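{- Let $X_{4n^2}=\begin{bmatrix} G & F & -F \\ E & A & B \\ -E & B & A \end{bmatrix}$ be constructed as in the context. Then it is balancedly splittable. In particular: (i) The submatrices $\left[\begin{smallmatrix} E & A & B\end{smallmatrix}\right]$ and $\left[\begin{smallmatrix} -E & B & A\end{smallmatrix}\right]$ induce an unstable split with $\alpha=-\beta=n$. (ii) The submatrices $\left[\begin{smallmatrix} F^* & A^* & B^*\end{smallmatrix}\right]^*$ and $\left[\begin{smallmatrix} -F^* & B^* & A^*\end{smallmatrix}\right]^*$ induce a stable split with $\alpha=-\beta=1$.
   Context: A QOD$(n;s_1,\dots,s_u)$ is a square matrix $X$ with entries in $\{0,\pm\varepsilon_\ell x_\ell,\pm\varepsilon_\ell x_\ell^*\mid\varepsilon_\ell\in\{1,i,j,k\}\}$ ($x_\ell$ complex indeterminates) with $XX^*=\sigma I_n$, $\sigma=\sum s_\ell|x_\ell|^2$; it is full if $\sum s_\ell=n$. A full QOD $X$ is balancedly splittable if it contains an $m\times n$ submatrix $X_1$ such that, for some $\alpha,\beta\in\mathbb{H}$: (unstable split) the off-diagonal entries of $X_1^*X_1$ lie in $\{\pm\varepsilon c\, x_1^{\ell_1}\cdots x_u^{\ell_u}(x_1^*)^{\ell'_1}\cdots(x_u^*)^{\ell'_u}\mid \ell_i,\ell'_i\ge0,\ \varepsilon\in\{1,i,j,k\},\ c\in\{\alpha,\alpha^*,\beta,\beta^*\}\}$; or (stable split) the off-diagonal entries of $X_1^*X_1$ lie in $\{\pm\varepsilon c\sigma\mid \varepsilon\in\{1,i,j,k\},c\in\{\alpha,\alpha^*,\beta,\beta^*\}\}$.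 (For a column-block submatrix $V$, the relevant Gram matrix is $VV^*$.) Construction: $X_n$ a full QOD$(n;s_1,\dots,s_u)$, $H_n$ a quaternionic Hadamard matrix of order $n$ (entries in $\{\pm1,\pm i,\pm j,\pm k\}$, $H_nH_n^*=nI_n$); $H_{2n}=\left[\begin{smallmatrix}1&1\\1&-1\end{smallmatrix}\right]\otimes H_n$, $X_{2n}=\left[\begin{smallmatrix}1&1\\1&-1\end{smallmatrix}\right]\otimes X_n$, with rows $h_i,\hat h_j,r_i,\hat r_j$ of $H_n,H_{2n},X_n,X_{2n}$. Set $C_i=h_i^*r_i$, $A=\mathrm{circ}(C_0,\dots,C_{n-1},C_{n-1},\dots,C_1)$, $B=\mathrm{circ}(C_0,\dots,C_{n-1},-C_{n-1},\dots,-C_1)$, $E_i=h_0^*\hat r_i$, $F_i=\hat h_i^*r_0$ ($1\le i\le 2n-1$), $E=[E_1^*\cdots E_{2n-1}^*]^*$, $F=[F_1\cdots F_{2n-1}]$, $G=\hat h_0^*\hat r_0$. This $X_{4n^2}$ is a QOD$(4n^2;4ns_1,\dots,4ns_u)$.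
   Formalization: In (ii) the stable split is stated with σ = Σ s_ℓ|x_ℓ|² of the initial design X_n, not the σ of X_{4n²} (which is 4n times larger); with the latter, α = −β = 1 would be false, e.g. for n = 1. -}

module Defs where

open import Data.Nat as ℕ using (ℕ; zero; suc; _<ᵇ_; _∸_)
open import Data.Nat.DivMod using (_%_; _mod_)
open import Data.Integer as ℤ using (ℤ; +_)
open import Data.Fin as Fin using (Fin; toℕ)
open import Data.Product using (_×_; _,_; ∃; ∃-syntax; swap)
open import Data.Sum using (_⊎_)
open import Data.Vec using (Vec; []; _∷_; map; zipWith)
open import Data.List as List using (List; concatMap; upTo; foldr)
open import Data.Bool using (Bool; true; false; if_then_else_; _∧_)
open import Relation.Binary.PropositionalEquality using (_≡_)
open import Relation.Nullary using (¬_)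
open import Relation.Nullary.Decidable using (⌊_⌋)

GI : Set
GI = ℤ × ℤ

0G 1G iG : GI
0G = (+ 0 , + 0)
1G = (+ 1 , + 0)
iG = (+ 0 , + 1)

_+G_ : GI → GI → GI
(a , b) +G (c , d) = (a ℤ.+ c , b ℤ.+ d)

_*G_ : GI → GI → GI
(a , b) *G (c , d) = (a ℤ.* c ℤ.- b ℤ.* d , a ℤ.* d ℤ.+ b ℤ.* c)

-G_ : GI → GI
-G (a , b) = (ℤ.- a , ℤ.- b)

conjG : GI → GI
conjG (a , b) = (a , ℤ.- b)

-- Polynomials in the commuting complex indeterminates x_ℓ, x_ℓ* (ℓ : Fin u)
-- with coefficients in ℤ[i].  An exponent vector records, for each ℓ,
-- the pair (exponent of x_ℓ , exponent of x_ℓ*).  A polynomial is its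
-- coefficient function; equality is coefficientwise.

Exp : ℕ → Set
Exp u = Vec (ℕ × ℕ) u

_==E_ : ∀ {u} → Exp u → Exp u → Bool
[] ==E [] = true
((a , b) ∷ e) ==E ((c , d) ∷ f) = (a ℕ.≡ᵇ c) ∧ (b ℕ.≡ᵇ d) ∧ (e ==E f)

zeroE : ∀ {u} → Exp u
zeroE {zero} = []
zeroE {suc u} = (0 , 0) ∷ zeroE

below : ∀ {u} → Exp u → List (Exp u)
below [] = [] List.∷ List.[]
below ((a , b) ∷ e) =
  concatMap (λ i → concatMap (λ j → List.map ((i , j) ∷_) (below e)) (upTo (suc b)))
            (upTo (suc a))

subE : ∀ {u} → Exp u → Exp u → Exp u
subE = zipWith (λ { (a , b) (c , d) → (a ∸ c , b ∸ d) })

Poly : ℕ → Set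
Poly u = Exp u → GI

_≈P_ : ∀ {u} → Poly u → Poly u → Set
p ≈P q = ∀ e → p e ≡ q e

0P : ∀ {u} → Poly u
0P _ = 0G

_+P_ : ∀ {u} → Poly u → Poly u → Poly u
(p +P q) e = p e +G q e

-P_ : ∀ {u} → Poly u → Poly u
(-P p) e = -G p e

_*P_ : ∀ {u} → Poly u → Poly u → Poly u
(p *P q) e = foldr (λ d acc → (p d *G q (subE e d)) +G acc) 0G (below e)

conjP : ∀ {u} → Poly u → Poly u
conjP p e = conjG (p (map swap e))

constP : ∀ {u} → GI → Poly u
constP g e = if e ==E zeroE then g else 0G

mono : ∀ {u} → Exp u → Poly u
mono e f = if e ==E f then 1G else 0G

unitE : ∀ {u} → Fin u → ℕ × ℕ → Exp u
unitE {suc u} Fin.zero p = p ∷ zeroE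
unitE {suc u} (Fin.suc ℓ) p = (0 , 0) ∷ unitE ℓ p

-- Quaternionic polynomials p + q j  (p q complex polynomials),
-- using j z = z* j for complex z.

QP : ℕ → Set
QP u = Poly u × Poly u

_≈Q_ : ∀ {u} → QP u → QP u → Set
(p , q) ≈Q (r , s) = (p ≈P r) × (q ≈P s)

0Q : ∀ {u} → QP u
0Q = (0P , 0P)

_+Q_ : ∀ {u} → QP u → QP u → QP u
(p , q) +Q (r , s) = (p +P r , q +P s)

-Q_ : ∀ {u} → QP u → QP u
-Q (p , q) = (-P p , -P q)

_*Q_ : ∀ {u} → QP u → QP u → QP u
(p , q) *Q (r , s) = ((p *P r) +P (-P (q *P conjP s)) , (p *P s) +P (q *P conjP r))

conjQ : ∀ {u} → QP u → QP u
conjQ (p , q) = (conjP p , -P q)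

natQ : ∀ {u} → ℕ → QP u
natQ n = (constP (+ n , + 0) , 0P)

sumFin : ∀ {k} {A : Set} → (A → A → A) → A → (Fin k → A) → A
sumFin {zero} _⊕_ z f = z
sumFin {suc k} _⊕_ z f = f Fin.zero ⊕ sumFin _⊕_ z (λ i → f (Fin.suc i))

ΣQ : ∀ {u k} → (Fin k → QP u) → QP u
ΣQ = sumFin _+Q_ 0Q

ΣN : ∀ {k} → (Fin k → ℕ) → ℕ
ΣN = sumFin ℕ._+_ 0

σ : ∀ {u} → (Fin u → ℕ) → QP u
σ s = ΣQ (λ ℓ → natQ (s ℓ) *Q (mono (unitE ℓ (1 , 1)) , 0P))

data Sgn : Set where
  plus minus : Sgn

sgnQ : ∀ {u} → Sgn → QP u → QP u
sgnQ plus x = x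
sgnQ minus x = -Q x

data Unit4 : Set where
  𝟙 𝕚 𝕛 𝕜 : Unit4

unitQ : ∀ {u} → Unit4 → QP u
unitQ 𝟙 = (constP 1G , 0P)
unitQ 𝕚 = (constP iG , 0P)
unitQ 𝕛 = (0P , constP 1G)
unitQ 𝕜 = (0P , constP iG)   -- k = i j

varQ : ∀ {u} → Fin u → Bool → QP u
varQ ℓ false = (mono (unitE ℓ (1 , 0)) , 0P)
varQ ℓ true  = (mono (unitE ℓ (0 , 1)) , 0P)

data QEntry (u : ℕ) : Set where
  zer : QEntry u
  ent : Sgn → Unit4 → Fin u → Bool → QEntry u

⟦_⟧E : ∀ {u} → QEntry u → QP u
⟦ zer ⟧E = 0Q
⟦ ent s ε ℓ b ⟧E = sgnQ s (unitQ ε *Q varQ ℓ b)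

HEntry : Set
HEntry = Sgn × Unit4

⟦_⟧H : ∀ {u} → HEntry → QP u
⟦ (s , ε) ⟧H = sgnQ s (unitQ ε)

_==F_ : ∀ {n} → Fin n → Fin n → Bool
a ==F b = ⌊ a Fin.≟ b ⌋

IsQOD : ∀ {u} (n : ℕ) → (Fin u → ℕ) → (Fin n → Fin n → QEntry u) → Set
IsQOD n s X = ∀ a b →
  ΣQ (λ c → ⟦ X a c ⟧E *Q conjQ ⟦ X b c ⟧E) ≈Q (if a ==F b then σ s else 0Q)

IsFullQOD : ∀ {u} (n : ℕ) → (Fin u → ℕ) → (Fin n → Fin n → QEntry u) → Set
IsFullQOD n s X = IsQOD n s X × (ΣN s ≡ n)

-- H H* = n I_n  (computed in the same algebra, u is irrelevant)
IsQHadamard : (n : ℕ) → (Fin n → Fin n → HEntry) → Set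
IsQHadamard n H = ∀ a b →
  ΣQ {0} (λ c → ⟦ H a c ⟧H *Q conjQ ⟦ H b c ⟧H) ≈Q (if a ==F b then natQ n else 0Q)

-- The construction of X_{4n²}, for n = suc m.
-- Index set: 2n + (2n−1)n + (2n−1)n, in the block order of the paper.

data Idx (m : ℕ) : Set where
  top : Fin (suc m ℕ.+ suc m) → Idx m
  mid : Fin (suc (m ℕ.+ m)) → Fin (suc m) → Idx m  -- (block t, position) in 2nd block
  bot : Fin (suc (m ℕ.+ m)) → Fin (suc m) → Idx m  -- (block t, position) in 3rd block

module Construction {u m : ℕ}
  (X : Fin (suc m) → Fin (suc m) → QEntry u)
  (H : Fin (suc m) → Fin (suc m) → HEntry) where

  N D : ℕ
  N = suc m
  D = suc (m ℕ.+ m)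

  fN : ℕ → Fin N
  fN k = k mod N

  Xq Hq : Fin N → Fin N → QP u
  Xq a b = ⟦ X a b ⟧E
  Hq a b = ⟦ H a b ⟧H

  -- [[1,1],[1,−1]] ⊗ Y, rows/columns indexed by 0..2n−1
  kron : (Fin N → Fin N → QP u) → ℕ → ℕ → QP u
  kron Y p q with p <ᵇ N | q <ᵇ N
  ... | false | false = -Q Y (fN p) (fN q)
  ... | _     | _     = Y (fN p) (fN q)

  Xh Hh : ℕ → ℕ → QP u
  Xh = kron Xq
  Hh = kron Hq

  C : Fin N → Fin N → Fin N → QP u
  C t a c = conjQ (Hq t a) *Q Xq t c

  -- t-th block of circ(C_0..C_{n−1}, ±C_{n−1}..±C_1), 0 ≤ t < 2n−1
  circBlock : Sgn → ℕ → Fin N → Fin N → QP u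
  circBlock s t a c = if t <ᵇ N then C (fN t) a c else sgnQ s (C (fN (D ∸ t)) a c)

  shift : Fin D → Fin D → ℕ
  shift p q = (toℕ q ℕ.+ D ∸ toℕ p) % D

  Ablk Bblk : Fin D → Fin N → Fin D → Fin N → QP u
  Ablk p a q c = circBlock plus (shift p q) a c
  Bblk p a q c = circBlock minus (shift p q) a c

  -- E_{i} = h_0* r̂_i, F_i = ĥ_i* r_0 (1 ≤ i ≤ 2n−1; i = 1 + block index), G = ĥ_0* r̂_0
  Eb : Fin D → Fin N → Fin (N ℕ.+ N) → QP u
  Eb i a q = conjQ (Hq Fin.zero a) *Q Xh (suc (toℕ i)) (toℕ q)

  Fb : Fin (N ℕ.+ N) → Fin D → Fin N → QP u
  Fb p i c = conjQ (Hh (suc (toℕ i)) (toℕ p)) *Q Xq Fin.zero c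

  Gb : Fin (N ℕ.+ N) → Fin (N ℕ.+ N) → QP u
  Gb p q = conjQ (Hh 0 (toℕ p)) *Q Xh 0 (toℕ q)

  X4 : Idx m → Idx m → QP u
  X4 (top p)   (top q)   = Gb p q
  X4 (top p)   (mid j c) = Fb p j c
  X4 (top p)   (bot j c) = -Q Fb p j c
  X4 (mid i a) (top q)   = Eb i a q
  X4 (mid i a) (mid j c) = Ablk i a j c
  X4 (mid i a) (bot j c) = Bblk i a j c
  X4 (bot i a) (top q)   = -Q Eb i a q
  X4 (bot i a) (mid j c) = Bblk i a j c
  X4 (bot i a) (bot j c) = Ablk i a j c

  ΣDN : ((Fin D → Fin N → QP u)) → QP u
  ΣDN f = ΣQ (λ i → ΣQ (λ a → f i a))

  gramRowsMid gramRowsBot : Idx m → Idx m → QP u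
  gramRowsMid p q = ΣDN (λ i a → conjQ (X4 (mid i a) p) *Q X4 (mid i a) q)
  gramRowsBot p q = ΣDN (λ i a → conjQ (X4 (bot i a) p) *Q X4 (bot i a) q)

  gramColsMid gramColsBot : Idx m → Idx m → QP u
  gramColsMid p q = ΣDN (λ j c → X4 p (mid j c) *Q conjQ (X4 q (mid j c)))
  gramColsBot p q = ΣDN (λ j c → X4 p (bot j c) *Q conjQ (X4 q (bot j c)))

-- Splits.  α, β are quaternion constants a + b j with a, b ∈ ℤ[i].

QC : Set
QC = GI × GI

qcQ : ∀ {u} → QC → QP u
qcQ (a , b) = (constP a , constP b)

data Pick : Set where
  pα pα* pβ pβ* : Pick

pick : ∀ {u} → QC → QC → Pick → QP u
pick α β pα  = qcQ α
pick α β pα* = conjQ (qcQ α)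
pick α β pβ  = qcQ β
pick α β pβ* = conjQ (qcQ β)

UnstableEntry : ∀ {u} → QC → QC → QP u → Set
UnstableEntry α β e =
  ∃[ s ] ∃[ ε ] ∃[ c ] ∃[ ex ]
    (e ≈Q sgnQ s ((unitQ ε *Q pick α β c) *Q (mono ex , 0P)))

StableEntry : ∀ {u} → (Fin u → ℕ) → QC → QC → QP u → Set
StableEntry s0 α β e =
  ∃[ s ] ∃[ ε ] ∃[ c ] (e ≈Q sgnQ s ((unitQ ε *Q pick α β c) *Q σ s0))

OffDiag : {I : Set} → (I → I → Set) → Set
OffDiag {I} P = ∀ (p q : I) → ¬ (p ≡ q) → P p q

Injective : ∀ {k} {I : Set} → (Fin k → I) → Set
Injective R = ∀ a b → R a ≡ R b → a ≡ b

rowGram : ∀ {u k} {I : Set} → (I → I → QP u) → (Fin k → I) → I → I → QP u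
rowGram Y R p q = ΣQ (λ r → conjQ (Y (R r) p) *Q Y (R r) q)

colGram : ∀ {u k} {I : Set} → (I → I → QP u) → (Fin k → I) → I → I → QP u
colGram Y R p q = ΣQ (λ r → Y p (R r) *Q conjQ (Y q (R r)))

IsSplit : ∀ {u} {I : Set} → (Fin u → ℕ) → QC → QC → (I → I → QP u) → Set
IsSplit s α β M = OffDiag (λ p q → UnstableEntry α β (M p q))
                ⊎ OffDiag (λ p q → StableEntry s α β (M p q))

BalancedlySplittable : ∀ {u} {I : Set} → (Fin u → ℕ) → (I → I → QP u) → Set
BalancedlySplittable {u} {I} s Y =
  ∃[ k ] ∃[ R ] ∃[ α ] ∃[ β ] (Injective {k} {I} R ×
    (IsSplit s α β (rowGram Y R) ⊎ IsSplit s α β (colGram Y R)))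

intQC : ℤ → QC
intQC z = ((z , + 0) , (+ 0 , + 0))

{-# OPTIONS --safe #-}
-- The rows of the block row [E A B], read column by column, are products
-- h_t* y in which h_t is a row of H, so row orthogonality of H collapses the Gram
-- matrix to n Σ y_p* y_q over the block rows in which the columns p and q carry
-- the same t.  For block columns of the circulants in different positions there
-- is exactly one such block row, because the order 2n − 1 is odd; in the remaining
-- cases the sum is, up to one term, an inner product of columns of X (or of the
-- doubled X), which vanishes.  Exchanging the roles of X and H gives the
-- other split, with σ in place of n.
--
-- Both cases need XX* = σI ⇒ X*X = σI, without division.  With Z = X*X − σI one
-- has XZ = 0, hence Z² = −σZ, and tr Z = 0, so Σ Z_ab Z_ab* = 0.  This forces
-- Z = 0 since in ℤ[i][[x, x*]] a sum Σ p p* vanishes only if every p does: at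
-- the least total degree d of the p's, the coefficient of x^d x*^d is a sum of squares.
module Submission where

open import Defs
open import Algebra.Bundles using (CommutativeRing; Ring)
open import Algebra.Structures using (IsCommutativeRing; IsRing)
open import Data.Nat as ℕ using (ℕ; zero; suc; _∸_; _<_; _≤_; z≤n; s≤s; s≤s⁻¹)
import Data.Nat.Properties as ℕₚ
open import Data.Integer as ℤ using (ℤ)
import Data.Integer.Properties as ℤₚ
open import Data.Fin as Fin using (Fin; toℕ)
import Data.Fin.Properties as Finₚ
open import Data.Bool using (Bool; true; false; if_then_else_; _∧_; T)
open import Data.Product using (_×_; _,_; ∃; ∃-syntax; swap; proj₁; proj₂)
open import Data.Sum using (_⊎_; inj₁; inj₂)
open import Data.List as List using (List; []; _∷_; _++_; foldr; concatMap; upTo; applyUpTo)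
open import Data.List.Relation.Unary.All as All using (All; []; _∷_)
import Data.List.Relation.Unary.All.Properties as Allₚ
open import Data.Vec as Vec using (_∷_; [])
open import Data.Empty using (⊥-elim)
open import Function using (_∘_; id)
open import Level using (0ℓ)
open import Relation.Nullary using (¬_; yes; no; Dec)
open import Relation.Binary.PropositionalEquality as ≡ using (_≡_; _≢_; refl; cong; cong₂; sym; trans; subst)
open import Data.Maybe using (just; nothing)

-- The entries do not commute, so even tr X*X = tr XX* needs an argument; it holds because x*x = xx*
-- for each single entry. This property and the positivity of Σ xx* are the only special facts about
-- quaternion polynomials that the matrix argument uses. They are made axioms of a star ring, and
-- one Gram computation over any star ring then serves both splits. Orthogonality alone does not
-- give the unstable split: it leaves n y*y′ for two entries y, y′ of X, and this is ±εn times a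
-- monomial only if neither is zero. Fullness excludes zeros: the |x_ℓ|² in a diagonal entry of XX*
-- count the nonzero entries of a row, and in σ they count Σ s_ℓ = n. The hypothesis on H lives in
-- the algebra without indeterminates. It is moved to the algebra of X through quaternion constants,
-- which that algebra determines faithfully.

module ListSum (R : Ring 0ℓ 0ℓ) where
  open Ring R renaming (refl to ≈-refl; sym to ≈-sym; trans to ≈-trans)
  open import Algebra.Properties.CommutativeSemigroup +-commutativeSemigroup using (interchange)

  -- Unfolds to the same foldr as the product _*P_.
  ∑ : {A : Set} → List A → (A → Carrier) → Carrier
  ∑ xs f = foldr (λ d acc → f d + acc) 0# xs

  ∑-cong : {A : Set} (xs : List A) {f g : A → Carrier} → (∀ x → f x ≈ g x) → ∑ xs f ≈ ∑ xs g
  ∑-cong []       e = ≈-refl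
  ∑-cong (x ∷ xs) e = +-cong (e x) (∑-cong xs e)

  ∑-All-cong : {A : Set} (xs : List A) {f g : A → Carrier} → All (λ x → f x ≈ g x) xs → ∑ xs f ≈ ∑ xs g
  ∑-All-cong []       []       = ≈-refl
  ∑-All-cong (x ∷ xs) (e ∷ es) = +-cong e (∑-All-cong xs es)

  ∑-0 : {A : Set} (xs : List A) → ∑ xs (λ _ → 0#) ≈ 0#
  ∑-0 []       = ≈-refl
  ∑-0 (x ∷ xs) = ≈-trans (+-identityˡ _) (∑-0 xs)

  ∑-+ : {A : Set} (xs : List A) (f g : A → Carrier) → ∑ xs (λ x → f x + g x) ≈ ∑ xs f + ∑ xs g
  ∑-+ []       f g = ≈-sym (+-identityˡ _)
  ∑-+ (x ∷ xs) f g = ≈-trans (+-congˡ (∑-+ xs f g)) (interchange _ _ _ _)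

  ∑-swap : {A B : Set} (xs : List A) (ys : List B) (f : A → B → Carrier) →
           ∑ xs (λ x → ∑ ys (f x)) ≈ ∑ ys (λ y → ∑ xs (λ x → f x y))
  ∑-swap []       ys f = ≈-sym (∑-0 ys)
  ∑-swap (x ∷ xs) ys f = ≈-trans (+-congˡ (∑-swap xs ys f)) (≈-sym (∑-+ ys _ _))

  ∑-++ : {A : Set} (xs ys : List A) (f : A → Carrier) → ∑ (xs ++ ys) f ≈ ∑ xs f + ∑ ys f
  ∑-++ []       ys f = ≈-sym (+-identityˡ _)
  ∑-++ (x ∷ xs) ys f = ≈-trans (+-congˡ (∑-++ xs ys f)) (≈-sym (+-assoc _ _ _))

  ∑-concatMap : {A B : Set} (g : A → List B) (xs : List A) (f : B → Carrier) →
                ∑ (concatMap g xs) f ≈ ∑ xs (λ x → ∑ (g x) f)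
  ∑-concatMap g []       f = ≈-refl
  ∑-concatMap g (x ∷ xs) f = ≈-trans (∑-++ (g x) _ f) (+-congˡ (∑-concatMap g xs f))

  ∑-map : {A B : Set} (g : A → B) (xs : List A) (f : B → Carrier) → ∑ (List.map g xs) f ≈ ∑ xs (f ∘ g)
  ∑-map g []       f = ≈-refl
  ∑-map g (x ∷ xs) f = +-congˡ (∑-map g xs f)

-- `definite` speaks of sums over lists, not of single squares: in this form it survives the
-- adjunction of a variable and the passage from complex to quaternionic coefficients, and it
-- applies to the sum over all entries of a matrix.
record IsStarRing (R : Ring 0ℓ 0ℓ) (_⋆ : Ring.Carrier R → Ring.Carrier R) : Set where
  open Ring R using (Carrier; _≈_; _+_; _*_; 0#)
  open ListSum R using (∑)
  field
    ⋆-cong   : ∀ {x y} → x ≈ y → (x ⋆) ≈ (y ⋆)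
    ⋆-+      : ∀ x y → ((x + y) ⋆) ≈ ((x ⋆) + (y ⋆))
    ⋆-*      : ∀ x y → ((x * y) ⋆) ≈ ((y ⋆) * (x ⋆))
    ⋆-⋆      : ∀ x → ((x ⋆) ⋆) ≈ x
    normal   : ∀ x → ((x ⋆) * x) ≈ (x * (x ⋆))
    definite : ∀ xs → ∑ xs (λ x → x * (x ⋆)) ≈ 0# → All (λ x → x ≈ 0#) xs

-- Formal power series over a commutative ring.

module PowerSeries (R : CommutativeRing 0ℓ 0ℓ) where
  open CommutativeRing R renaming (refl to ≈-refl; sym to ≈-sym; trans to ≈-trans)
  open import Algebra.Properties.CommutativeSemigroup +-commutativeSemigroup using (interchange; x∙yz≈y∙xz)
  open import Relation.Binary.Reasoning.Setoid setoid
  open ListSum ring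

  Series : Set
  Series = ℕ → Carrier

  infix 4 _≋_
  _≋_ : Series → Series → Set
  f ≋ g = ∀ n → f n ≈ g n

  infixl 7 _⊛_
  -- The Cauchy product, by splitting off the constant term of the first factor: f = f₀ + x f′. The
  -- ring laws then follow by induction on the degree, without manipulating indexed sums.
  _⊛_ : Series → Series → Series
  (f ⊛ g) zero    = f 0 * g 0
  (f ⊛ g) (suc n) = f 0 * g (suc n) + ((f ∘ suc) ⊛ g) n

  _⊞_ : Series → Series → Series
  (f ⊞ g) n = f n + g n

  term : ℕ → Carrier → Series
  term zero    c zero    = c
  term zero    c (suc n) = 0#
  term (suc k) c zero    = 0#
  term (suc k) c (suc n) = term k c n

  ⊛-cong : ∀ {f f′ g g′} → f ≋ f′ → g ≋ g′ → f ⊛ g ≋ f′ ⊛ g′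
  ⊛-cong p q zero    = *-cong (p 0) (q 0)
  ⊛-cong p q (suc n) = +-cong (*-cong (p 0) (q (suc n))) (⊛-cong (p ∘ suc) q n)

  ⊛-distribʳ : ∀ h f g → (f ⊞ g) ⊛ h ≋ (f ⊛ h) ⊞ (g ⊛ h)
  ⊛-distribʳ h f g zero    = distribʳ _ _ _
  ⊛-distribʳ h f g (suc n) =
    ≈-trans (+-cong (distribʳ _ _ _) (⊛-distribʳ h (f ∘ suc) (g ∘ suc) n)) (interchange _ _ _ _)

  ⊛-scale : ∀ c f g → (λ n → c * f n) ⊛ g ≋ (λ n → c * (f ⊛ g) n)
  ⊛-scale c f g zero    = *-assoc _ _ _
  ⊛-scale c f g (suc n) = ≈-trans (+-cong (*-assoc _ _ _) (⊛-scale c (f ∘ suc) g n)) (≈-sym (distribˡ _ _ _))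

  -- The mirror image of the defining recursion, splitting off the constant term of `g`;
  -- commutativity results from comparing the two.
  ⊛-suc : ∀ f g n → (f ⊛ g) (suc n) ≈ f (suc n) * g 0 + (f ⊛ (g ∘ suc)) n
  ⊛-suc f g zero    = +-comm _ _
  ⊛-suc f g (suc n) = ≈-trans (+-congˡ (⊛-suc (f ∘ suc) g n)) (x∙yz≈y∙xz _ _ _)

  ⊛-comm : ∀ f g → f ⊛ g ≋ g ⊛ f
  ⊛-comm f g zero    = *-comm _ _
  ⊛-comm f g (suc n) = ≈-trans (+-cong (*-comm _ _) (⊛-comm (f ∘ suc) g n)) (≈-sym (⊛-suc g f n))

  ⊛-assoc : ∀ f g h → (f ⊛ g) ⊛ h ≋ f ⊛ (g ⊛ h)
  ⊛-assoc f g h zero    = *-assoc _ _ _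
  ⊛-assoc f g h (suc n) = begin
    (f 0 * g 0) * h (suc n) + (((λ k → f 0 * g (suc k)) ⊞ ((f ∘ suc) ⊛ g)) ⊛ h) n
      ≈⟨ +-cong (*-assoc _ _ _) (⊛-distribʳ h _ _ n) ⟩
    f 0 * (g 0 * h (suc n)) + (((λ k → f 0 * g (suc k)) ⊛ h) n + (((f ∘ suc) ⊛ g) ⊛ h) n)
      ≈⟨ +-congˡ (+-cong (⊛-scale (f 0) (g ∘ suc) h n) (⊛-assoc (f ∘ suc) g h n)) ⟩
    f 0 * (g 0 * h (suc n)) + (f 0 * ((g ∘ suc) ⊛ h) n + ((f ∘ suc) ⊛ (g ⊛ h)) n)
      ≈⟨ +-assoc _ _ _ ⟨
    (f 0 * (g 0 * h (suc n)) + f 0 * ((g ∘ suc) ⊛ h) n) + ((f ∘ suc) ⊛ (g ⊛ h)) n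
      ≈⟨ +-congʳ (distribˡ _ _ _) ⟨
    f 0 * (g ⊛ h) (suc n) + ((f ∘ suc) ⊛ (g ⊛ h)) n ∎

  ⊛-zeroˡ : ∀ f g n → (∀ k → k ≤ n → f k ≈ 0#) → (f ⊛ g) n ≈ 0#
  ⊛-zeroˡ f g zero    z = ≈-trans (*-congʳ (z 0 z≤n)) (zeroˡ _)
  ⊛-zeroˡ f g (suc n) z = ≈-trans
    (+-cong (≈-trans (*-congʳ (z 0 z≤n)) (zeroˡ _)) (⊛-zeroˡ (f ∘ suc) g n (λ k k≤n → z (suc k) (s≤s k≤n))))
    (+-identityˡ _)

  term-⊛ : ∀ c g → term 0 c ⊛ g ≋ (λ n → c * g n)
  term-⊛ c g zero    = ≈-refl
  term-⊛ c g (suc n) = ≈-trans (+-congˡ (⊛-zeroˡ _ g n (λ _ _ → ≈-refl))) (+-identityʳ _)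

  term-cong : ∀ k {c d} → c ≈ d → term k c ≋ term k d
  term-cong zero    e zero    = e
  term-cong zero    e (suc n) = ≈-refl
  term-cong (suc k) e zero    = ≈-refl
  term-cong (suc k) e (suc n) = term-cong k e n

  scale-term : ∀ c k d → (λ n → c * term k d n) ≋ term k (c * d)
  scale-term c zero    d zero    = ≈-refl
  scale-term c zero    d (suc n) = zeroʳ c
  scale-term c (suc k) d zero    = zeroʳ c
  scale-term c (suc k) d (suc n) = scale-term c k d n

  term-*-term : ∀ j c k d → term j c ⊛ term k d ≋ term (j ℕ.+ k) (c * d)
  term-*-term zero    c k d n       = ≈-trans (term-⊛ c (term k d) n) (scale-term c k d n)
  term-*-term (suc j) c k d zero    = zeroˡ _
  term-*-term (suc j) c k d (suc n) =
    ≈-trans (+-cong (zeroˡ _) (term-*-term j c k d n)) (+-identityˡ _)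

  ⊛-identityˡ : ∀ f → term 0 1# ⊛ f ≋ f
  ⊛-identityˡ f n = ≈-trans (term-⊛ 1# f n) (*-identityˡ _)

  -- Every other term of the convolution uses an index below `a` in `f` or below `b` in `g`. It
  -- isolates the squares in the positivity argument.
  ⊛-lowest : ∀ a b f g → (∀ j → j < a → f j ≈ 0#) → (∀ j → j < b → g j ≈ 0#) →
             (f ⊛ g) (a ℕ.+ b) ≈ f a * g b
  ⊛-lowest zero    zero    f g p q = ≈-refl
  ⊛-lowest zero    (suc b) f g p q = ≈-trans
    (+-congˡ (≈-trans (⊛-comm (f ∘ suc) g b) (⊛-zeroˡ g _ b (λ k k≤b → q k (s≤s k≤b))))) (+-identityʳ _)
  ⊛-lowest (suc a) b f g p q = ≈-trans
    (+-cong (≈-trans (*-congʳ (p 0 (s≤s z≤n))) (zeroˡ _)) (⊛-lowest a b (f ∘ suc) g (λ j j<a → p (suc j) (s≤s j<a)) q))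
    (+-identityˡ _)

  ⊛-as-∑ : ∀ f g n → ∑ (upTo (suc n)) (λ k → f k * g (n ∸ k)) ≈ (f ⊛ g) n
  ⊛-as-∑ f g n = go n f id _ (λ _ → ≈-refl)
    where
    -- `upTo` unfolds to `applyUpTo id`, whose recursion changes the enumerating function; hence `φ`
    -- moves along with the tails of `f` while the summand `h` stays fixed.
    go : ∀ n f (φ : ℕ → ℕ) (h : ℕ → Carrier) → (∀ k → h (φ k) ≈ f k * g (n ∸ k)) →
         ∑ (applyUpTo φ (suc n)) h ≈ (f ⊛ g) n
    go zero    f φ h e = ≈-trans (+-congʳ (e 0)) (+-identityʳ _)
    go (suc n) f φ h e = +-cong (e 0) (go n (f ∘ suc) (φ ∘ suc) h (e ∘ suc))

  isCommutativeRing-⊛ : IsCommutativeRing _≋_ _⊞_ _⊛_ (λ f n → - f n) (λ _ → 0#) (term 0 1#)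
  isCommutativeRing-⊛ = record
    { isRing = record
      { +-isAbelianGroup = record
        { isGroup = record
          { isMonoid = record
            { isSemigroup = record
              { isMagma = record
                { isEquivalence = record
                  { refl = λ _ → ≈-refl ; sym = λ e n → ≈-sym (e n) ; trans = λ e e′ n → ≈-trans (e n) (e′ n) }
                ; ∙-cong = λ e e′ n → +-cong (e n) (e′ n) }
              ; assoc = λ f g h n → +-assoc _ _ _ }
            ; identity = (λ f n → +-identityˡ _) , (λ f n → +-identityʳ _) }
          ; inverse = (λ f n → -‿inverseˡ _) , (λ f n → -‿inverseʳ _)
          ; ⁻¹-cong = λ e n → -‿cong (e n) }
        ; comm = λ f g n → +-comm _ _ }
      ; *-cong = ⊛-cong
      ; *-assoc = ⊛-assoc
      ; *-identity = ⊛-identityˡ , (λ f n → ≈-trans (⊛-comm f (term 0 1#) n) (⊛-identityˡ f n))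
      ; distrib = (λ h f g n → ≈-trans (⊛-comm h (f ⊞ g) n)
                    (≈-trans (⊛-distribʳ h f g n) (+-cong (⊛-comm f h n) (⊛-comm g h n))))
                , ⊛-distribʳ }
    ; *-comm = ⊛-comm }

  series : CommutativeRing 0ℓ 0ℓ
  series = record { isCommutativeRing = isCommutativeRing-⊛ }

-- Gaussian integers and their norm.

isCommutativeRing-G : IsCommutativeRing _≡_ _+G_ _*G_ -G_ 0G 1G
isCommutativeRing-G = record
  { isRing = record
    { +-isAbelianGroup = record
      { isGroup = record
        { isMonoid = record
          { isSemigroup = record
            { isMagma = record { isEquivalence = ≡.isEquivalence ; ∙-cong = cong₂ _+G_ }
            ; assoc = λ { (a , b) (c , d) (e , f) → cong₂ _,_ (ℤₚ.+-assoc a c e) (ℤₚ.+-assoc b d f) } }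
          ; identity = (λ x → cong₂ _,_ (ℤₚ.+-identityˡ _) (ℤₚ.+-identityˡ _))
                     , (λ x → cong₂ _,_ (ℤₚ.+-identityʳ _) (ℤₚ.+-identityʳ _)) }
        ; inverse = (λ { (a , b) → cong₂ _,_ (ℤₚ.+-inverseˡ a) (ℤₚ.+-inverseˡ b) })
                  , (λ { (a , b) → cong₂ _,_ (ℤₚ.+-inverseʳ a) (ℤₚ.+-inverseʳ b) })
        ; ⁻¹-cong = cong -G_ }
      ; comm = λ { (a , b) (c , d) → cong₂ _,_ (ℤₚ.+-comm a c) (ℤₚ.+-comm b d) } }
    ; *-cong = cong₂ _*G_
    ; *-assoc = λ { (a , b) (c , d) (e , f) → cong₂ _,_ (assoc₁ a b c d e f) (assoc₂ a b c d e f) }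
    ; *-identity = (λ { (a , b) → cong₂ _,_ (idˡ₁ a b) (idˡ₂ a b) })
                 , (λ { (a , b) → cong₂ _,_ (idʳ₁ a b) (idʳ₂ a b) })
    ; distrib = (λ { (a , b) (c , d) (e , f) → cong₂ _,_ (dˡ₁ a b c d e f) (dˡ₂ a b c d e f) })
              , (λ { (a , b) (c , d) (e , f) → cong₂ _,_ (dʳ₁ a b c d e f) (dʳ₂ a b c d e f) }) }
  ; *-comm = λ { (a , b) (c , d) → cong₂ _,_ (comm₁ a b c d) (comm₂ a b c d) } }
  where
  open import Data.Integer using (_+_; _*_; _-_; -_)
  open import Data.Integer.Tactic.RingSolver using (solve-∀)
  assoc₁ : ∀ a b c d e f → (a * c - b * d) * e - (a * d + b * c) * f ≡ a * (c * e - d * f) - b * (c * f + d * e)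
  assoc₁ = solve-∀
  assoc₂ : ∀ a b c d e f → (a * c - b * d) * f + (a * d + b * c) * e ≡ a * (c * f + d * e) + b * (c * e - d * f)
  assoc₂ = solve-∀
  idˡ₁ : ∀ a b → ℤ.+ 1 * a - ℤ.+ 0 * b ≡ a
  idˡ₁ = solve-∀
  idˡ₂ : ∀ a b → ℤ.+ 1 * b + ℤ.+ 0 * a ≡ b
  idˡ₂ = solve-∀
  idʳ₁ : ∀ a b → a * ℤ.+ 1 - b * ℤ.+ 0 ≡ a
  idʳ₁ = solve-∀
  idʳ₂ : ∀ a b → a * ℤ.+ 0 + b * ℤ.+ 1 ≡ b
  idʳ₂ = solve-∀
  dˡ₁ : ∀ a b c d e f → a * (c + e) - b * (d + f) ≡ (a * c - b * d) + (a * e - b * f)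
  dˡ₁ = solve-∀
  dˡ₂ : ∀ a b c d e f → a * (d + f) + b * (c + e) ≡ (a * d + b * c) + (a * f + b * e)
  dˡ₂ = solve-∀
  dʳ₁ : ∀ a b c d e f → (c + e) * a - (d + f) * b ≡ (c * a - d * b) + (e * a - f * b)
  dʳ₁ = solve-∀
  dʳ₂ : ∀ a b c d e f → (c + e) * b + (d + f) * a ≡ (c * b + d * a) + (e * b + f * a)
  dʳ₂ = solve-∀
  comm₁ : ∀ a b c d → a * c - b * d ≡ c * a - d * b
  comm₁ = solve-∀
  comm₂ : ∀ a b c d → a * d + b * c ≡ c * b + d * a
  comm₂ = solve-∀

gaussRing : CommutativeRing 0ℓ 0ℓ
gaussRing = record { isCommutativeRing = isCommutativeRing-G }

module G where
  open CommutativeRing gaussRing public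
  open ListSum ring public

conjG-+ : ∀ x y → conjG (x +G y) ≡ conjG x +G conjG y
conjG-+ (a , b) (c , d) = cong (_ ,_) (ℤₚ.neg-distrib-+ b d)

conjG-* : ∀ x y → conjG (x *G y) ≡ conjG x *G conjG y
conjG-* (a , b) (c , d) = cong₂ _,_ (re a b c d) (im a b c d)
  where
  open import Data.Integer using (_+_; _*_; _-_; -_)
  open import Data.Integer.Tactic.RingSolver using (solve-∀)
  re : ∀ a b c d → a * c - b * d ≡ a * c - (- b) * (- d)
  re = solve-∀
  im : ∀ a b c d → - (a * d + b * c) ≡ a * (- d) + (- b) * c
  im = solve-∀

conjG-conjG : ∀ x → conjG (conjG x) ≡ x
conjG-conjG (a , b) = cong (a ,_) (ℤₚ.neg-involutive b)

normG : GI → ℕ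
normG (a , b) = ℤ.∣ a ∣ ℕ.* ℤ.∣ a ∣ ℕ.+ ℤ.∣ b ∣ ℕ.* ℤ.∣ b ∣

re-*-conjG : ∀ x → proj₁ (x *G conjG x) ≡ ℤ.+ normG x
re-*-conjG (a , b) = trans (flip a b)
  (trans (cong₂ ℤ._+_ (square a) (square b)) (sym (ℤₚ.pos-+ (ℤ.∣ a ∣ ℕ.* ℤ.∣ a ∣) _)))
  where
  open import Data.Integer using (_+_; _*_; _-_; -_)
  open import Data.Integer.Tactic.RingSolver using (solve-∀)
  flip : ∀ a b → a * a - b * (- b) ≡ a * a + b * b
  flip = solve-∀
  square : ∀ a → a * a ≡ ℤ.+ (ℤ.∣ a ∣ ℕ.* ℤ.∣ a ∣)
  square (ℤ.+ n)      = sym (ℤₚ.pos-* n n)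
  square (ℤ.-[1+ n ]) = refl

normG≡0 : ∀ x → normG x ≡ 0 → x ≡ 0G
normG≡0 (a , b) e = cong₂ _,_
  (root a (ℕₚ.m+n≡0⇒m≡0 _ e)) (root b (ℕₚ.m+n≡0⇒n≡0 (ℤ.∣ a ∣ ℕ.* ℤ.∣ a ∣) e))
  where
  root : ∀ a → ℤ.∣ a ∣ ℕ.* ℤ.∣ a ∣ ≡ 0 → a ≡ ℤ.+ 0
  root (ℤ.+ zero) e = refl

-- The polynomial ring as an iterated ring of power series.

curryP : ∀ {u} → Poly (suc u) → ℕ → ℕ → Poly u
curryP p a b e = p ((a , b) ∷ e)

foldr-eval : ∀ {u} {A : Set} (xs : List A) (f : A → Poly u) e →
             foldr (λ d acc → f d +P acc) 0P xs e ≡ G.∑ xs (λ d → f d e)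
foldr-eval []       f e = refl
foldr-eval (x ∷ xs) f e = cong (f x e +G_) (foldr-eval xs f e)

-- The index set of the coefficient sum defining _*P_ is a product, so the sum
-- can be taken over the exponents of the first variable first.
curryP-* : ∀ {u} (p q : Poly (suc u)) a b e → (p *P q) ((a , b) ∷ e) ≡
  G.∑ (upTo (suc a)) (λ i → G.∑ (upTo (suc b)) (λ j → (curryP p i j *P curryP q (a ∸ i) (b ∸ j)) e))
curryP-* p q a b e =
  trans (G.∑-concatMap (λ i → concatMap (slice i) (upTo (suc b))) (upTo (suc a)) t) (G.∑-cong (upTo (suc a)) (λ i →
  trans (G.∑-concatMap (slice i) (upTo (suc b)) t) (G.∑-cong (upTo (suc b)) (λ j →
  G.∑-map ((i , j) ∷_) (below e) t))))
  where
  t : Exp _ → GI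
  t d = p d *G q (subE ((a , b) ∷ e) d)
  slice : ℕ → ℕ → List (Exp _)
  slice i j = List.map ((i , j) ∷_) (below e)

-- A polynomial is an arbitrary coefficient function, so in one more pair x, x* it is exactly a
-- double power series over the polynomials in the others. The ring laws are pulled back along the
-- injective `curryP`; the signature comes early because this step uses `polyRing u`.
isCommutativeRing-P : ∀ u → IsCommutativeRing (_≈P_ {u}) _+P_ _*P_ -P_ 0P (constP 1G)

polyRing : ℕ → CommutativeRing 0ℓ 0ℓ
polyRing u = record { isCommutativeRing = isCommutativeRing-P u }

-- `Outer` is indexed by the exponent of the first x, `Inner` by the exponent of its x*.
module Curried (R : CommutativeRing 0ℓ 0ℓ) where
  module Inner = PowerSeries R
  module Outer = PowerSeries Inner.series

  inner-eval : {A : Set} (xs : List A) (f : A → Inner.Series) → ∀ b →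
               ListSum.∑ (CommutativeRing.ring Inner.series) xs f b ≡ ListSum.∑ (CommutativeRing.ring R) xs (λ d → f d b)
  inner-eval []       f b = refl
  inner-eval (x ∷ xs) f b = cong (CommutativeRing._+_ R (f x b)) (inner-eval xs f b)

curryP-⊛ : ∀ {u} (p q : Poly (suc u)) a b → let open Curried (polyRing u) in
           curryP (p *P q) a b ≈P (curryP p Outer.⊛ curryP q) a b

isCommutativeRing-P zero = isCommutativeRing mono₀ isCommutativeRing-G
  where
  open import Algebra.Morphism.Structures using (IsRingMonomorphism)
  open import Algebra.Morphism.RingMonomorphism using (isCommutativeRing)
  open import Algebra.Bundles using (RawRing)
  raw : RawRing 0ℓ 0ℓ
  raw = record { _≈_ = _≈P_ {0} ; _+_ = _+P_ ; _*_ = _*P_ ; -_ = -P_ ; 0# = 0P ; 1# = constP 1G }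
  mono₀ : IsRingMonomorphism raw (CommutativeRing.rawRing gaussRing) (λ p → p [])
  mono₀ = record
    { isRingHomomorphism = record
      { isSemiringHomomorphism = record
        { isNearSemiringHomomorphism = record
          { +-isMonoidHomomorphism = record
            { isMagmaHomomorphism = record
              { isRelHomomorphism = record { cong = λ e → e [] } ; homo = λ _ _ → refl }
            ; ε-homo = refl }
          ; *-homo = λ _ _ → G.+-identityʳ _ }
        ; 1#-homo = refl }
      ; -‿homo = λ _ → refl }
    ; injective = λ { e [] → e } }
isCommutativeRing-P (suc u) = isCommutativeRing mono⁺ Outer.isCommutativeRing-⊛
  where
  open Curried (polyRing u)
  open import Algebra.Morphism.Structures using (IsRingMonomorphism)
  open import Algebra.Morphism.RingMonomorphism using (isCommutativeRing)
  open import Algebra.Bundles using (RawRing)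
  raw : RawRing 0ℓ 0ℓ
  raw = record { _≈_ = _≈P_ {suc u} ; _+_ = _+P_ ; _*_ = _*P_ ; -_ = -P_ ; 0# = 0P ; 1# = constP 1G }
  one : ∀ a b e → constP 1G ((a , b) ∷ e) ≡ Outer.term 0 (Inner.term 0 (constP 1G)) a b e
  one zero    zero    e = refl
  one zero    (suc b) e = refl
  one (suc a) b       e = refl
  mono⁺ : IsRingMonomorphism raw (CommutativeRing.rawRing Outer.series) curryP
  mono⁺ = record
    { isRingHomomorphism = record
      { isSemiringHomomorphism = record
        { isNearSemiringHomomorphism = record
          { +-isMonoidHomomorphism = record
            { isMagmaHomomorphism = record
              { isRelHomomorphism = record { cong = λ h a b e → h ((a , b) ∷ e) } ; homo = λ _ _ _ _ _ → refl }
            ; ε-homo = λ _ _ _ → refl }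
          ; *-homo = curryP-⊛ }
        ; 1#-homo = one }
      ; -‿homo = λ _ _ _ _ → refl }
    ; injective = λ { h ((a , b) ∷ e) → h a b e } }

curryP-⊛ {u} p q a b e = trans (curryP-* p q a b e) (sym (trans
  (sym (Outer.⊛-as-∑ (curryP p) (curryP q) a b e)) (trans
  (cong (λ f → f e) (inner-eval (upTo (suc a)) (λ i → curryP p i Inner.⊛ curryP q (a ∸ i)) b)) (trans
  (foldr-eval (upTo (suc a)) (λ i → (curryP p i Inner.⊛ curryP q (a ∸ i)) b) e)
  (G.∑-cong (upTo (suc a)) (λ i → trans
    (sym (Inner.⊛-as-∑ (curryP p i) (curryP q (a ∸ i)) b e))
    (foldr-eval (upTo (suc b)) (λ j → curryP p i j *P curryP q (a ∸ i) (b ∸ j)) e)))))))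
  where
  open Curried (polyRing u)

-- Conjugation of polynomials and positivity of sums of squares.

module P {u : ℕ} where
  open CommutativeRing (polyRing u) public
  open ListSum ring public

conjG-∑ : {A : Set} (xs : List A) (f : A → GI) → conjG (G.∑ xs f) ≡ G.∑ xs (conjG ∘ f)
conjG-∑ []       f = refl
conjG-∑ (x ∷ xs) f = trans (conjG-+ (f x) _) (cong (conjG (f x) +G_) (conjG-∑ xs f))

-- Conjugation exchanges the exponents of x and x*, so the two sums of `curryP-*` come out in the
-- opposite order and have to be interchanged.
conjP-* : ∀ {u} (p q : Poly u) → conjP (p *P q) ≈P (conjP p *P conjP q)
conjP-* {zero}  p q [] = trans (conjG-+ (p [] *G q []) 0G) (cong (_+G 0G) (conjG-* (p []) (q [])))
conjP-* {suc u} p q ((a , b) ∷ e) = begin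
  conjG ((p *P q) ((b , a) ∷ ē))
    ≡⟨ cong conjG (curryP-* p q b a ē) ⟩
  conjG (G.∑ (upTo (suc b)) (λ i → G.∑ (upTo (suc a)) (λ j → (t i j) ē)))
    ≡⟨ conjG-∑ (upTo (suc b)) (λ i → G.∑ (upTo (suc a)) (λ j → (t i j) ē)) ⟩
  G.∑ (upTo (suc b)) (λ i → conjG (G.∑ (upTo (suc a)) (λ j → (t i j) ē)))
    ≡⟨ G.∑-cong (upTo (suc b)) (λ i → trans (conjG-∑ (upTo (suc a)) (λ j → t i j ē))
         (G.∑-cong (upTo (suc a)) (λ j → conjP-* (curryP p i j) (curryP q (b ∸ i) (a ∸ j)) e))) ⟩
  G.∑ (upTo (suc b)) (λ i → G.∑ (upTo (suc a)) (λ j → t′ i j e))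
    ≡⟨ G.∑-swap (upTo (suc b)) (upTo (suc a)) (λ i j → t′ i j e) ⟩
  G.∑ (upTo (suc a)) (λ j → G.∑ (upTo (suc b)) (λ i → t′ i j e))
    ≡⟨ curryP-* (conjP p) (conjP q) a b e ⟨
  (conjP p *P conjP q) ((a , b) ∷ e) ∎
  where
  open ≡.≡-Reasoning
  ē = Vec.map swap e
  t t′ : ℕ → ℕ → Poly u
  t i j = curryP p i j *P curryP q (b ∸ i) (a ∸ j)
  t′ i j = conjP (curryP p i j) *P conjP (curryP q (b ∸ i) (a ∸ j))

map-swap² : ∀ {u} (e : Exp u) → Vec.map swap (Vec.map swap e) ≡ e
map-swap² []      = refl
map-swap² (x ∷ e) = cong (x ∷_) (map-swap² e)

-- The real part of the sum is a sum of the natural numbers `normG`, and among naturals a vanishing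
-- sum has vanishing terms.
definite₀ : (ps : List (Poly 0)) → P.∑ ps (λ p → p *P conjP p) ≈P 0P → All (_≈P 0P) ps
definite₀ ps h = vanish ps (ℤₚ.+-injective (trans (sym (total ps)) (cong proj₁ (h []))))
  where
  norms : List (Poly 0) → ℕ
  norms = foldr (λ p acc → normG (p []) ℕ.+ acc) 0
  total : ∀ ps → proj₁ (P.∑ ps (λ p → p *P conjP p) []) ≡ ℤ.+ norms ps
  total []       = refl
  total (p ∷ ps) = trans
    (cong₂ ℤ._+_ (trans (ℤₚ.+-identityʳ _) (re-*-conjG (p []))) (total ps)) (sym (ℤₚ.pos-+ (normG (p [])) _))
  vanish : ∀ ps → norms ps ≡ 0 → All (_≈P 0P) ps
  vanish []       e = []
  vanish (p ∷ ps) e = (λ { [] → normG≡0 (p []) (ℕₚ.m+n≡0⇒m≡0 _ e) })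
                    ∷ vanish ps (ℕₚ.m+n≡0⇒n≡0 (normG (p [])) e)

module _ {u : ℕ} where
  VanishesBelow : ℕ → Poly (suc u) → Set
  VanishesBelow d p = ∀ a b → a ℕ.+ b < d → curryP p a b ≈P 0P

  antidiagonal : ℕ → Poly (suc u) → List (Poly u)
  antidiagonal d p = List.map (λ i → curryP p i (d ∸ i)) (upTo (suc d))

  -- A term of the coefficient of x^d x*^d multiplies the coefficient of p at (i, j) by the
  -- conjugate of the one at (d - j, d - i). The two degrees add up to 2d, so both reach d only if j
  -- = d - i, and then the two coefficients are the same. Degrees are counted in the first variable
  -- alone; the other variables stay in the coefficients.
  diagonal-coefficient : ∀ d p → VanishesBelow d p →
    curryP (p *P conjP p) d d ≈P P.∑ (antidiagonal d p) (λ c → c *P conjP c)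
  diagonal-coefficient d p v = begin
    curryP (p *P conjP p) d d
      ≈⟨ curryP-⊛ p (conjP p) d d ⟩
    (curryP p Outer.⊛ curryP (conjP p)) d d
      ≈⟨ Outer.⊛-as-∑ (curryP p) (curryP (conjP p)) d d ⟨
    ListSum.∑ (CommutativeRing.ring Inner.series) (upTo (suc d)) (λ i → f i) d
      ≡⟨ inner-eval (upTo (suc d)) f d ⟩
    P.∑ (upTo (suc d)) (λ i → f i d)
      ≈⟨ P.∑-All-cong (upTo (suc d)) (Allₚ.applyUpTo⁺₁ id (suc d) lowest) ⟩
    P.∑ (upTo (suc d)) (λ i → curryP p i (d ∸ i) *P conjP (curryP p i (d ∸ i)))
      ≈⟨ P.∑-map (λ i → curryP p i (d ∸ i)) (upTo (suc d)) (λ c → c *P conjP c) ⟨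
    P.∑ (antidiagonal d p) (λ c → c *P conjP c) ∎
    where
    open Curried (polyRing u)
    open import Relation.Binary.Reasoning.Setoid (P.setoid {u})
    f : ℕ → ℕ → Poly u
    f i = curryP p i Inner.⊛ curryP (conjP p) (d ∸ i)
    lowest : ∀ {i} → i < suc d → f i d ≈P (curryP p i (d ∸ i) *P conjP (curryP p i (d ∸ i)))
    lowest {i} i<d = subst (λ n → f i n ≈P (curryP p i (d ∸ i) *P conjP (curryP p i (d ∸ i))))
      (ℕₚ.m∸n+n≡m i≤d)
      (Inner.⊛-lowest (d ∸ i) i (curryP p i) (curryP (conjP p) (d ∸ i))
        (λ j j< → v i j (subst (i ℕ.+ j <_) (ℕₚ.m+[n∸m]≡n i≤d) (ℕₚ.+-monoʳ-< i j<)))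
        (λ j j<i e → cong conjG (v j (d ∸ i)
          (subst (j ℕ.+ (d ∸ i) <_) (ℕₚ.m+[n∸m]≡n i≤d) (ℕₚ.+-monoˡ-< (d ∸ i) j<i)) (Vec.map swap e))))
      where
      i≤d : i ≤ d
      i≤d = s≤s⁻¹ i<d

curryP-∑ : ∀ {u} {A : Set} (xs : List A) (f : A → Poly (suc u)) a b →
           curryP (P.∑ xs f) a b ≈P P.∑ xs (λ x → curryP (f x) a b)
curryP-∑ []       f a b e = refl
curryP-∑ (x ∷ xs) f a b e = cong (f x ((a , b) ∷ e) +G_) (curryP-∑ xs f a b e)

-- Instead of choosing a least degree, `below-all` raises the bound: if all p vanish below d, the
-- coefficients on their antidiagonals of degree d form a vanishing sum of squares in one variable
-- fewer, and vanish by induction. The exponent (a, b) is reached at the bound a + b + 1.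
definite-P : ∀ {u} (ps : List (Poly u)) → P.∑ ps (λ p → p *P conjP p) ≈P 0P → All (_≈P 0P) ps
definite-P {zero}  ps h = definite₀ ps h
definite-P {suc u} ps h = All.tabulate
  (λ p∈ → λ { ((a , b) ∷ e) → All.lookup (below-all (suc (a ℕ.+ b))) p∈ a b ℕₚ.≤-refl e })
  where
  below-all : ∀ d → All (VanishesBelow d) ps
  below-all zero    = All.tabulate (λ _ _ _ ())
  below-all (suc d) = All.zipWith (λ {p} → step {p}) (below-all d , Allₚ.map⁻ (Allₚ.concat⁻ (definite-P _ squares)))
    where
    open import Relation.Binary.Reasoning.Setoid (P.setoid {u})
    squares : P.∑ (concatMap (antidiagonal d) ps) (λ c → c *P conjP c) ≈P 0P
    squares = begin
      P.∑ (concatMap (antidiagonal d) ps) (λ c → c *P conjP c)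
        ≈⟨ P.∑-concatMap (antidiagonal d) ps (λ c → c *P conjP c) ⟩
      P.∑ ps (λ p → P.∑ (antidiagonal d p) (λ c → c *P conjP c))
        ≈⟨ P.∑-All-cong ps (All.map (λ {p} v → diagonal-coefficient d p v) (below-all d)) ⟨
      P.∑ ps (λ p → curryP (p *P conjP p) d d)
        ≈⟨ curryP-∑ ps (λ p → p *P conjP p) d d ⟨
      curryP (P.∑ ps (λ p → p *P conjP p)) d d
        ≈⟨ (λ e → h ((d , d) ∷ e)) ⟩
      0P ∎
    step : ∀ {p} → VanishesBelow d p × All (_≈P 0P) (antidiagonal d p) → VanishesBelow (suc d) p
    step {p} (v , w) a b a+b<1+d with ℕₚ.m≤n⇒m<n∨m≡n (s≤s⁻¹ a+b<1+d)
    ... | inj₁ lt   = v a b lt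
    ... | inj₂ refl = subst (λ c → curryP p a c ≈P 0P) (ℕₚ.m+n∸m≡n a b)
                        (Allₚ.applyUpTo⁻ id (suc (a ℕ.+ b)) (Allₚ.map⁻ w) (s≤s (ℕₚ.m≤m+n a b)))

isStarRing-P : ∀ u → IsStarRing (P.ring {u}) conjP
isStarRing-P u = record
  { ⋆-cong = λ h e → cong conjG (h (Vec.map swap e))
  ; ⋆-+ = λ p q e → conjG-+ (p (Vec.map swap e)) _
  ; ⋆-* = λ p q → P.trans (conjP-* p q) (P.*-comm (conjP p) (conjP q))
  ; ⋆-⋆ = λ p e → trans (conjG-conjG _) (cong p (map-swap² e))
  ; normal = λ p → P.*-comm (conjP p) p
  ; definite = definite-P }

-- Star rings and the passage from complex to quaternionic coefficients.

module StarRing {R : Ring 0ℓ 0ℓ} {_⋆ : Ring.Carrier R → Ring.Carrier R} (S : IsStarRing R _⋆) where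
  open Ring R renaming (sym to ≈-sym; trans to ≈-trans)
  open IsStarRing S
  open import Algebra.Properties.Ring R using (+-identityˡ-unique; +-inverseˡ-unique)

  ⋆-0 : (0# ⋆) ≈ 0#
  ⋆-0 = +-identityˡ-unique _ _ (≈-trans (≈-sym (⋆-+ 0# 0#)) (⋆-cong (+-identityˡ 0#)))

  ⋆-neg : ∀ x → ((- x) ⋆) ≈ (- (x ⋆))
  ⋆-neg x = +-inverseˡ-unique _ _ (≈-trans (≈-sym (⋆-+ (- x) x)) (≈-trans (⋆-cong (-‿inverseˡ x)) ⋆-0))

  -- 1⋆ = 1⋆ 1⋆⋆ = (1⋆ 1)⋆ = 1⋆⋆ = 1.
  ⋆-1 : (1# ⋆) ≈ 1#
  ⋆-1 = ≈-trans (≈-sym (*-identityʳ _)) (≈-trans (*-congˡ (≈-sym (⋆-⋆ 1#)))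
    (≈-trans (≈-sym (⋆-* _ _)) (≈-trans (⋆-cong (*-identityʳ _)) (⋆-⋆ 1#))))

-- The library's solvers need a coefficient ring that computes; formal
-- differences of naturals map into every commutative ring.
module DifferenceSolver (R : CommutativeRing 0ℓ 0ℓ) where
  open CommutativeRing R renaming (sym to ≈-sym; trans to ≈-trans)
  open import Algebra.Bundles using (RawRing)
  open import Algebra.Properties.Ring ring using (-0#≈0#; -‿distribˡ-*; -‿distribʳ-*; -‿involutive)
  open import Algebra.Properties.AbelianGroup +-abelianGroup using (⁻¹-∙-comm)
  open import Algebra.Properties.CommutativeSemigroup +-commutativeSemigroup using (interchange)
  open import Algebra.Properties.Semiring.Mult semiring using (×-homo-+; ×1-homo-*) renaming (_×_ to _∙_)
  open import Algebra.Solver.Ring.AlmostCommutativeRing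
    using (_-Raw-AlmostCommutative⟶_; Induced-equivalence) renaming (fromCommutativeRing to almost)
  open import Relation.Binary.Definitions using (WeaklyDecidable)
  open import Relation.Binary.Reasoning.Setoid setoid

  private
    differences : RawRing 0ℓ 0ℓ
    differences = record
      { Carrier = ℕ × ℕ
      ; _≈_ = _≡_
      ; _+_ = λ (a , b) (c , d) → (a ℕ.+ c , b ℕ.+ d)
      ; _*_ = λ (a , b) (c , d) → (a ℕ.* c ℕ.+ b ℕ.* d , a ℕ.* d ℕ.+ b ℕ.* c)
      ; -_ = swap
      ; 0# = (0 , 0)
      ; 1# = (1 , 0) }

    ι : ℕ → Carrier
    ι n = n ∙ 1#

    ⟦_⟧D : ℕ × ℕ → Carrier
    ⟦ a , b ⟧D = ι a + - ι b

    +-homo : ∀ x y → ⟦ RawRing._+_ differences x y ⟧D ≈ ⟦ x ⟧D + ⟦ y ⟧D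
    +-homo (a , b) (c , d) = begin
      ι (a ℕ.+ c) + - ι (b ℕ.+ d)        ≈⟨ +-cong (×-homo-+ 1# a c) (-‿cong (×-homo-+ 1# b d)) ⟩
      (ι a + ι c) + - (ι b + ι d)        ≈⟨ +-congˡ (⁻¹-∙-comm (ι b) (ι d)) ⟨
      (ι a + ι c) + (- ι b + - ι d)      ≈⟨ interchange _ _ _ _ ⟩
      ⟦ a , b ⟧D + ⟦ c , d ⟧D ∎

    ι-* : ∀ a b c d → ι (a ℕ.* b ℕ.+ c ℕ.* d) ≈ ι a * ι b + ι c * ι d
    ι-* a b c d = ≈-trans (×-homo-+ 1# (a ℕ.* b) _) (+-cong (×1-homo-* a b) (×1-homo-* c d))

    *-homo : ∀ x y → ⟦ RawRing._*_ differences x y ⟧D ≈ ⟦ x ⟧D * ⟦ y ⟧D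
    *-homo (a , b) (c , d) = begin
      ι (a ℕ.* c ℕ.+ b ℕ.* d) + - ι (a ℕ.* d ℕ.+ b ℕ.* c)
        ≈⟨ +-cong (ι-* a c b d) (-‿cong (ι-* a d b c)) ⟩
      (ι a * ι c + ι b * ι d) + - (ι a * ι d + ι b * ι c)
        ≈⟨ +-congˡ (⁻¹-∙-comm _ _) ⟨
      (ι a * ι c + ι b * ι d) + (- (ι a * ι d) + - (ι b * ι c))
        ≈⟨ +-congˡ (+-comm _ _) ⟩
      (ι a * ι c + ι b * ι d) + (- (ι b * ι c) + - (ι a * ι d))
        ≈⟨ interchange _ _ _ _ ⟩
      (ι a * ι c + - (ι b * ι c)) + (ι b * ι d + - (ι a * ι d))
        ≈⟨ +-cong (+-congˡ (-‿distribˡ-* _ _)) (≈-trans (+-comm _ _) (+-cong (-‿distribʳ-* _ _) (negneg _ _))) ⟩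
      (ι a * ι c + (- ι b) * ι c) + (ι a * - ι d + (- ι b) * - ι d)
        ≈⟨ +-cong (distribʳ _ _ _) (distribʳ _ _ _) ⟨
      ⟦ a , b ⟧D * ι c + ⟦ a , b ⟧D * - ι d
        ≈⟨ distribˡ _ _ _ ⟨
      ⟦ a , b ⟧D * ⟦ c , d ⟧D ∎
      where
      negneg : ∀ x y → x * y ≈ (- x) * (- y)
      negneg x y = ≈-trans (≈-sym (-‿involutive _)) (≈-trans (-‿cong (-‿distribˡ-* x y)) (-‿distribʳ-* (- x) y))

    -‿homo : ∀ x → ⟦ swap x ⟧D ≈ - ⟦ x ⟧D
    -‿homo (a , b) = begin
      ι b + - ι a          ≈⟨ +-congʳ (-‿involutive _) ⟨
      - (- ι b) + - ι a    ≈⟨ +-comm _ _ ⟩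
      - ι a + - (- ι b)    ≈⟨ ⁻¹-∙-comm _ _ ⟩
      - (ι a + - ι b) ∎

    morphism : differences -Raw-AlmostCommutative⟶ almost R
    morphism = record
      { ⟦_⟧ = ⟦_⟧D
      ; +-homo = +-homo
      ; *-homo = *-homo
      ; -‿homo = -‿homo
      ; 0-homo = -‿inverseʳ 0#
      ; 1-homo = ≈-trans (+-cong (+-identityʳ 1#) -0#≈0#) (+-identityʳ 1#) }

    -- Formal differences are not kept in a normal form, so equality of pairs would miss
    -- coefficients such as (1 , 1) and (0 , 0); the test a + d = c + b recognises them.
    same-difference : WeaklyDecidable (Induced-equivalence morphism)
    same-difference (a , b) (c , d) with a ℕ.+ d ℕ.≟ c ℕ.+ b
    ... | no  _ = nothing
    ... | yes e = just (begin
      ι a + - ι b                        ≈⟨ +-identityʳ _ ⟨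
      (ι a + - ι b) + 0#                 ≈⟨ +-congˡ (-‿inverseʳ (ι d)) ⟨
      (ι a + - ι b) + (ι d + - ι d)      ≈⟨ interchange _ _ _ _ ⟩
      (ι a + ι d) + (- ι b + - ι d)      ≈⟨ +-congʳ (×-homo-+ 1# a d) ⟨
      ι (a ℕ.+ d) + (- ι b + - ι d)      ≡⟨ cong (λ n → ι n + (- ι b + - ι d)) e ⟩
      ι (c ℕ.+ b) + (- ι b + - ι d)      ≈⟨ +-congʳ (×-homo-+ 1# c b) ⟩
      (ι c + ι b) + (- ι b + - ι d)      ≈⟨ +-assoc _ _ _ ⟩
      ι c + (ι b + (- ι b + - ι d))      ≈⟨ +-congˡ (+-assoc _ _ _) ⟨
      ι c + ((ι b + - ι b) + - ι d)      ≈⟨ +-congˡ (+-congʳ (-‿inverseʳ (ι b))) ⟩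
      ι c + (0# + - ι d)                 ≈⟨ +-congˡ (+-identityˡ _) ⟩
      ι c + - ι d ∎)

  open import Algebra.Solver.Ring differences (almost R) morphism same-difference public

-- The component equations that remain once conjugation has been pushed down to the variables.
-- Conjugates enter as independent primed variables, which makes these equations plain commutative
-- ring identities.
module CayleyDicksonIdentities (R : CommutativeRing 0ℓ 0ℓ) where
  open CommutativeRing R using (_≈_; _+_; _*_; -_) renaming (refl to ≈-refl)
  open DifferenceSolver R using (solve; _:=_; _:+_; _:*_; :-_)

  assoc-eq₁ : ∀ p q r s t s′ r′ v′ → (p * r + - (q * s′)) * t + - ((p * s + q * r′) * v′) ≈ p * (r * t + - (s * v′)) + - (q * (r′ * v′ + s′ * t))
  assoc-eq₁ = solve 8 (λ p q r s t s′ r′ v′ →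
    (p :* r :+ :- (q :* s′)) :* t :+ :- ((p :* s :+ q :* r′) :* v′) := p :* (r :* t :+ :- (s :* v′)) :+ :- (q :* (r′ :* v′ :+ s′ :* t))) ≈-refl
  assoc-eq₂ : ∀ p q r s v s′ r′ t′ → (p * r + - (q * s′)) * v + (p * s + q * r′) * t′ ≈ p * (r * v + s * t′) + q * (r′ * t′ + - (s′ * v))
  assoc-eq₂ = solve 8 (λ p q r s v s′ r′ t′ →
    (p :* r :+ :- (q :* s′)) :* v :+ (p :* s :+ q :* r′) :* t′ := p :* (r :* v :+ s :* t′) :+ q :* (r′ :* t′ :+ :- (s′ :* v))) ≈-refl
  distribˡ-eq₁ : ∀ p q r t s′ v′ → p * (r + t) + - (q * (s′ + v′)) ≈ (p * r + - (q * s′)) + (p * t + - (q * v′))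
  distribˡ-eq₁ = solve 6 (λ p q r t s′ v′ →
    p :* (r :+ t) :+ :- (q :* (s′ :+ v′)) := (p :* r :+ :- (q :* s′)) :+ (p :* t :+ :- (q :* v′))) ≈-refl
  distribˡ-eq₂ : ∀ p q s v r′ t′ → p * (s + v) + q * (r′ + t′) ≈ (p * s + q * r′) + (p * v + q * t′)
  distribˡ-eq₂ = solve 6 (λ p q s v r′ t′ →
    p :* (s :+ v) :+ q :* (r′ :+ t′) := (p :* s :+ q :* r′) :+ (p :* v :+ q :* t′)) ≈-refl
  distribʳ-eq₁ : ∀ p q r s t v′ → (p + r) * t + - ((q + s) * v′) ≈ (p * t + - (q * v′)) + (r * t + - (s * v′))
  distribʳ-eq₁ = solve 6 (λ p q r s t v′ →
    (p :+ r) :* t :+ :- ((q :+ s) :* v′) := (p :* t :+ :- (q :* v′)) :+ (r :* t :+ :- (s :* v′))) ≈-refl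
  distribʳ-eq₂ : ∀ p q r s v t′ → (p + r) * v + (q + s) * t′ ≈ (p * v + q * t′) + (r * v + s * t′)
  distribʳ-eq₂ = solve 6 (λ p q r s v t′ →
    (p :+ r) :* v :+ (q :+ s) :* t′ := (p :* v :+ q :* t′) :+ (r :* v :+ s :* t′)) ≈-refl
  conj-eq₁ : ∀ p′ r′ q′ s → p′ * r′ + - (q′ * s) ≈ r′ * p′ + - ((- s) * (- q′))
  conj-eq₁ = solve 4 (λ p′ r′ q′ s →
    p′ :* r′ :+ :- (q′ :* s) := r′ :* p′ :+ :- ((:- s) :* (:- q′))) ≈-refl
  conj-eq₂ : ∀ p q s r′ → - (p * s + q * r′) ≈ r′ * (- q) + (- s) * p
  conj-eq₂ = solve 4 (λ p q s r′ →
    :- (p :* s :+ q :* r′) := r′ :* (:- q) :+ (:- s) :* p) ≈-refl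
  norm-eq₁ : ∀ p q p′ q′ → p * p′ + - (q * (- q′)) ≈ p * p′ + q * q′
  norm-eq₁ = solve 4 (λ p q p′ q′ →
    p :* p′ :+ :- (q :* (:- q′)) := p :* p′ :+ q :* q′) ≈-refl
  norm-eq₂ : ∀ p q → p * (- q) + q * p ≈ - (p * q) + p * q
  norm-eq₂ = solve 2 (λ p q →
    p :* (:- q) :+ q :* p := :- (p :* q) :+ p :* q) ≈-refl
  normal-eq₁ : ∀ p q p′ q′ → p′ * p + - ((- q) * q′) ≈ p * p′ + q * q′
  normal-eq₁ = solve 4 (λ p q p′ q′ →
    p′ :* p :+ :- ((:- q) :* q′) := p :* p′ :+ q :* q′) ≈-refl
  normal-eq₂ : ∀ p q p′ q′ → p′ * q + (- q) * p′ ≈ p′ * q + - (p′ * q)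
  normal-eq₂ = solve 4 (λ p q p′ q′ →
    p′ :* q :+ (:- q) :* p′ := p′ :* q :+ :- (p′ :* q)) ≈-refl
  neg-+ : ∀ q s → - (q + s) ≈ (- q) + (- s)
  neg-+ = solve 2 (λ q s →
    :- (q :+ s) := (:- q) :+ (:- s)) ≈-refl
  neg-neg : ∀ q → - (- q) ≈ q
  neg-neg = solve 1 (λ q →
    :- (:- q) := q) ≈-refl

-- Pairs (p , q) stand for p + q j, where j z = z⋆ j and j² = −1.
module CayleyDickson (R : CommutativeRing 0ℓ 0ℓ)
                     (_⋆ : CommutativeRing.Carrier R → CommutativeRing.Carrier R)
                     (S : IsStarRing (CommutativeRing.ring R) _⋆) where
  open CommutativeRing R renaming (refl to ≈-refl; sym to ≈-sym; trans to ≈-trans)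
  open IsStarRing S
  open StarRing S
  open ListSum (CommutativeRing.ring R)
  open import Relation.Binary.Reasoning.Setoid setoid
  open import Algebra.Properties.Ring ring using (-0#≈0#)
  open CayleyDicksonIdentities R

  ℍ : Set
  ℍ = Carrier × Carrier

  _≈ℍ_ : ℍ → ℍ → Set
  (p , q) ≈ℍ (r , s) = (p ≈ r) × (q ≈ s)

  _+ℍ_ _*ℍ_ : ℍ → ℍ → ℍ
  (p , q) +ℍ (r , s) = (p + r , q + s)
  (p , q) *ℍ (r , s) = ((p * r) + (- (q * (s ⋆))) , (p * s) + (q * (r ⋆)))

  -ℍ_ conjℍ : ℍ → ℍ
  -ℍ (p , q) = (- p , - q)
  conjℍ (p , q) = (p ⋆ , - q)

  0ℍ 1ℍ : ℍ
  0ℍ = (0# , 0#)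
  1ℍ = (1# , 0#)

  private
    ⋆-*-comm : ∀ x y → ((x * y) ⋆) ≈ ((x ⋆) * (y ⋆))
    ⋆-*-comm x y = ≈-trans (⋆-* x y) (*-comm _ _)

    ⋆-sum : ∀ x y z w → ((x * y + z * (w ⋆)) ⋆) ≈ ((x ⋆) * (y ⋆) + (z ⋆) * w)
    ⋆-sum x y z w = ≈-trans (⋆-+ _ _) (+-cong (⋆-*-comm x y) (≈-trans (⋆-*-comm z _) (*-congˡ (⋆-⋆ w))))

    ⋆-diff : ∀ x y z w → ((x * y + - (z * (w ⋆))) ⋆) ≈ ((x ⋆) * (y ⋆) + - ((z ⋆) * w))
    ⋆-diff x y z w = ≈-trans (⋆-+ _ _) (+-cong (⋆-*-comm x y)
      (≈-trans (⋆-neg _) (-‿cong (≈-trans (⋆-*-comm z _) (*-congˡ (⋆-⋆ w))))))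

  *ℍ-assoc : ∀ x y z → ((x *ℍ y) *ℍ z) ≈ℍ (x *ℍ (y *ℍ z))
  *ℍ-assoc (p , q) (r , s) (t , v) =
      ≈-trans (assoc-eq₁ p q r s t (s ⋆) (r ⋆) (v ⋆)) (+-congˡ (-‿cong (*-congˡ (≈-sym (⋆-sum r v s t)))))
    , ≈-trans (assoc-eq₂ p q r s v (s ⋆) (r ⋆) (t ⋆)) (+-congˡ (*-congˡ (≈-sym (⋆-diff r t s v))))

  *ℍ-cong : ∀ {x x′ y y′} → x ≈ℍ x′ → y ≈ℍ y′ → (x *ℍ y) ≈ℍ (x′ *ℍ y′)
  *ℍ-cong (a , b) (c , d) = +-cong (*-cong a c) (-‿cong (*-cong b (⋆-cong d))) , +-cong (*-cong a d) (*-cong b (⋆-cong c))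

  *ℍ-identityˡ : ∀ x → (1ℍ *ℍ x) ≈ℍ x
  *ℍ-identityˡ (r , s) =
      ≈-trans (+-cong (*-identityˡ r) (≈-trans (-‿cong (zeroˡ _)) -0#≈0#)) (+-identityʳ r)
    , ≈-trans (+-cong (*-identityˡ s) (zeroˡ _)) (+-identityʳ s)

  *ℍ-identityʳ : ∀ x → (x *ℍ 1ℍ) ≈ℍ x
  *ℍ-identityʳ (p , q) =
      ≈-trans (+-cong (*-identityʳ p) (≈-trans (-‿cong (≈-trans (*-congˡ ⋆-0) (zeroʳ q))) -0#≈0#)) (+-identityʳ p)
    , ≈-trans (+-cong (zeroʳ p) (≈-trans (*-congˡ ⋆-1) (*-identityʳ q))) (+-identityˡ q)

  *ℍ-distribˡ : ∀ x y z → (x *ℍ (y +ℍ z)) ≈ℍ ((x *ℍ y) +ℍ (x *ℍ z))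
  *ℍ-distribˡ (p , q) (r , s) (t , v) =
      ≈-trans (+-congˡ (-‿cong (*-congˡ (⋆-+ s v)))) (distribˡ-eq₁ p q r t (s ⋆) (v ⋆))
    , ≈-trans (+-congˡ (*-congˡ (⋆-+ r t))) (distribˡ-eq₂ p q s v (r ⋆) (t ⋆))

  *ℍ-distribʳ : ∀ z x y → ((x +ℍ y) *ℍ z) ≈ℍ ((x *ℍ z) +ℍ (y *ℍ z))
  *ℍ-distribʳ (t , v) (p , q) (r , s) = distribʳ-eq₁ p q r s t (v ⋆) , distribʳ-eq₂ p q r s v (t ⋆)

  isRing-ℍ : IsRing _≈ℍ_ _+ℍ_ _*ℍ_ -ℍ_ 0ℍ 1ℍ
  isRing-ℍ = record
    { +-isAbelianGroup = record
      { isGroup = record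
        { isMonoid = record
          { isSemigroup = record
            { isMagma = record
              { isEquivalence = record
                { refl = ≈-refl , ≈-refl
                ; sym = λ (a , b) → ≈-sym a , ≈-sym b
                ; trans = λ (a , b) (c , d) → ≈-trans a c , ≈-trans b d }
              ; ∙-cong = λ (a , b) (c , d) → +-cong a c , +-cong b d }
            ; assoc = λ _ _ _ → +-assoc _ _ _ , +-assoc _ _ _ }
          ; identity = (λ _ → +-identityˡ _ , +-identityˡ _) , (λ _ → +-identityʳ _ , +-identityʳ _) }
        ; inverse = (λ _ → -‿inverseˡ _ , -‿inverseˡ _) , (λ _ → -‿inverseʳ _ , -‿inverseʳ _)
        ; ⁻¹-cong = λ (a , b) → -‿cong a , -‿cong b }
      ; comm = λ _ _ → +-comm _ _ , +-comm _ _ }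
    ; *-cong = *ℍ-cong
    ; *-assoc = *ℍ-assoc
    ; *-identity = *ℍ-identityˡ , *ℍ-identityʳ
    ; distrib = *ℍ-distribˡ , *ℍ-distribʳ }

  ℍ-ring : Ring 0ℓ 0ℓ
  ℍ-ring = record { isRing = isRing-ℍ }

  conjℍ-* : ∀ x y → conjℍ (x *ℍ y) ≈ℍ (conjℍ y *ℍ conjℍ x)
  conjℍ-* (p , q) (r , s) =
      ≈-trans (⋆-diff p r q s) (≈-trans (conj-eq₁ (p ⋆) (r ⋆) (q ⋆) s) (+-congˡ (-‿cong (*-congˡ (≈-sym (⋆-neg q))))))
    , ≈-trans (conj-eq₂ p q s (r ⋆)) (+-congˡ (*-congˡ (≈-sym (⋆-⋆ p))))

  -- The j-component is p(-q) + qp, which cancels because the base ring commutes. Hence a sum of xx*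
  -- over quaternions is a sum of squares over their components, which is how positivity is
  -- inherited.
  norm-ℍ : ∀ p q → ((p , q) *ℍ conjℍ (p , q)) ≈ℍ ((p * (p ⋆)) + (q * (q ⋆)) , 0#)
  norm-ℍ p q = ≈-trans (+-congˡ (-‿cong (*-congˡ (⋆-neg q)))) (norm-eq₁ p q (p ⋆) (q ⋆))
             , ≈-trans (+-congˡ (*-congˡ (⋆-⋆ p))) (≈-trans (norm-eq₂ p q) (-‿inverseˡ (p * q)))

  normal-ℍ : ∀ x → (conjℍ x *ℍ x) ≈ℍ (x *ℍ conjℍ x)
  normal-ℍ (p , q) = Ring.trans ℍ-ring (normal-eq₁ p q (p ⋆) (q ⋆) , ≈-trans (normal-eq₂ p q (p ⋆) (q ⋆)) (-‿inverseʳ ((p ⋆) * q))) (Ring.sym ℍ-ring (norm-ℍ p q))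

  private
    module Hℍ = ListSum ℍ-ring

    components : List ℍ → List Carrier
    components []            = []
    components ((p , q) ∷ xs) = p ∷ q ∷ components xs

    ∑-components : ∀ xs → proj₁ (Hℍ.∑ xs (λ x → x *ℍ conjℍ x)) ≈ ∑ (components xs) (λ c → c * (c ⋆))
    ∑-components []            = ≈-refl
    ∑-components ((p , q) ∷ xs) =
      ≈-trans (+-cong (proj₁ (norm-ℍ p q)) (∑-components xs)) (+-assoc _ _ _)

    vanish : ∀ xs → All (λ c → c ≈ 0#) (components xs) → All (λ x → x ≈ℍ 0ℍ) xs
    vanish []            []            = []
    vanish ((p , q) ∷ xs) (a ∷ b ∷ cs) = (a , b) ∷ vanish xs cs

  isStarRing-ℍ : IsStarRing ℍ-ring conjℍ
  isStarRing-ℍ = record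
    { ⋆-cong = λ (a , b) → ⋆-cong a , -‿cong b
    ; ⋆-+ = λ (p , q) (r , s) → ⋆-+ p r , neg-+ q s
    ; ⋆-* = conjℍ-*
    ; ⋆-⋆ = λ (p , q) → ⋆-⋆ p , neg-neg q
    ; normal = normal-ℍ
    ; definite = λ xs h → vanish xs (definite (components xs) (≈-trans (≈-sym (∑-components xs)) (proj₁ h))) }

module QuaternionPolynomials (u : ℕ) = CayleyDickson (polyRing u) conjP (isStarRing-P u)

-- The operations of `CayleyDickson` over polynomials unfold to those of `QP`, so its laws apply to
-- quaternion polynomials as they stand.
quatRing : ℕ → Ring 0ℓ 0ℓ
quatRing u = record
  { Carrier = QP u ; _≈_ = _≈Q_ ; _+_ = _+Q_ ; _*_ = _*Q_ ; -_ = -Q_ ; 0# = 0Q ; 1# = (constP 1G , 0P)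
  ; isRing = QuaternionPolynomials.isRing-ℍ u }

isStarRing-Q : ∀ u → IsStarRing (quatRing u) conjQ
isStarRing-Q u = QuaternionPolynomials.isStarRing-ℍ u

-- Matrices over a star ring: orthogonal rows give orthogonal columns.

==F-refl : ∀ {n} (a : Fin n) → (a ==F a) ≡ true
==F-refl a with a Fin.≟ a
... | yes _   = refl
... | no  a≢a = ⊥-elim (a≢a refl)

==F-≢ : ∀ {n} {a b : Fin n} → a ≢ b → (a ==F b) ≡ false
==F-≢ {a = a} {b} a≢b with a Fin.≟ b
... | yes e = ⊥-elim (a≢b e)
... | no  _ = refl

module StarMatrices {R : Ring 0ℓ 0ℓ} {_⋆ : Ring.Carrier R → Ring.Carrier R} (S : IsStarRing R _⋆) where
  open Ring R renaming (refl to ≈-refl; sym to ≈-sym; trans to ≈-trans)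
  open IsStarRing S
  open StarRing S
  open ListSum R
  open import Algebra.Properties.Ring R using (-0#≈0#; -‿distribˡ-*; -‿distribʳ-*)
  open import Algebra.Properties.Semiring.Sum semiring public
    using (sum; sum-cong-≋; ∑-distrib-+; ∑-comm; *-distribˡ-sum; *-distribʳ-sum; sum-replicate-zero; sum-permute)
  open import Algebra.Properties.Group +-group using (inverseˡ-unique) renaming (⁻¹-involutive to neg-neg)
  open import Relation.Binary.Reasoning.Setoid setoid

  sum-cong : ∀ {n} {f g : Fin n → Carrier} → (∀ i → f i ≈ g i) → sum f ≈ sum g
  sum-cong = sum-cong-≋

  sum-0 : ∀ {n} {f : Fin n → Carrier} → (∀ i → f i ≈ 0#) → sum f ≈ 0#
  sum-0 {n} e = ≈-trans (sum-cong e) (sum-replicate-zero n)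

  sum-single : ∀ {n} {f : Fin n → Carrier} a → (∀ b → b ≢ a → f b ≈ 0#) → sum f ≈ f a
  sum-single Fin.zero    e = ≈-trans (+-congˡ (sum-0 (λ i → e (Fin.suc i) λ ()))) (+-identityʳ _)
  sum-single (Fin.suc a) e = ≈-trans
    (+-cong (e Fin.zero λ ()) (sum-single a (λ b b≢a → e (Fin.suc b) (b≢a ∘ Finₚ.suc-injective)))) (+-identityˡ _)

  sum-neg : ∀ {n} (f : Fin n → Carrier) → sum (λ i → - f i) ≈ - sum f
  sum-neg f = inverseˡ-unique _ _ (≈-trans (≈-sym (∑-distrib-+ (λ i → - f i) f)) (sum-0 (λ i → -‿inverseˡ (f i))))

  ⋆-sum : ∀ {n} (f : Fin n → Carrier) → (sum f ⋆) ≈ sum (λ i → f i ⋆)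
  ⋆-sum {zero}  f = ⋆-0
  ⋆-sum {suc n} f = ≈-trans (⋆-+ _ _) (+-congˡ (⋆-sum (f ∘ Fin.suc)))

  sum-assoc : ∀ {m n} (f : Fin m → Carrier) (g : Fin m → Fin n → Carrier) (h : Fin n → Carrier) →
              sum (λ i → f i * sum (λ j → g i j * h j)) ≈ sum (λ j → sum (λ i → f i * g i j) * h j)
  sum-assoc f g h = begin
    sum (λ i → f i * sum (λ j → g i j * h j))
      ≈⟨ sum-cong (λ i → *-distribˡ-sum (f i) (λ j → g i j * h j)) ⟩
    sum (λ i → sum (λ j → f i * (g i j * h j)))
      ≈⟨ sum-cong (λ i → sum-cong (λ j → *-assoc (f i) (g i j) (h j))) ⟨
    sum (λ i → sum (λ j → (f i * g i j) * h j))
      ≈⟨ ∑-comm (λ i j → (f i * g i j) * h j) ⟩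
    sum (λ j → sum (λ i → (f i * g i j) * h j))
      ≈⟨ sum-cong (λ j → *-distribʳ-sum (h j) (λ i → f i * g i j)) ⟨
    sum (λ j → sum (λ i → f i * g i j) * h j) ∎

  -- Written with `_==F_`, so that it is literally the right-hand side of `IsQOD` and `IsQHadamard`.
  δ : ∀ {n} → Fin n → Fin n → Carrier → Carrier
  δ a b x = if a ==F b then x else 0#

  δ-≡ : ∀ {n} (a : Fin n) x → δ a a x ≈ x
  δ-≡ a x rewrite ==F-refl a = ≈-refl

  δ-≢ : ∀ {n} {a b : Fin n} x → a ≢ b → δ a b x ≈ 0#
  δ-≢ x a≢b rewrite ==F-≢ a≢b = ≈-refl

  sum-δˡ : ∀ {n} (a : Fin n) x (f : Fin n → Carrier) → sum (λ b → δ a b x * f b) ≈ x * f a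
  sum-δˡ a x f = ≈-trans
    (sum-single a (λ b b≢a → ≈-trans (*-congʳ (δ-≢ x (b≢a ∘ sym))) (zeroˡ _))) (*-congʳ (δ-≡ a x))

  sum-δʳ : ∀ {n} (a : Fin n) x (f : Fin n → Carrier) → sum (λ b → f b * δ b a x) ≈ f a * x
  sum-δʳ a x f = ≈-trans
    (sum-single a (λ b b≢a → ≈-trans (*-congˡ (δ-≢ x b≢a)) (zeroʳ _))) (*-congˡ (δ-≡ a x))

  Central SelfAdjoint : Carrier → Set
  Central σ = ∀ x → (σ * x) ≈ (x * σ)
  SelfAdjoint σ = (σ ⋆) ≈ σ

  RowOrthogonal ColumnOrthogonal : ∀ {n} → Carrier → (Fin n → Fin n → Carrier) → Set
  RowOrthogonal    σ Y = ∀ a b → sum (λ c → Y a c * (Y b c ⋆)) ≈ δ a b σ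
  ColumnOrthogonal σ Y = ∀ a b → sum (λ c → (Y c a ⋆) * Y c b) ≈ δ a b σ

  -- With Z = Y⋆Y − σ, the trace of Z vanishes because y⋆y = yy⋆ entrywise.
  module _ {n} (Y : Fin n → Fin n → Carrier) {σ : Carrier}
           (central : Central σ) (adjoint : SelfAdjoint σ) (rows : RowOrthogonal σ Y) where
    private
      W Z : Fin n → Fin n → Carrier
      W a b = sum {n} (λ c → (Y c a ⋆) * Y c b)
      Z a b = W a b + - δ a b σ

      δ-⋆ : ∀ (a b : Fin n) → (δ a b σ ⋆) ≈ δ b a σ
      δ-⋆ a b with a Fin.≟ b
      ... | yes refl = ≈-trans adjoint (≈-sym (δ-≡ a σ))
      ... | no  a≢b  = ≈-trans ⋆-0 (≈-sym (δ-≢ σ (a≢b ∘ sym)))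

      Z-hermitian : ∀ a b → (Z a b ⋆) ≈ Z b a
      Z-hermitian a b = ≈-trans (⋆-+ _ _) (+-cong
        (≈-trans (⋆-sum (λ c → (Y c a ⋆) * Y c b))
          (sum-cong (λ c → ≈-trans (⋆-* (Y c a ⋆) (Y c b)) (*-congˡ (⋆-⋆ (Y c a))))))
        (≈-trans (⋆-neg _) (-‿cong (δ-⋆ a b))))

      -- YZ = (YY⋆)Y - Yσ = σY - Yσ, and σ is central.
      YZ : ∀ d c → sum (λ b → Y d b * Z b c) ≈ 0#
      YZ d c = begin
        sum (λ b → Y d b * Z b c)
          ≈⟨ sum-cong (λ b → ≈-trans (distribˡ (Y d b) (W b c) (- δ b c σ)) (+-congˡ (≈-sym (-‿distribʳ-* (Y d b) (δ b c σ))))) ⟩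
        sum (λ b → Y d b * W b c + - (Y d b * δ b c σ))
          ≈⟨ ∑-distrib-+ (λ b → Y d b * W b c) (λ b → - (Y d b * δ b c σ)) ⟩
        sum (λ b → Y d b * W b c) + sum (λ b → - (Y d b * δ b c σ))
          ≈⟨ +-cong (sum-assoc (Y d) (λ b e → Y e b ⋆) (λ e → Y e c))
               (≈-trans (sum-neg (λ b → Y d b * δ b c σ)) (-‿cong (sum-δʳ c σ (Y d)))) ⟩
        sum (λ e → sum (λ b → Y d b * (Y e b ⋆)) * Y e c) + - (Y d c * σ)
          ≈⟨ +-congʳ (sum-cong (λ e → *-congʳ (rows d e))) ⟩
        sum (λ e → δ d e σ * Y e c) + - (Y d c * σ)
          ≈⟨ +-congʳ (≈-trans (sum-δˡ d σ (λ e → Y e c)) (central _)) ⟩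
        Y d c * σ + - (Y d c * σ)
          ≈⟨ -‿inverseʳ _ ⟩
        0# ∎

      ZZ : ∀ a c → sum (λ b → Z a b * Z b c) ≈ - (σ * Z a c)
      ZZ a c = begin
        sum (λ b → Z a b * Z b c)
          ≈⟨ sum-cong (λ b → ≈-trans (distribʳ (Z b c) (W a b) (- δ a b σ)) (+-congˡ (≈-sym (-‿distribˡ-* (δ a b σ) (Z b c))))) ⟩
        sum (λ b → W a b * Z b c + - (δ a b σ * Z b c))
          ≈⟨ ∑-distrib-+ (λ b → W a b * Z b c) (λ b → - (δ a b σ * Z b c)) ⟩
        sum (λ b → W a b * Z b c) + sum (λ b → - (δ a b σ * Z b c))
          ≈⟨ +-cong (≈-sym (sum-assoc (λ d → Y d a ⋆) Y (λ b → Z b c)))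
               (≈-trans (sum-neg (λ b → δ a b σ * Z b c)) (-‿cong (sum-δˡ a σ (λ b → Z b c)))) ⟩
        sum (λ d → (Y d a ⋆) * sum (λ b → Y d b * Z b c)) + - (σ * Z a c)
          ≈⟨ +-congʳ (sum-0 (λ d → ≈-trans (*-congˡ (YZ d c)) (zeroʳ _))) ⟩
        0# + - (σ * Z a c)
          ≈⟨ +-identityˡ _ ⟩
        - (σ * Z a c) ∎

      traceZ : sum (λ a → Z a a) ≈ 0#
      traceZ = begin
        sum (λ a → W a a + - δ a a σ)
          ≈⟨ ∑-distrib-+ (λ a → W a a) (λ a → - δ {n} a a σ) ⟩
        sum (λ a → W a a) + sum {n} (λ a → - δ a a σ)
          ≈⟨ +-cong (sum-cong (λ a → sum-cong (λ c → normal (Y c a)))) (sum-neg {n} (λ a → δ a a σ)) ⟩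
        sum (λ a → sum (λ c → Y c a * (Y c a ⋆))) + - sum {n} (λ a → δ a a σ)
          ≈⟨ +-congʳ (∑-comm (λ a c → Y c a * (Y c a ⋆))) ⟩
        sum (λ c → sum (λ a → Y c a * (Y c a ⋆))) + - sum {n} (λ a → δ a a σ)
          ≈⟨ +-congʳ (sum-cong (λ c → rows c c)) ⟩
        sum {n} (λ a → δ a a σ) + - sum {n} (λ a → δ a a σ)
          ≈⟨ -‿inverseʳ _ ⟩
        0# ∎

      -- Z is hermitian, so this is the trace of Z² = -σZ.
      squares : sum (λ a → sum (λ b → Z a b * (Z a b ⋆))) ≈ 0#
      squares = begin
        sum (λ a → sum (λ b → Z a b * (Z a b ⋆)))
          ≈⟨ sum-cong (λ a → sum-cong (λ b → *-congˡ (Z-hermitian a b))) ⟩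
        sum (λ a → sum (λ b → Z a b * Z b a))
          ≈⟨ sum-cong (λ a → ZZ a a) ⟩
        sum (λ a → - (σ * Z a a))
          ≈⟨ ≈-trans (sum-neg (λ a → σ * Z a a)) (-‿cong (≈-sym (*-distribˡ-sum σ (λ a → Z a a)))) ⟩
        - (σ * sum (λ a → Z a a))
          ≈⟨ -‿cong (≈-trans (*-congˡ traceZ) (zeroʳ σ)) ⟩
        - 0#
          ≈⟨ -0#≈0# ⟩
        0# ∎

      ∑-tabulate : ∀ {A : Set} {k} (f : Fin k → A) (g : A → Carrier) → ∑ (List.tabulate f) g ≈ sum (g ∘ f)
      ∑-tabulate {k = zero}  f g = ≈-refl
      ∑-tabulate {k = suc k} f g = +-congˡ (∑-tabulate (f ∘ Fin.suc) g)

      Z-vanishes : ∀ a b → Z a b ≈ 0#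
      Z-vanishes a b = Allₚ.tabulate⁻ (Allₚ.tabulate⁻ (Allₚ.map⁻ (Allₚ.concat⁻
        (definite (concatMap row (List.tabulate id)) total))) a) b
        where
        row : Fin n → List Carrier
        row a = List.tabulate (Z a)
        total : ∑ (concatMap row (List.tabulate id)) (λ x → x * (x ⋆)) ≈ 0#
        total = begin
          ∑ (concatMap row (List.tabulate id)) (λ x → x * (x ⋆))
            ≈⟨ ∑-concatMap row (List.tabulate id) (λ x → x * (x ⋆)) ⟩
          ∑ (List.tabulate id) (λ a → ∑ (row a) (λ x → x * (x ⋆)))
            ≈⟨ ∑-tabulate id (λ a → ∑ (row a) (λ x → x * (x ⋆))) ⟩
          sum (λ a → ∑ (row a) (λ x → x * (x ⋆)))
            ≈⟨ sum-cong (λ a → ∑-tabulate (Z a) (λ x → x * (x ⋆))) ⟩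
          sum (λ a → sum (λ b → Z a b * (Z a b ⋆)))
            ≈⟨ squares ⟩
          0# ∎

    columns-orthogonal : ColumnOrthogonal σ Y
    columns-orthogonal a b = ≈-trans (inverseˡ-unique _ _ (Z-vanishes a b)) (neg-neg _)

  -- Each `y i` stands to the right of the conjugated row, so the rows of `A` meet in the middle of
  -- y⋆ A A⋆ y′ without passing a noncommuting factor; what they leave there is `k`, which moves out
  -- because it is central.
  gram-of-blocks : ∀ {D n k} (A : Fin n → Fin n → Carrier) → Central k → RowOrthogonal k A →
    (t t′ : Fin D → Fin n) (y y′ : Fin D → Carrier) →
    sum (λ i → sum (λ a → (((A (t i) a ⋆) * y i) ⋆) * ((A (t′ i) a ⋆) * y′ i)))
      ≈ k * sum (λ i → δ (t i) (t′ i) ((y i ⋆) * y′ i))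
  gram-of-blocks {k = k} A central rows t t′ y y′ =
    ≈-trans (sum-cong block) (≈-sym (*-distribˡ-sum k (λ i → δ (t i) (t′ i) ((y i ⋆) * y′ i))))
    where
    δ-middle : ∀ {n} (a b : Fin n) x z → (x * (δ a b k * z)) ≈ (k * δ a b (x * z))
    δ-middle a b x z with a ==F b
    ... | true  = ≈-trans (≈-sym (*-assoc _ _ _)) (≈-trans (*-congʳ (≈-sym (central x))) (*-assoc _ _ _))
    ... | false = ≈-trans (≈-trans (*-congˡ (zeroˡ z)) (zeroʳ x)) (≈-sym (zeroʳ k))
    block : ∀ i → sum (λ a → (((A (t i) a ⋆) * y i) ⋆) * ((A (t′ i) a ⋆) * y′ i))
                  ≈ k * δ (t i) (t′ i) ((y i ⋆) * y′ i)
    block i = begin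
      sum (λ a → (((A (t i) a ⋆) * y i) ⋆) * ((A (t′ i) a ⋆) * y′ i))
        ≈⟨ sum-cong (λ a → *-congʳ (≈-trans (⋆-* (A (t i) a ⋆) (y i)) (*-congˡ (⋆-⋆ (A (t i) a))))) ⟩
      sum (λ a → ((y i ⋆) * A (t i) a) * ((A (t′ i) a ⋆) * y′ i))
        ≈⟨ sum-cong (λ a → ≈-trans (*-assoc (y i ⋆) (A (t i) a) _) (*-congˡ (≈-sym (*-assoc (A (t i) a) (A (t′ i) a ⋆) (y′ i))))) ⟩
      sum (λ a → (y i ⋆) * ((A (t i) a * (A (t′ i) a ⋆)) * y′ i))
        ≈⟨ *-distribˡ-sum (y i ⋆) (λ a → (A (t i) a * (A (t′ i) a ⋆)) * y′ i) ⟨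
      (y i ⋆) * sum (λ a → (A (t i) a * (A (t′ i) a ⋆)) * y′ i)
        ≈⟨ *-congˡ (*-distribʳ-sum (y′ i) (λ a → A (t i) a * (A (t′ i) a ⋆))) ⟨
      (y i ⋆) * (sum (λ a → A (t i) a * (A (t′ i) a ⋆)) * y′ i)
        ≈⟨ *-congˡ (*-congʳ (rows (t i) (t′ i))) ⟩
      (y i ⋆) * (δ (t i) (t′ i) k * y′ i)
        ≈⟨ δ-middle (t i) (t′ i) (y i ⋆) (y′ i) ⟩
      k * δ (t i) (t′ i) ((y i ⋆) * y′ i) ∎

-- Positions in the circulants: arithmetic modulo the odd number D = 2n - 1.

module Cyclic (m : ℕ) where
  open import Data.Nat using (_+_; _*_; _<ᵇ_; _≤?_; _<?_)
  open import Data.Nat.DivMod using (_%_; _mod_; m%n<n; m<n⇒m%n≡m; [m+n]%n≡m%n)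
  open import Data.Nat.Tactic.RingSolver using (solve-∀)

  N D : ℕ
  N = suc m
  D = suc (m + m)

  shift : Fin D → Fin D → ℕ
  shift p q = (toℕ q + D ∸ toℕ p) % D

  -- The index of C at position r of the first block row C₀, ..., C_(n-1), C_(n-1), ..., C₁, in
  -- other words the representative of ±r modulo D below N. The final `mod N` only forms the element
  -- of `Fin N`.
  fold : ℕ → Fin N
  fold r = (if r <ᵇ N then r else D ∸ r) mod N

  -- The congruence i + s ≡ j modulo D for residues below D, where at most one wrap can occur.
  -- Equations in ℕ replace remainders and truncated subtraction.
  Step : ℕ → ℕ → ℕ → Set
  Step i s j = (i + s ≡ j) ⊎ (i + s ≡ j + D)

  no-wrap : ∀ {a b} → a < D → a ≢ b + D
  no-wrap {b = b} a<D refl = ℕₚ.<⇒≱ a<D (ℕₚ.m≤n+m D b)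

  step-mod : ∀ i s → i < D → s < D → Step i s ((i + s) % D)
  step-mod i s i<D s<D with i + s <? D
  ... | yes lt = inj₁ (sym (m<n⇒m%n≡m lt))
  ... | no  ge = inj₂ (trans (sym e) (cong (_+ D) (sym (trans (cong (_% D) (sym e))
                   (trans ([m+n]%n≡m%n x D) (m<n⇒m%n≡m x<D))))))
    where
    x = i + s ∸ D
    e : x + D ≡ i + s
    e = ℕₚ.m∸n+n≡m (ℕₚ.≮⇒≥ ge)
    x<D : x < D
    x<D = ℕₚ.+-cancelʳ-< D x D (subst (_< D + D) (sym e) (ℕₚ.+-mono-< i<D s<D))

  step-shift : ∀ i j → Step (toℕ i) (shift i j) (toℕ j)
  step-shift i j with toℕ i ≤? toℕ j
  ... | yes i≤j = inj₁ (trans (cong (toℕ i +_) (trans (cong (_% D) (ℕₚ.+-∸-comm D i≤j))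
                    (trans ([m+n]%n≡m%n (toℕ j ∸ toℕ i) D) (m<n⇒m%n≡m (ℕₚ.≤-<-trans (ℕₚ.m∸n≤m _ (toℕ i)) (Finₚ.toℕ<n j))))))
                    (ℕₚ.m+[n∸m]≡n i≤j))
  ... | no  i≰j = inj₂ (trans (cong (toℕ i +_) (m<n⇒m%n≡m x<D)) e)
    where
    x = toℕ j + D ∸ toℕ i
    e : toℕ i + x ≡ toℕ j + D
    e = ℕₚ.m+[n∸m]≡n (ℕₚ.≤-trans (ℕₚ.<⇒≤ (Finₚ.toℕ<n i)) (ℕₚ.m≤n+m D (toℕ j)))
    x<D : x < D
    x<D = ℕₚ.+-cancelˡ-< (toℕ i) x D (subst (_< toℕ i + D) (sym e) (ℕₚ.+-monoˡ-< D (ℕₚ.≰⇒> i≰j)))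

  shift<D : ∀ i j → shift i j < D
  shift<D i j = m%n<n (toℕ j + D ∸ toℕ i) D

  step-unique : ∀ {i s s′ j} → s < D → s′ < D → Step i s j → Step i s′ j → s ≡ s′
  step-unique {i} {s} {s′} {j} s< s′< (inj₁ p) (inj₁ q) = ℕₚ.+-cancelˡ-≡ i s s′ (trans p (sym q))
  step-unique {i} {s} {s′} {j} s< s′< (inj₂ p) (inj₂ q) = ℕₚ.+-cancelˡ-≡ i s s′ (trans p (sym q))
  step-unique {i} {s} {s′} {j} s< s′< (inj₁ p) (inj₂ q) = ⊥-elim (no-wrap s′<
    (ℕₚ.+-cancelˡ-≡ i s′ (s + D) (trans q (trans (cong (_+ D) (sym p)) (ℕₚ.+-assoc i s D)))))
  step-unique {i} {s} {s′} {j} s< s′< (inj₂ p) (inj₁ q) = ⊥-elim (no-wrap s<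
    (ℕₚ.+-cancelˡ-≡ i s (s′ + D) (trans p (trans (cong (_+ D) (sym q)) (ℕₚ.+-assoc i s′ D)))))

  step-target : ∀ {i s j j′} → j < D → j′ < D → Step i s j → Step i s j′ → j ≡ j′
  step-target j< j′< (inj₁ p) (inj₁ q) = trans (sym p) q
  step-target j< j′< (inj₂ p) (inj₂ q) = ℕₚ.+-cancelʳ-≡ D _ _ (trans (sym p) q)
  step-target j< j′< (inj₁ p) (inj₂ q) = ⊥-elim (no-wrap j< (trans (sym p) q))
  step-target j< j′< (inj₂ p) (inj₁ q) = ⊥-elim (no-wrap j′< (trans (sym q) p))

  step-comm : ∀ {i s j} → Step i s j → Step s i j
  step-comm {i} {s} (inj₁ p) = inj₁ (trans (ℕₚ.+-comm s i) p)
  step-comm {i} {s} (inj₂ p) = inj₂ (trans (ℕₚ.+-comm s i) p)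

  shift-unique : ∀ i j {s} → s < D → Step (toℕ i) s (toℕ j) → shift i j ≡ s
  shift-unique i j s<D st = step-unique (shift<D i j) s<D (step-shift i j) st

  step-back : ∀ {i s j} → 0 < s → s < D → Step i s j → Step j (D ∸ s) i
  step-back {i} {s} {j} _ s<D (inj₁ p) = inj₂ (trans (cong (_+ (D ∸ s)) (sym p))
    (trans (ℕₚ.+-assoc i s _) (cong (i +_) (ℕₚ.m+[n∸m]≡n (ℕₚ.<⇒≤ s<D)))))
  step-back {i} {s} {j} _ s<D (inj₂ p) = inj₁ (ℕₚ.+-cancelʳ-≡ s _ _ (trans (ℕₚ.+-assoc j _ s)
    (trans (cong (j +_) (ℕₚ.m∸n+n≡m (ℕₚ.<⇒≤ s<D))) (sym p))))

  FoldSpec : ℕ → Set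
  FoldSpec r = (toℕ (fold r) ≡ r) ⊎ (toℕ (fold r) + r ≡ D)

  toℕ-mod : ∀ {x} → x < N → toℕ (x mod N) ≡ x
  toℕ-mod {x} x<N = trans (Finₚ.toℕ-fromℕ< (m%n<n x N)) (m<n⇒m%n≡m x<N)

  fold-low : ∀ {r} → r < N → toℕ (fold r) ≡ r
  fold-low {r} r<N with r <ᵇ N | ℕₚ.<⇒<ᵇ r<N
  ... | true | _ = toℕ-mod r<N

  fold-high : ∀ {r} → ¬ r < N → toℕ (fold r) ≡ D ∸ r
  fold-high {r} r≮N with r <ᵇ N in eq
  ... | true  = ⊥-elim (r≮N (ℕₚ.<ᵇ⇒< r N (subst T (sym eq) _)))
  ... | false = toℕ-mod (s≤s (subst (D ∸ r ≤_) (ℕₚ.m+n∸m≡n N m) (ℕₚ.∸-monoʳ-≤ D (ℕₚ.≮⇒≥ r≮N))))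

  fold-spec : ∀ {r} → r < D → FoldSpec r
  fold-spec {r} r<D with r <? N
  ... | yes r<N = inj₁ (fold-low r<N)
  ... | no  r≮N = inj₂ (trans (cong (_+ r) (fold-high r≮N)) (ℕₚ.m∸n+n≡m (ℕₚ.<⇒≤ r<D)))

  -- The indices 1, ..., n-1, n-1, ..., 1 form a palindrome, so r and -r carry the same C.
  fold-neg : ∀ {r} → 0 < r → r < D → fold (D ∸ r) ≡ fold r
  fold-neg {r} 0<r r<D = Finₚ.toℕ-injective (go (r <? N))
    where
    go : Dec (r < N) → toℕ (fold (D ∸ r)) ≡ toℕ (fold r)
    go (no  r≮N) = trans (fold-low (s≤s (subst (D ∸ r ≤_) (ℕₚ.m+n∸m≡n N m) (ℕₚ.∸-monoʳ-≤ D (ℕₚ.≮⇒≥ r≮N)))))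
                         (sym (fold-high r≮N))
    go (yes r<N) = trans (fold-high (ℕₚ.≤⇒≯ (ℕₚ.m+n≤o⇒m≤o∸n N (subst (_≤ D) refl
                           (s≤s (ℕₚ.+-monoʳ-≤ m (s≤s⁻¹ r<N)))))))
                         (trans (ℕₚ.m∸[m∸n]≡n (ℕₚ.<⇒≤ r<D)) (sym (fold-low r<N)))

  -- C₀ occurs once in the first block row, at position 0; as the reflected index of a nonzero
  -- position, 0 would force the shift to be D.
  fold-zero : ∀ i j → fold (shift i j) ≡ Fin.zero → i ≡ j
  fold-zero i j e with fold-spec (shift<D i j)
  ... | inj₂ p = ⊥-elim (ℕₚ.<⇒≢ (shift<D i j) (trans (cong (_+ shift i j) (sym (cong toℕ e))) p))
  ... | inj₁ p with step-shift i j | trans (sym p) (cong toℕ e)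
  ...   | inj₁ q | z = Finₚ.toℕ-injective (trans (sym (ℕₚ.+-identityʳ _)) (trans (cong (toℕ i +_) (sym z)) q))
  ...   | inj₂ q | z = ⊥-elim (no-wrap (Finₚ.toℕ<n i) (trans (sym (ℕₚ.+-identityʳ _)) (trans (cong (toℕ i +_) (sym z)) q)))

  shift-diag : ∀ i → shift i i ≡ 0
  shift-diag i = shift-unique i i (s≤s z≤n) (inj₁ (ℕₚ.+-identityʳ _))

  -- Off the diagonal the two shifts are negatives of each other modulo D. This symmetry of the
  -- pattern of C's carries the facts about rows over to columns.
  shift-comm : ∀ i j → fold (shift i j) ≡ fold (shift j i)
  shift-comm i j with i Fin.≟ j
  ... | yes refl = refl
  ... | no  i≢j  = trans (sym (fold-neg 0<s (shift<D i j)))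
                     (cong fold (sym (shift-unique j i D∸s<D (step-back {toℕ i} 0<s (shift<D i j) (step-shift i j)))))
    where
    0<s : 0 < shift i j
    0<s = ℕₚ.n≢0⇒n>0 (λ z → i≢j (fold-zero i j (cong fold z)))
    D∸s<D : D ∸ shift i j < D
    D∸s<D = ℕₚ.∸-monoʳ-< {D} 0<s (ℕₚ.<⇒≤ (shift<D i j))

  fold-eq : ∀ {r r′} → r < D → r′ < D → fold r ≡ fold r′ → (r ≡ r′) ⊎ (r + r′ ≡ D)
  fold-eq {r} {r′} r< r′< e with fold-spec r< | fold-spec r′<
  ... | inj₁ p | inj₁ q = inj₁ (trans (sym p) (trans (cong toℕ e) q))
  ... | inj₁ p | inj₂ q = inj₂ (trans (cong (_+ r′) (trans (sym p) (cong toℕ e))) q)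
  ... | inj₂ p | inj₁ q = inj₂ (trans (cong (r +_) (trans (sym q) (sym (cong toℕ e)))) (trans (ℕₚ.+-comm r _) p))
  ... | inj₂ p | inj₂ q = inj₁ (ℕₚ.+-cancelˡ-≡ (toℕ (fold r)) r r′ (trans p (trans (sym q) (cong (λ a → toℕ a + r′) (sym e)))))

  shift-injectiveʳ : ∀ i {j j′} → shift i j ≡ shift i j′ → j ≡ j′
  shift-injectiveʳ i {j} {j′} e = Finₚ.toℕ-injective (step-target {toℕ i} {shift i j} (Finₚ.toℕ<n j) (Finₚ.toℕ<n j′)
    (step-shift i j) (subst (λ s → Step (toℕ i) s (toℕ j′)) (sym e) (step-shift i j′)))

  -- j + j′ ≡ 2i modulo D, written without subtraction.
  Midpoint : ℕ → ℕ → Set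
  Midpoint x i = (2 * i + D ≡ x) ⊎ (2 * i ≡ x) ⊎ (2 * i ≡ x + D)

  +-interleave : ∀ i s s′ → 2 * i + (s + s′) ≡ (i + s) + (i + s′)
  +-interleave = solve-∀

  -- The sum of the two steps has 2i + D on the left; zero, one or two wraps on the right give the
  -- three alternatives.
  midpoint : ∀ i {j j′} → shift i j + shift i j′ ≡ D → Midpoint (toℕ j + toℕ j′) (toℕ i)
  midpoint i {j} {j′} e with step-shift i j | step-shift i j′
  ... | inj₁ p | inj₁ q = inj₁ (trans (cong (2 * toℕ i +_) (sym e)) (trans (+-interleave (toℕ i) (shift i j) (shift i j′)) (cong₂ _+_ p q)))
  ... | inj₁ p | inj₂ q = inj₂ (inj₁ (ℕₚ.+-cancelʳ-≡ (shift i j + shift i j′) _ _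
          (trans (+-interleave (toℕ i) (shift i j) (shift i j′)) (trans (cong₂ _+_ p q)
          (trans (sym (ℕₚ.+-assoc (toℕ j) (toℕ j′) D)) (cong (toℕ j + toℕ j′ +_) (sym e)))))))
  ... | inj₂ p | inj₁ q = inj₂ (inj₁ (ℕₚ.+-cancelʳ-≡ (shift i j + shift i j′) _ _
          (trans (+-interleave (toℕ i) (shift i j) (shift i j′)) (trans (cong₂ _+_ p q)
          (trans (regroup′ (toℕ j) D (toℕ j′)) (cong (toℕ j + toℕ j′ +_) (sym e)))))))
    where
    regroup′ : ∀ j d j′ → j + d + j′ ≡ j + j′ + d
    regroup′ = solve-∀
  ... | inj₂ p | inj₂ q = inj₂ (inj₂ (ℕₚ.+-cancelʳ-≡ (shift i j + shift i j′) _ _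
          (trans (+-interleave (toℕ i) (shift i j) (shift i j′)) (trans (cong₂ _+_ p q)
          (trans (regroup′ (toℕ j) D (toℕ j′)) (cong (toℕ j + toℕ j′ + D +_) (sym e)))))))
    where
    regroup′ : ∀ j d j′ → (j + d) + (j′ + d) ≡ j + j′ + d + d
    regroup′ = solve-∀

  -- Oddness of D enters the uniqueness proof here: it makes doubling injective modulo D.
  odd-gap : ∀ a b → 2 * a ≢ 2 * b + D
  odd-gap a b e = ℕₚ.even≢odd a (b + m) (trans e (regroup b m))
    where
    regroup : ∀ b m → 2 * b + suc (m + m) ≡ suc (2 * (b + m))
    regroup = solve-∀

  even-gap : ∀ {a b} → a < D → 2 * a ≢ 2 * b + D + D
  even-gap {a} {b} a<D e = no-wrap a<D (ℕₚ.*-cancelˡ-≡ a (b + D) 2 (trans e (regroup b D)))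
    where
    regroup : ∀ b d → 2 * b + d + d ≡ 2 * (b + d)
    regroup = solve-∀

  -- Equal alternatives give equal doubles. Alternatives that differ by D clash in parity, and those
  -- that differ by 2D would put one of the residues at D or above.
  midpoint-unique : ∀ {x i i′} → i < D → i′ < D → Midpoint x i → Midpoint x i′ → i ≡ i′
  midpoint-unique {x} {i} {i′} i< i′< = λ
    { (inj₁ p) (inj₁ q)               → halve (ℕₚ.+-cancelʳ-≡ D _ _ (trans p (sym q)))
    ; (inj₁ p) (inj₂ (inj₁ q))        → ⊥-elim (odd-gap i′ i (trans q (sym p)))
    ; (inj₁ p) (inj₂ (inj₂ q))        → ⊥-elim (even-gap {b = i} i′< (trans q (cong (_+ D) (sym p))))
    ; (inj₂ (inj₁ p)) (inj₁ q)        → ⊥-elim (odd-gap i i′ (trans p (sym q)))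
    ; (inj₂ (inj₁ p)) (inj₂ (inj₁ q)) → halve (trans p (sym q))
    ; (inj₂ (inj₁ p)) (inj₂ (inj₂ q)) → ⊥-elim (odd-gap i′ i (trans q (cong (_+ D) (sym p))))
    ; (inj₂ (inj₂ p)) (inj₁ q)        → ⊥-elim (even-gap {b = i′} i< (trans p (cong (_+ D) (sym q))))
    ; (inj₂ (inj₂ p)) (inj₂ (inj₁ q)) → ⊥-elim (odd-gap i i′ (trans p (cong (_+ D) (sym q))))
    ; (inj₂ (inj₂ p)) (inj₂ (inj₂ q)) → halve (trans p (sym q)) }
    where
    halve : 2 * i ≡ 2 * i′ → i ≡ i′
    halve = ℕₚ.*-cancelˡ-≡ i i′ 2

  -- The same C at positions j and j′ of row i means j - i ≡ ±(j′ - i). The plus sign is excluded by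
  -- j ≠ j′, and the minus sign makes i the midpoint of j and j′.
  meet-unique : ∀ {i i′ j j′} → j ≢ j′ → fold (shift i j) ≡ fold (shift i j′) →
                fold (shift i′ j) ≡ fold (shift i′ j′) → i ≡ i′
  meet-unique {i} {i′} {j} {j′} j≢j′ e e′ = Finₚ.toℕ-injective
    (midpoint-unique (Finₚ.toℕ<n i) (Finₚ.toℕ<n i′) (mid-of i e) (mid-of i′ e′))
    where
    mid-of : ∀ i → fold (shift i j) ≡ fold (shift i j′) → Midpoint (toℕ j + toℕ j′) (toℕ i)
    mid-of i e with fold-eq (shift<D i j) (shift<D i j′) e
    ... | inj₁ p = ⊥-elim (j≢j′ (shift-injectiveʳ i p))
    ... | inj₂ p = midpoint i p

  add : Fin D → Fin D → Fin D
  add i s = (toℕ i + toℕ s) mod D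

  step-add : ∀ i s → Step (toℕ i) (toℕ s) (toℕ (add i s))
  step-add i s = subst (Step (toℕ i) (toℕ s)) (sym (Finₚ.toℕ-fromℕ< (m%n<n (toℕ i + toℕ s) D)))
    (step-mod (toℕ i) (toℕ s) (Finₚ.toℕ<n i) (Finₚ.toℕ<n s))

  -- The offset from j′ to j or from j to j′ is even because D is odd; go half of it.
  meet-even : ∀ {j j′} r → j ≢ j′ → shift j′ j ≡ r + r → ∃ λ i → fold (shift i j) ≡ fold (shift i j′)
  meet-even {j} {j′} r j≢j′ e = i , trans (cong fold i→j) (trans (sym (fold-neg 0<r r<D)) (cong fold (sym i→j′)))
    where
    2r<D : r + r < D
    2r<D = subst (_< D) e (shift<D j′ j)
    r<D : r < D
    r<D = ℕₚ.≤-<-trans (ℕₚ.m≤m+n r r) 2r<D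
    0<r : 0 < r
    0<r = ℕₚ.n≢0⇒n>0 (λ { refl → j≢j′ (sym (fold-zero j′ j (cong fold e))) })
    i : Fin D
    i = add j′ (Fin.fromℕ< r<D)
    j′→i : Step (toℕ j′) r (toℕ i)
    j′→i = subst (λ s → Step (toℕ j′) s (toℕ i)) (Finₚ.toℕ-fromℕ< r<D) (step-add j′ (Fin.fromℕ< r<D))
    i→j′ : shift i j′ ≡ D ∸ r
    i→j′ = shift-unique i j′ (ℕₚ.∸-monoʳ-< {D} 0<r (ℕₚ.<⇒≤ r<D)) (step-back 0<r r<D j′→i)
    half : ∀ {a b c} → c < D → Step a r b → Step a (r + r) c → Step b r c
    half {a} c< (inj₁ p) (inj₁ q) = inj₁ (trans (cong (_+ r) (sym p)) (trans (ℕₚ.+-assoc a r r) q))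
    half {a} c< (inj₁ p) (inj₂ q) = inj₂ (trans (cong (_+ r) (sym p)) (trans (ℕₚ.+-assoc a r r) q))
    half {a} {b} c< (inj₂ p) (inj₁ q) = ⊥-elim (no-wrap c< (trans (sym q) (trans (sym (ℕₚ.+-assoc a r r)) (trans (cong (_+ r) p) (regroup b D r)))))
      where
      regroup : ∀ b d r → b + d + r ≡ b + r + d
      regroup = solve-∀
    half {a} {b} {c} c< (inj₂ p) (inj₂ q) = inj₁ (ℕₚ.+-cancelʳ-≡ D _ _
      (trans (regroup b r D) (trans (cong (_+ r) (sym p)) (trans (ℕₚ.+-assoc a r r) q))))
      where
      regroup : ∀ b r d → b + r + d ≡ b + d + r
      regroup = solve-∀
    i→j : shift i j ≡ r
    i→j = shift-unique i j r<D (half (Finₚ.toℕ<n j) j′→i (subst (λ s → Step (toℕ j′) s (toℕ j)) e (step-shift j′ j)))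

  parity : ∀ n → ∃ λ r → (n ≡ r + r) ⊎ (n ≡ suc (r + r))
  parity zero    = 0 , inj₁ refl
  parity (suc n) with parity n
  ... | r , inj₁ e = r , inj₂ (cong suc e)
  ... | r , inj₂ e = suc r , inj₁ (trans (cong suc e) (cong suc (sym (ℕₚ.+-suc r r))))

  meet : ∀ {j j′} → j ≢ j′ → ∃ λ i → fold (shift i j) ≡ fold (shift i j′)
  meet {j} {j′} j≢j′ with parity (shift j′ j)
  ... | r , inj₁ e = meet-even r j≢j′ e
  -- D = 2m + 1, so the offset opposite to 2r + 1 is 2(m - r), with half `m ∸ r`.
  ... | r , inj₂ e with meet-even (m ∸ r) (j≢j′ ∘ sym) back
    where
    r≤m : r ≤ m
    r≤m = ℕₚ.≮⇒≥ (λ m<r → ℕₚ.<⇒≱ (subst (_< D) e (shift<D j′ j)) (s≤s (ℕₚ.+-mono-≤ (ℕₚ.<⇒≤ m<r) (ℕₚ.<⇒≤ m<r))))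
    double : D ∸ suc (r + r) ≡ (m ∸ r) + (m ∸ r)
    double = trans (cong (λ x → x + x ∸ (r + r)) (sym (ℕₚ.m∸n+n≡m r≤m)))
      (trans (cong (_∸ (r + r)) (regroup (m ∸ r) r)) (ℕₚ.m+n∸n≡m _ (r + r)))
      where
      regroup : ∀ a r → (a + r) + (a + r) ≡ (a + a) + (r + r)
      regroup = solve-∀
    back : shift j j′ ≡ (m ∸ r) + (m ∸ r)
    back = trans (shift-unique j j′ (ℕₚ.∸-monoʳ-< {D} 0<s (ℕₚ.<⇒≤ (shift<D j′ j))) (step-back {toℕ j′} 0<s (shift<D j′ j) (step-shift j′ j)))
                 (trans (cong (D ∸_) e) double)
      where
      0<s : 0 < shift j′ j
      0<s = subst (0 <_) (sym e) (s≤s z≤n)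
  ...   | i , p = i , sym p

  shiftF : Fin D → Fin D → Fin D
  shiftF i j = Fin.fromℕ< (shift<D i j)

  toℕ-shiftF : ∀ i j → toℕ (shiftF i j) ≡ shift i j
  toℕ-shiftF i j = Finₚ.toℕ-fromℕ< (shift<D i j)

  -- For fixed j the map i ↦ j - i is its own inverse; it turns a sum down a circulant column into a
  -- sum over all positions. Along a row, j ↦ j - i has the inverse `add i` instead.
  shiftF-involutive : ∀ i j → shiftF (shiftF i j) j ≡ i
  shiftF-involutive i j = Finₚ.toℕ-injective (trans (toℕ-shiftF (shiftF i j) j)
    (shift-unique (shiftF i j) j (Finₚ.toℕ<n i)
      (subst (λ s → Step s (toℕ i) (toℕ j)) (sym (toℕ-shiftF i j)) (step-comm {toℕ i} (step-shift i j)))))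

  add-shiftF : ∀ i j → add i (shiftF i j) ≡ j
  add-shiftF i j = Finₚ.toℕ-injective (step-target {toℕ i} {toℕ (shiftF i j)} (Finₚ.toℕ<n (add i (shiftF i j))) (Finₚ.toℕ<n j) (step-add i (shiftF i j))
    (subst (λ s → Step (toℕ i) s (toℕ j)) (sym (toℕ-shiftF i j)) (step-shift i j)))

  shiftF-add : ∀ i s → shiftF i (add i s) ≡ s
  shiftF-add i s = Finₚ.toℕ-injective (trans (toℕ-shiftF i (add i s))
    (shift-unique i (add i s) (Finₚ.toℕ<n s) (step-add i s)))

-- Signs in a star ring.

_·_ : Sgn → Sgn → Sgn
plus  · s     = s
minus · plus  = minus
minus · minus = plus

module Signs {R : Ring 0ℓ 0ℓ} {_⋆ : Ring.Carrier R → Ring.Carrier R} (S : IsStarRing R _⋆) where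
  open Ring R renaming (refl to ≈-refl; sym to ≈-sym; trans to ≈-trans)
  open IsStarRing S
  open StarRing S
  open StarMatrices S using (sum; sum-neg)
  open import Algebra.Properties.Ring R using (-‿distribˡ-*; -‿distribʳ-*)
  open import Algebra.Properties.Group +-group using () renaming (⁻¹-involutive to neg-neg)

  signed : Sgn → Carrier → Carrier
  signed plus  x = x
  signed minus x = - x

  signed-cong : ∀ s {x y} → x ≈ y → signed s x ≈ signed s y
  signed-cong plus  e = e
  signed-cong minus e = -‿cong e

  signed-signed : ∀ s s′ x → signed s (signed s′ x) ≈ signed (s · s′) x
  signed-signed plus  s′    x = ≈-refl
  signed-signed minus plus  x = ≈-refl
  signed-signed minus minus x = neg-neg x

  signed-*ˡ : ∀ s x y → (signed s x * y) ≈ signed s (x * y)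
  signed-*ˡ plus  x y = ≈-refl
  signed-*ˡ minus x y = ≈-sym (-‿distribˡ-* x y)

  signed-*ʳ : ∀ s x y → (x * signed s y) ≈ signed s (x * y)
  signed-*ʳ plus  x y = ≈-refl
  signed-*ʳ minus x y = ≈-sym (-‿distribʳ-* x y)

  signed-⋆ : ∀ s x → (signed s x ⋆) ≈ signed s (x ⋆)
  signed-⋆ plus  x = ≈-refl
  signed-⋆ minus x = ⋆-neg x

  signed-⋆* : ∀ s s′ x y → ((signed s x ⋆) * signed s′ y) ≈ signed (s · s′) ((x ⋆) * y)
  signed-⋆* s s′ x y = ≈-trans (*-congʳ (signed-⋆ s x)) (≈-trans (signed-*ˡ s _ _)
    (≈-trans (signed-cong s (signed-*ʳ s′ _ _)) (signed-signed s s′ _)))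

  signed-sum : ∀ s {n} (f : Fin n → Carrier) → sum (λ i → signed s (f i)) ≈ signed s (sum f)
  signed-sum plus  f = ≈-refl
  signed-sum minus f = sum-neg f

-- Gram sums over one block row of the construction.

module BlockGram {R : Ring 0ℓ 0ℓ} {_⋆ : Ring.Carrier R → Ring.Carrier R} (S : IsStarRing R _⋆) (m : ℕ) where
  open Ring R renaming (refl to ≈-refl; sym to ≈-sym; trans to ≈-trans)
  open IsStarRing S
  open StarRing S
  open StarMatrices S
  open Signs S
  open Cyclic m
  open import Data.Nat using (_<ᵇ_; _<?_)
  open import Data.Nat.DivMod using (_%_; _mod_; m%n<n; m<n⇒m%n≡m; [m+n]%n≡m%n)
  open import Data.Fin.Permutation using (reverse; permutation)
  open import Algebra.Properties.Ring R using (-0#≈0#)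
  open import Algebra.Properties.Group +-group using (inverseʳ-unique)
  open import Relation.Binary.Reasoning.Setoid setoid

  -- With a summand on ℕ, a range can be split in the middle or lose its first index without casts
  -- between `Fin` types.
  sumℕ : ℕ → (ℕ → Carrier) → Carrier
  sumℕ n F = sum {n} (F ∘ toℕ)

  sumℕ-+ : ∀ a b F → sumℕ (a ℕ.+ b) F ≈ sumℕ a F + sumℕ b (F ∘ (λ k → a ℕ.+ k))
  sumℕ-+ zero    b F = ≈-sym (+-identityˡ _)
  sumℕ-+ (suc a) b F = ≈-trans (+-congˡ (sumℕ-+ a b (F ∘ suc))) (≈-sym (+-assoc _ _ _))

  -- The sign of the entries in column block r of circ(C₀, …, C_{n-1}, ±C_{n-1}, …, ±C₁).
  half : Sgn → ℕ → Sgn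
  half s r = if r <ᵇ N then plus else s

  half-low : ∀ s {r} → r < N → half s r ≡ plus
  half-low s {r} r<N with r <ᵇ N | ℕₚ.<⇒<ᵇ r<N
  ... | true | _ = refl

  half-high : ∀ s {r} → ¬ r < N → half s r ≡ s
  half-high s {r} r≮N with r <ᵇ N in eq
  ... | true  = ⊥-elim (r≮N (ℕₚ.<ᵇ⇒< r N (subst T (sym eq) _)))
  ... | false = refl

  -- Position 0 contributes f₀, positions 1 to m contribute f₁ to f_m, and positions m + 1 to 2m run
  -- back from f_m to f₁ with the sign `s`; the reversal does not affect the sum.
  ∑-fold : ∀ s (f : Fin N → Carrier) → sumℕ D (λ r → signed (half s r) (f (fold r))) ≈
           f Fin.zero + (sum (f ∘ Fin.suc) + signed s (sum (f ∘ Fin.suc)))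
  ∑-fold s f = +-congˡ (≈-trans (sumℕ-+ m m (λ k → signed (half s (suc k)) (f (fold (suc k))))) (+-cong (sum-cong low) high))
    where
    low : ∀ i → signed (half s (suc (toℕ i))) (f (fold (suc (toℕ i)))) ≈ f (Fin.suc i)
    low i rewrite half-low s (s≤s (Finₚ.toℕ<n i))
      | Finₚ.toℕ-injective {i = fold (suc (toℕ i))} {j = Fin.suc i} (fold-low (s≤s (Finₚ.toℕ<n i))) = ≈-refl
    opposite : ∀ i → fold (suc (m ℕ.+ toℕ i)) ≡ Fin.suc (Fin.opposite i)
    opposite i = Finₚ.toℕ-injective (trans (fold-high (ℕₚ.≤⇒≯ (s≤s (ℕₚ.m≤m+n m (toℕ i)))))
      (trans (ℕₚ.[m+n]∸[m+o]≡n∸o m m (toℕ i))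
      (trans (ℕₚ.+-∸-assoc 1 (Finₚ.toℕ<n i)) (cong suc (sym (Finₚ.opposite-prop i))))))
    high : sum {m} (λ i → signed (half s (suc (m ℕ.+ toℕ i))) (f (fold (suc (m ℕ.+ toℕ i)))))
           ≈ signed s (sum (f ∘ Fin.suc))
    high = begin
      sum {m} (λ i → signed (half s (suc (m ℕ.+ toℕ i))) (f (fold (suc (m ℕ.+ toℕ i)))))
        ≈⟨ sum-cong (λ i → reflexive (cong₂ (λ s′ k → signed s′ (f k))
             (half-high s (ℕₚ.≤⇒≯ (s≤s (ℕₚ.m≤m+n m (toℕ i))))) (opposite i))) ⟩
      sum (λ i → signed s (f (Fin.suc (Fin.opposite i))))
        ≈⟨ signed-sum s (λ i → f (Fin.suc (Fin.opposite i))) ⟩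
      signed s (sum (λ i → f (Fin.suc (Fin.opposite i))))
        ≈⟨ signed-cong s (sum-permute (f ∘ Fin.suc) reverse) ⟨
      signed s (sum (f ∘ Fin.suc)) ∎

  -- All that the Gram computation asks of the positions. `shift` and its transpose both satisfy it,
  -- so one computation covers the block rows and the block columns of X_(4n²).
  record Circulant (ρ : Fin D → Fin D → ℕ) : Set where
    field
      diag    : ∀ i → ρ i i ≡ 0
      zero⇒≡  : ∀ i j → fold (ρ i j) ≡ Fin.zero → i ≡ j
      common  : ∀ {j j′} → j ≢ j′ → ∃ λ i → fold (ρ i j) ≡ fold (ρ i j′)
      common! : ∀ {i i′ j j′} → j ≢ j′ → fold (ρ i j) ≡ fold (ρ i j′) → fold (ρ i′ j) ≡ fold (ρ i′ j′) → i ≡ i′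
      ∑-row   : ∀ (F : ℕ → Carrier) j → sum (λ i → F (ρ i j)) ≈ sumℕ D F

  rows-circulant : Circulant shift
  rows-circulant = record
    { diag = shift-diag ; zero⇒≡ = fold-zero ; common = meet ; common! = meet-unique
    ; ∑-row = λ F j → ≈-trans (sum-cong (λ i → reflexive (cong F (sym (toℕ-shiftF i j)))))
        (≈-sym (sum-permute (F ∘ toℕ) (permutation (λ i → shiftF i j) (λ i → shiftF i j)
          (λ i → shiftF-involutive i j) (λ i → shiftF-involutive i j)))) }

  columns-circulant : Circulant (λ i j → shift j i)
  columns-circulant = record
    { diag = shift-diag
    ; zero⇒≡ = λ i j e → sym (fold-zero j i e)
    ; common = λ {j} {j′} j≢j′ → let (i , e) = meet j≢j′ in i , flip i e
    ; common! = λ {i} {i′} j≢j′ e e′ → meet-unique j≢j′ (flop i e) (flop i′ e′)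
    ; ∑-row = λ F j → ≈-trans (sum-cong (λ i → reflexive (cong F (sym (toℕ-shiftF j i)))))
        (≈-sym (sum-permute (F ∘ toℕ) (permutation (shiftF j) (add j) (shiftF-add j) (add-shiftF j)))) }
    where
    flip : ∀ i {j j′} → fold (shift i j) ≡ fold (shift i j′) → fold (shift j i) ≡ fold (shift j′ i)
    flip i {j} {j′} e = trans (shift-comm j i) (trans e (shift-comm i j′))
    flop : ∀ i {j j′} → fold (shift j i) ≡ fold (shift j′ i) → fold (shift i j) ≡ fold (shift i j′)
    flop i {j} {j′} e = trans (shift-comm i j) (trans e (shift-comm j′ i))

  corner : ℕ → ℕ → Sgn
  corner p q = if p <ᵇ N then plus else half minus q

  mod-low : ∀ (i : Fin N) → toℕ i mod N ≡ i
  mod-low i = Finₚ.toℕ-injective (toℕ-mod (Finₚ.toℕ<n i))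

  mod-high : ∀ (i : Fin N) → (N ℕ.+ toℕ i) mod N ≡ i
  mod-high i = Finₚ.toℕ-injective (trans (Finₚ.toℕ-fromℕ< (m%n<n (N ℕ.+ toℕ i) N))
    (trans (cong (_% N) (ℕₚ.+-comm N (toℕ i))) (trans ([m+n]%n≡m%n (toℕ i) N) (m<n⇒m%n≡m (Finₚ.toℕ<n i)))))

  mod-injective : ∀ {p q} → p < N ℕ.+ N → q < N ℕ.+ N → p mod N ≡ q mod N → half minus p ≡ half minus q → p ≡ q
  mod-injective {p} {q} p< q< e h = go (p <? N) (q <? N)
    where
    plus≢minus : plus ≢ minus
    plus≢minus ()
    residue : ∀ {x} → ¬ x < N → x < N ℕ.+ N → N ℕ.+ toℕ (x mod N) ≡ x
    residue {x} x≮N x< = trans (cong (N ℕ.+_) (trans (Finₚ.toℕ-fromℕ< (m%n<n x N))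
      (trans (cong (_% N) (sym x′+N)) (trans ([m+n]%n≡m%n (x ∸ N) N) (m<n⇒m%n≡m x′<N)))))
      (trans (ℕₚ.+-comm N _) x′+N)
      where
      x′+N : x ∸ N ℕ.+ N ≡ x
      x′+N = ℕₚ.m∸n+n≡m (ℕₚ.≮⇒≥ x≮N)
      x′<N : x ∸ N < N
      x′<N = ℕₚ.+-cancelʳ-< N (x ∸ N) N (subst (_< N ℕ.+ N) (sym x′+N) x<)
    go : Dec (p < N) → Dec (q < N) → p ≡ q
    go (yes a) (yes b) = trans (sym (toℕ-mod a)) (trans (cong toℕ e) (toℕ-mod b))
    go (yes a) (no b)  = ⊥-elim (plus≢minus (trans (sym (half-low minus a)) (trans h (half-high minus b))))
    go (no a)  (yes b) = ⊥-elim (plus≢minus (trans (sym (half-low minus b)) (trans (sym h) (half-high minus a))))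
    go (no a)  (no b)  = trans (sym (residue a p<)) (trans (cong (λ z → N ℕ.+ toℕ z) e) (residue b q<))

  module Blocks (B : Fin N → Fin N → Carrier)
                (columns : ∀ {a b} → a ≢ b → sum (λ c → (B c a ⋆) * B c b) ≈ 0#)
                {ρ : Fin D → Fin D → ℕ} (circ : Circulant ρ) where
    open Circulant circ

    -- The Kronecker product of [[1,1],[1,−1]] with B.
    B̂ : ℕ → ℕ → Carrier
    B̂ p q = signed (corner p q) (B (p mod N) (q mod N))

    -- In block row i, column p has the entries h_t* y with t = `block i p` and y = `entry i p`. The
    -- top columns have t = 0 because E_i = h₀* r̂_i, and the `suc` in their `entry` starts at r̂₁,
    -- since r̂₀ belongs to G. In a block column, r_t* and ĥ_i take these places.
    block : Fin D → Idx m → Fin N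
    block i (top q)   = Fin.zero
    block i (mid j c) = fold (ρ i j)
    block i (bot j c) = fold (ρ i j)

    entry : Fin D → Idx m → Carrier
    entry i (top q)   = B̂ (suc (toℕ i)) (toℕ q)
    entry i (mid j c) = signed (half plus (ρ i j)) (B (fold (ρ i j)) c)
    entry i (bot j c) = signed (half minus (ρ i j)) (B (fold (ρ i j)) c)

    gram : Idx m → Idx m → Carrier
    gram p q = sum (λ i → δ (block i p) (block i q) ((entry i p ⋆) * entry i q))

    IsEntry IsProduct : Carrier → Set
    IsEntry x = ∃[ s ] ∃[ a ] ∃[ c ] (x ≡ signed s (B a c))
    IsProduct x = ∃[ s ] ∃[ a ] ∃[ c ] ∃[ a′ ] ∃[ c′ ] (x ≈ signed s ((B a c ⋆) * B a′ c′))

    B̂-isEntry : ∀ p q → IsEntry (B̂ p q)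
    B̂-isEntry p q = corner p q , p mod N , q mod N , refl

    isEntry : ∀ i p → IsEntry (entry i p)
    isEntry i (top q)   = B̂-isEntry (suc (toℕ i)) (toℕ q)
    isEntry i (mid j c) = half plus (ρ i j) , fold (ρ i j) , c , refl
    isEntry i (bot j c) = half minus (ρ i j) , fold (ρ i j) , c , refl

    isProduct : ∀ {x y z} s → IsEntry x → IsEntry y → z ≈ signed s ((x ⋆) * y) → IsProduct z
    isProduct s (s₁ , a , c , refl) (s₂ , a′ , c′ , refl) e = s · (s₁ · s₂) , a , c , a′ , c′ ,
      ≈-trans e (≈-trans (signed-cong s (signed-⋆* s₁ s₂ _ _)) (signed-signed s _ _))

    gram-single : ∀ p q i → block i p ≡ block i q → (∀ i′ → block i′ p ≡ block i′ q → i′ ≡ i) → IsProduct (gram p q)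
    gram-single p q i e unique = isProduct plus (isEntry i p) (isEntry i q) (begin
      gram p q
        ≈⟨ sum-single i (λ i′ i′≢i → δ-≢ ((entry i′ p ⋆) * entry i′ q) (i′≢i ∘ unique i′)) ⟩
      δ (block i p) (block i q) ((entry i p ⋆) * entry i q)
        ≡⟨ cong (λ b → δ b (block i q) ((entry i p ⋆) * entry i q)) e ⟩
      δ (block i q) (block i q) ((entry i p ⋆) * entry i q)
        ≈⟨ δ-≡ (block i q) _ ⟩
      (entry i p ⋆) * entry i q ∎)

    -- The lower half of the sum repeats the upper half up to the sign s₀. For different residues
    -- modulo N each half vanishes by `columns`. For equal residues p ≠ q lie in different halves of
    -- the index range, s₀ is minus, and the two halves cancel.
    B̂-columns : ∀ p q → p < N ℕ.+ N → q < N ℕ.+ N → p ≢ q → sumℕ (N ℕ.+ N) (λ r → (B̂ r p ⋆) * B̂ r q) ≈ 0#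
    B̂-columns p q p< q< p≢q = begin
      sumℕ (N ℕ.+ N) (λ r → (B̂ r p ⋆) * B̂ r q)
        ≈⟨ sumℕ-+ N N (λ r → (B̂ r p ⋆) * B̂ r q) ⟩
      sumℕ N (λ r → (B̂ r p ⋆) * B̂ r q) + sumℕ N (λ r → (B̂ (N ℕ.+ r) p ⋆) * B̂ (N ℕ.+ r) q)
        ≈⟨ +-cong (sum-cong low) (≈-trans (sum-cong high) (signed-sum s₀ f)) ⟩
      sum f + signed s₀ (sum f)
        ≈⟨ cancel ⟩
      0# ∎
      where
      f : Fin N → Carrier
      f r = (B r (p mod N) ⋆) * B r (q mod N)
      s₀ : Sgn
      s₀ = half minus p · half minus q
      low : ∀ r → ((B̂ (toℕ r) p ⋆) * B̂ (toℕ r) q) ≈ f r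
      low r with toℕ r <ᵇ N | ℕₚ.<⇒<ᵇ (Finₚ.toℕ<n r)
      ... | true | _ rewrite mod-low r = ≈-refl
      high : ∀ r → ((B̂ (N ℕ.+ toℕ r) p ⋆) * B̂ (N ℕ.+ toℕ r) q) ≈ signed s₀ (f r)
      high r with N ℕ.+ toℕ r <ᵇ N in eq
      ... | true  = ⊥-elim (ℕₚ.<⇒≱ (ℕₚ.<ᵇ⇒< (N ℕ.+ toℕ r) N (subst T (sym eq) _)) (ℕₚ.m≤m+n N (toℕ r)))
      ... | false rewrite mod-high r = signed-⋆* (half minus p) (half minus q) _ _
      opposite-signs : ∀ s s′ x → s ≢ s′ → (x + signed (s · s′) x) ≈ 0#
      opposite-signs plus  plus  x ne = ⊥-elim (ne refl)
      opposite-signs plus  minus x ne = -‿inverseʳ x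
      opposite-signs minus plus  x ne = -‿inverseʳ x
      opposite-signs minus minus x ne = ⊥-elim (ne refl)
      signed-0 : ∀ s {x} → x ≈ 0# → signed s x ≈ 0#
      signed-0 plus  e = e
      signed-0 minus e = ≈-trans (-‿cong e) -0#≈0#
      cancel : (sum f + signed s₀ (sum f)) ≈ 0#
      cancel with p mod N Fin.≟ q mod N
      ... | no  ne = ≈-trans (+-cong (columns ne) (signed-0 s₀ (columns ne))) (+-identityˡ 0#)
      ... | yes e  = opposite-signs (half minus p) (half minus q) (sum f) (p≢q ∘ mod-injective p< q< e)

    -- Adding row 0 of `B̂` would complete the sum to an inner product of two columns of `B̂`, which
    -- is zero; so the sum is minus the product taken from row 0.
    gram-top : ∀ p q → p ≢ q → IsProduct (gram (top p) (top q))
    gram-top p q p≢q = isProduct minus (B̂-isEntry 0 (toℕ p)) (B̂-isEntry 0 (toℕ q)) (begin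
      gram (top p) (top q)
        ≈⟨ sum-cong {D} (λ i → δ-≡ (Fin.zero {m}) (F (suc (toℕ i)))) ⟩
      sumℕ D (F ∘ suc)
        ≈⟨ inverseʳ-unique _ _ total ⟩
      - ((B̂ 0 (toℕ p) ⋆) * B̂ 0 (toℕ q)) ∎)
      where
      F : ℕ → Carrier
      F r = (B̂ r (toℕ p) ⋆) * B̂ r (toℕ q)
      total : (F 0 + sumℕ D (F ∘ suc)) ≈ 0#
      total = ≈-trans (reflexive (cong (λ n → sumℕ (suc n) F) (sym (ℕₚ.+-suc m m))))
        (B̂-columns (toℕ p) (toℕ q) (Finₚ.toℕ<n p) (Finₚ.toℕ<n q) (p≢q ∘ Finₚ.toℕ-injective))

    -- Two columns at the same position j share t in every block row, so no term drops out. The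
    -- index 0 occurs once and every other t twice, the second time with the sign s · s′: plus
    -- inside one block column of X_(4n²), minus across two.
    gram-same : ∀ s s′ j c c′ → sum (λ i → δ (fold (ρ i j)) (fold (ρ i j))
                  ((signed (half s (ρ i j)) (B (fold (ρ i j)) c) ⋆) * signed (half s′ (ρ i j)) (B (fold (ρ i j)) c′)))
                ≈ (B Fin.zero c ⋆) * B Fin.zero c′
                  + (sum (λ k → (B (Fin.suc k) c ⋆) * B (Fin.suc k) c′)
                     + signed (s · s′) (sum (λ k → (B (Fin.suc k) c ⋆) * B (Fin.suc k) c′)))
    gram-same s s′ j c c′ = begin
      sum (λ i → δ (fold (ρ i j)) (fold (ρ i j)) (F (ρ i j)))
        ≈⟨ sum-cong (λ i → ≈-trans (δ-≡ (fold (ρ i j)) (F (ρ i j))) (F≈ (ρ i j))) ⟩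
      sum (λ i → signed (half (s · s′) (ρ i j)) (f (fold (ρ i j))))
        ≈⟨ ∑-row (λ r → signed (half (s · s′) r) (f (fold r))) j ⟩
      sumℕ D (λ r → signed (half (s · s′) r) (f (fold r)))
        ≈⟨ ∑-fold (s · s′) f ⟩
      f Fin.zero + (sum (f ∘ Fin.suc) + signed (s · s′) (sum (f ∘ Fin.suc))) ∎
      where
      f : Fin N → Carrier
      f k = (B k c ⋆) * B k c′
      F : ℕ → Carrier
      F r = (signed (half s r) (B (fold r) c) ⋆) * signed (half s′ r) (B (fold r) c′)
      half-· : ∀ r → half s r · half s′ r ≡ half (s · s′) r
      half-· r with r <ᵇ N
      ... | true  = refl
      ... | false = refl
      F≈ : ∀ r → F r ≈ signed (half (s · s′) r) (f (fold r))
      F≈ r = ≈-trans (signed-⋆* (half s r) (half s′ r) _ _) (reflexive (cong (λ t → signed t (f (fold r))) (half-· r)))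

    -- Here y collects the rows other than row 0, so f₀ + y = 0 by column orthogonality and f₀ + 2y
    -- = y = -f₀.
    add-back : ∀ {x y c c′} → c ≢ c′ → (x ≈ (B Fin.zero c ⋆) * B Fin.zero c′ + (y + y)) →
               y ≈ sum (λ k → (B (Fin.suc k) c ⋆) * B (Fin.suc k) c′) → IsProduct x
    add-back {x} {y} {c} {c′} c≢c′ e ey = minus , _ , c , _ , c′ , (begin
      x                       ≈⟨ e ⟩
      f₀ + (y + y)            ≈⟨ +-assoc _ _ _ ⟨
      (f₀ + y) + y            ≈⟨ +-congʳ total ⟩
      0# + y                  ≈⟨ +-identityˡ y ⟩
      y                       ≈⟨ inverseʳ-unique f₀ y total ⟩
      - f₀ ∎)
      where
      f₀ : Carrier
      f₀ = (B Fin.zero c ⋆) * B Fin.zero c′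
      total : (f₀ + y) ≈ 0#
      total = ≈-trans (+-congˡ ey) (columns c≢c′)

    -- For one column over A and one over B, the two occurrences of each t ≠ 0 have opposite signs
    -- and only t = 0 is left. The case c = c′ is included, as the columns are still distinct.
    cancelled : ∀ {x y c c′} → (x ≈ (B Fin.zero c ⋆) * B Fin.zero c′ + (y + - y)) → IsProduct x
    cancelled {c = c} {c′} e = plus , _ , c , _ , c′ ,
      ≈-trans e (≈-trans (+-congˡ (-‿inverseʳ _)) (+-identityʳ _))

    private
      diag-block : ∀ j → Fin.zero ≡ fold (ρ j j)
      diag-block j = cong fold (sym (diag j))

      diag-unique : ∀ {j} i → Fin.zero ≡ fold (ρ i j) → i ≡ j
      diag-unique {j} i e = zero⇒≡ i j (sym e)

    gram-isProduct : ∀ p q → p ≢ q → IsProduct (gram p q)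
    gram-isProduct (top p)   (top q)     ne = gram-top p q (ne ∘ cong top)
    -- The top columns carry t = 0 throughout, and at position `j` this index occurs on the diagonal
    -- only, so block row `j` is the single common one.
    gram-isProduct (top p)   (mid j c)   ne = gram-single (top p) (mid j c) j (diag-block j) diag-unique
    gram-isProduct (top p)   (bot j c)   ne = gram-single (top p) (bot j c) j (diag-block j) diag-unique
    gram-isProduct (mid j c) (top q)     ne = gram-single (mid j c) (top q) j (sym (diag-block j)) (λ i → zero⇒≡ i j)
    gram-isProduct (bot j c) (top q)     ne = gram-single (bot j c) (top q) j (sym (diag-block j)) (λ i → zero⇒≡ i j)
    gram-isProduct (mid j c) (mid j′ c′) ne with j Fin.≟ j′
    ... | yes refl = add-back (ne ∘ cong (mid j)) (gram-same plus plus j c c′) ≈-refl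
    ... | no  j≢j′ = let (i , e) = common j≢j′ in
      gram-single (mid j c) (mid j′ c′) i e (λ i′ e′ → common! j≢j′ e′ e)
    gram-isProduct (mid j c) (bot j′ c′) ne with j Fin.≟ j′
    ... | yes refl = cancelled (gram-same plus minus j c c′)
    ... | no  j≢j′ = let (i , e) = common j≢j′ in
      gram-single (mid j c) (bot j′ c′) i e (λ i′ e′ → common! j≢j′ e′ e)
    gram-isProduct (bot j c) (mid j′ c′) ne with j Fin.≟ j′
    ... | yes refl = cancelled (gram-same minus plus j c c′)
    ... | no  j≢j′ = let (i , e) = common j≢j′ in
      gram-single (bot j c) (mid j′ c′) i e (λ i′ e′ → common! j≢j′ e′ e)
    gram-isProduct (bot j c) (bot j′ c′) ne with j Fin.≟ j′
    ... | yes refl = add-back (ne ∘ cong (bot j)) (gram-same minus minus j c c′) ≈-refl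
    ... | no  j≢j′ = let (i , e) = common j≢j′ in
      gram-single (bot j c) (bot j′ c′) i e (λ i′ e′ → common! j≢j′ e′ e)

    block-gram : ∀ {k} (A : Fin N → Fin N → Carrier) → Central k → RowOrthogonal k A →
      (M : Fin D → Fin N → Idx m → Carrier) → (∀ i a p → M i a p ≈ (A (block i p) a ⋆) * entry i p) →
      ∀ p q → p ≢ q → ∃[ s ] ∃[ a ] ∃[ c ] ∃[ a′ ] ∃[ c′ ]
        (sum (λ i → sum (λ a → (M i a p ⋆) * M i a q)) ≈ signed s (k * ((B a c ⋆) * B a′ c′)))
    block-gram {k} A central rows M M≈ p q p≢q with gram-isProduct p q p≢q
    ... | s , a , c , a′ , c′ , e = s , a , c , a′ , c′ , (begin
      sum (λ i → sum (λ a → (M i a p ⋆) * M i a q))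
        ≈⟨ sum-cong (λ i → sum-cong (λ a → *-cong (⋆-cong (M≈ i a p)) (M≈ i a q))) ⟩
      sum (λ i → sum (λ a → (((A (block i p) a ⋆) * entry i p) ⋆) * ((A (block i q) a ⋆) * entry i q)))
        ≈⟨ gram-of-blocks A central rows (λ i → block i p) (λ i → block i q) (λ i → entry i p) (λ i → entry i q) ⟩
      k * gram p q
        ≈⟨ *-congˡ e ⟩
      k * signed s ((B a c ⋆) * B a′ c′)
        ≈⟨ signed-*ʳ s k _ ⟩
      signed s (k * ((B a c ⋆) * B a′ c′)) ∎)

-- Monomials and quaternion constants among the polynomials.

cmono : ∀ {u} → Exp u → GI → Poly u
cmono e g f = if e ==E f then g else 0G

addE : ∀ {u} → Exp u → Exp u → Exp u
addE = Vec.zipWith (λ (a , b) (c , d) → (a ℕ.+ c , b ℕ.+ d))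

module _ {u : ℕ} where
  open Curried (polyRing u)

  curryP-cmono : ∀ i j (e : Exp u) g a b →
                 curryP (cmono ((i , j) ∷ e) g) a b ≈P Outer.term i (Inner.term j (cmono e g)) a b
  curryP-cmono zero    zero    e g zero    zero    f = refl
  curryP-cmono zero    zero    e g zero    (suc b) f = refl
  curryP-cmono zero    (suc j) e g zero    zero    f = refl
  curryP-cmono zero    (suc j) e g zero    (suc b) f = curryP-cmono zero j e g zero b f
  curryP-cmono zero    j       e g (suc a) b       f = refl
  curryP-cmono (suc i) j       e g zero    b       f = refl
  curryP-cmono (suc i) j       e g (suc a) b       f = curryP-cmono i j e g a b f

-- In curried form a monomial is a single term of each of the two series, so the product is computed
-- one variable at a time and the convolution never has to be searched for its nonzero term.
cmono-* : ∀ {u} (e f : Exp u) g h → (cmono e g *P cmono f h) ≈P cmono (addE e f) (g *G h)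
cmono-* {zero}  []            []            g h [] = G.+-identityʳ (g *G h)
cmono-* {suc u} ((i , j) ∷ e) ((k , l) ∷ f) g h = λ { ((a , b) ∷ d) → equal a b d }
  where
  open Curried (polyRing u)
  open import Relation.Binary.Reasoning.Setoid (P.setoid {u})
  equal : ∀ a b → curryP (cmono ((i , j) ∷ e) g *P cmono ((k , l) ∷ f) h) a b
                  ≈P curryP (cmono ((i ℕ.+ k , j ℕ.+ l) ∷ addE e f) (g *G h)) a b
  equal a b = begin
    curryP (cmono ((i , j) ∷ e) g *P cmono ((k , l) ∷ f) h) a b
      ≈⟨ curryP-⊛ (cmono ((i , j) ∷ e) g) (cmono ((k , l) ∷ f) h) a b ⟩
    (curryP (cmono ((i , j) ∷ e) g) Outer.⊛ curryP (cmono ((k , l) ∷ f) h)) a b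
      ≈⟨ Outer.⊛-cong (curryP-cmono i j e g) (curryP-cmono k l f h) a b ⟩
    (Outer.term i (Inner.term j (cmono e g)) Outer.⊛ Outer.term k (Inner.term l (cmono f h))) a b
      ≈⟨ Outer.term-*-term i _ k _ a b ⟩
    Outer.term (i ℕ.+ k) (Inner.term j (cmono e g) Inner.⊛ Inner.term l (cmono f h)) a b
      ≈⟨ Outer.term-cong (i ℕ.+ k) (λ n → P.trans (Inner.term-*-term j _ l _ n)
           (Inner.term-cong (j ℕ.+ l) (cmono-* e f g h) n)) a b ⟩
    Outer.term (i ℕ.+ k) (Inner.term (j ℕ.+ l) (cmono (addE e f) (g *G h))) a b
      ≈⟨ curryP-cmono (i ℕ.+ k) (j ℕ.+ l) (addE e f) (g *G h) a b ⟨
    curryP (cmono ((i ℕ.+ k , j ℕ.+ l) ∷ addE e f) (g *G h)) a b ∎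

≡ᵇ-sym : ∀ a b → (a ℕ.≡ᵇ b) ≡ (b ℕ.≡ᵇ a)
≡ᵇ-sym zero    zero    = refl
≡ᵇ-sym zero    (suc b) = refl
≡ᵇ-sym (suc a) zero    = refl
≡ᵇ-sym (suc a) (suc b) = ≡ᵇ-sym a b

==E-sym : ∀ {u} (e f : Exp u) → (e ==E f) ≡ (f ==E e)
==E-sym []            []            = refl
==E-sym ((a , b) ∷ e) ((c , d) ∷ f) =
  cong₂ _∧_ (≡ᵇ-sym a c) (cong₂ _∧_ (≡ᵇ-sym b d) (==E-sym e f))

==E-refl : ∀ {u} (e : Exp u) → (e ==E e) ≡ true
==E-refl []            = refl
==E-refl ((a , b) ∷ e) = cong₂ _∧_ (same a) (cong₂ _∧_ (same b) (==E-refl e))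
  where
  same : ∀ a → (a ℕ.≡ᵇ a) ≡ true
  same zero    = refl
  same (suc a) = same a

==E-swap : ∀ {u} (e f : Exp u) → (e ==E Vec.map swap f) ≡ (Vec.map swap e ==E f)
==E-swap []            []            = refl
==E-swap ((a , b) ∷ e) ((c , d) ∷ f) with a ℕ.≡ᵇ d | b ℕ.≡ᵇ c
... | true  | true  = ==E-swap e f
... | true  | false = refl
... | false | true  = refl
... | false | false = refl

swap-zeroE : ∀ {u} → Vec.map swap (zeroE {u}) ≡ zeroE
swap-zeroE {zero}  = refl
swap-zeroE {suc u} = cong ((0 , 0) ∷_) swap-zeroE

swap-unitE : ∀ {u} (ℓ : Fin u) a b → Vec.map swap (unitE ℓ (a , b)) ≡ unitE ℓ (b , a)
swap-unitE Fin.zero    a b = cong (_ ∷_) swap-zeroE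
swap-unitE (Fin.suc ℓ) a b = cong (_ ∷_) (swap-unitE ℓ a b)

add-zeroE : ∀ {u} (e : Exp u) → addE zeroE e ≡ e
add-zeroE []      = refl
add-zeroE (x ∷ e) = cong (x ∷_) (add-zeroE e)

constP≈cmono : ∀ {u} g → constP {u} g ≈P cmono zeroE g
constP≈cmono g e = cong (λ b → if b then g else 0G) (==E-sym e zeroE)

conjP-cmono : ∀ {u} (e : Exp u) g → conjP (cmono e g) ≈P cmono (Vec.map swap e) (conjG g)
conjP-cmono e g f = trans (push (e ==E Vec.map swap f)) (cong (λ b → if b then conjG g else 0G) (==E-swap e f))
  where
  push : ∀ b → conjG (if b then g else 0G) ≡ (if b then conjG g else 0G)
  push true  = refl
  push false = refl

conjP-mono : ∀ {u} (e : Exp u) → conjP (mono e) ≈P mono (Vec.map swap e)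
conjP-mono e = conjP-cmono e 1G

conjP-const : ∀ {u} g → conjP (constP {u} g) ≈P constP (conjG g)
conjP-const {u} g = P.trans (λ e → cong conjG (constP≈cmono {u} g (Vec.map swap e)))
  (P.trans (conjP-cmono zeroE g) (λ e → trans (cong (λ z → cmono z (conjG g) e) swap-zeroE)
    (sym (constP≈cmono {u} (conjG g) e))))

const-*-cmono : ∀ {u} g (e : Exp u) h → (constP g *P cmono e h) ≈P cmono e (g *G h)
const-*-cmono {u} g e h = P.trans (P.*-congʳ {u} {cmono e h} {constP g} (constP≈cmono g))
  (P.trans (cmono-* zeroE e g h) (λ f → cong (λ z → cmono z (g *G h) f) (add-zeroE e)))

constP-* : ∀ {u} g h → (constP g *P constP h) ≈P constP {u} (g *G h)
constP-* {u} g h = P.trans (P.*-congˡ {u} {constP g} (constP≈cmono h)) (P.trans (const-*-cmono g zeroE h)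
  (λ e → sym (constP≈cmono {u} (g *G h) e)))

constP-+ : ∀ {u} g h → constP {u} (g +G h) ≈P (constP g +P constP h)
constP-+ g h e with e ==E zeroE
... | true  = refl
... | false = refl

constP-neg : ∀ {u} g → constP {u} (-G g) ≈P (-P constP g)
constP-neg g e with e ==E zeroE
... | true  = refl
... | false = refl

constP-0 : ∀ {u} → constP {u} 0G ≈P 0P
constP-0 e with e ==E zeroE
... | true  = refl
... | false = refl

-- Constants as pairs of Gaussian integers, where the multiplication table of the quaternion units
-- holds by computation; `qcQ` carries it to coefficient functions.
_+C_ _*C_ : QC → QC → QC
(a , b) +C (c , d) = (a +G c , b +G d)
(a , b) *C (c , d) = ((a *G c) +G (-G (b *G conjG d)) , (a *G d) +G (b *G conjG c))

-C_ conjC : QC → QC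
-C (a , b) = (-G a , -G b)
conjC (a , b) = (conjG a , -G b)

0C : QC
0C = (0G , 0G)

module Q {u : ℕ} where
  open Ring (quatRing u) public
  open IsStarRing (isStarRing-Q u) public
  open StarRing (isStarRing-Q u) public
  open StarMatrices (isStarRing-Q u) public

qcQ-+ : ∀ {u} x y → qcQ {u} (x +C y) ≈Q (qcQ x +Q qcQ y)
qcQ-+ (a , b) (c , d) = constP-+ a c , constP-+ b d

qcQ-* : ∀ {u} x y → qcQ {u} (x *C y) ≈Q (qcQ x *Q qcQ y)
qcQ-* {u} (a , b) (c , d) =
    P.trans (constP-+ (a *G c) _) (P.+-cong (P.sym (constP-* a c))
      (P.trans (constP-neg (b *G conjG d)) (P.-‿cong (P.trans (P.sym (constP-* b (conjG d)))
        (P.*-congˡ {u} {constP b} (P.sym (conjP-const d)))))))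
  , P.trans (constP-+ (a *G d) _) (P.+-cong (P.sym (constP-* a d))
      (P.trans (P.sym (constP-* b (conjG c))) (P.*-congˡ {u} {constP b} (P.sym (conjP-const c)))))

qcQ-conj : ∀ {u} x → qcQ {u} (conjC x) ≈Q conjQ (qcQ x)
qcQ-conj (a , b) = P.sym (conjP-const a) , constP-neg b

qcQ-neg : ∀ {u} x → qcQ {u} (-C x) ≈Q (-Q qcQ x)
qcQ-neg (a , b) = constP-neg a , constP-neg b

sgnC : Sgn → QC → QC
sgnC plus  x = x
sgnC minus x = -C x

qcQ-sgn : ∀ {u} s x → qcQ {u} (sgnC s x) ≈Q sgnQ s (qcQ x)
qcQ-sgn plus  x = Q.refl
qcQ-sgn minus x = qcQ-neg x

unitC : Unit4 → QC
unitC 𝟙 = (1G , 0G)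
unitC 𝕚 = (iG , 0G)
unitC 𝕛 = (0G , 1G)
unitC 𝕜 = (0G , iG)

unitQ≈qcQ : ∀ {u} ε → unitQ {u} ε ≈Q qcQ (unitC ε)
unitQ≈qcQ 𝟙 = P.refl , P.sym constP-0
unitQ≈qcQ 𝕚 = P.refl , P.sym constP-0
unitQ≈qcQ 𝕛 = P.sym constP-0 , P.refl
unitQ≈qcQ 𝕜 = P.sym constP-0 , P.refl

natQ≈qcQ : ∀ {u} n → natQ {u} n ≈Q qcQ (intQC (ℤ.+ n))
natQ≈qcQ n = P.refl , P.sym constP-0

sgnQ-cong : ∀ {u} s {x y : QP u} → x ≈Q y → sgnQ s x ≈Q sgnQ s y
sgnQ-cong plus  e = e
sgnQ-cong {u} minus {x} {y} e = Q.-‿cong {u} {x} {y} e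

unit-product : Unit4 → Unit4 → Sgn × Unit4
unit-product 𝟙 ε = plus , ε
unit-product ε 𝟙 = plus , ε
unit-product 𝕚 𝕚 = minus , 𝟙
unit-product 𝕚 𝕛 = plus , 𝕜
unit-product 𝕚 𝕜 = minus , 𝕛
unit-product 𝕛 𝕚 = minus , 𝕜
unit-product 𝕛 𝕛 = minus , 𝟙
unit-product 𝕛 𝕜 = plus , 𝕚
unit-product 𝕜 𝕚 = plus , 𝕛
unit-product 𝕜 𝕛 = minus , 𝕚
unit-product 𝕜 𝕜 = minus , 𝟙

unit-productC : ∀ ε ε′ → unitC ε *C unitC ε′ ≡ sgnC (proj₁ (unit-product ε ε′)) (unitC (proj₂ (unit-product ε ε′)))
unit-productC 𝟙 𝟙 = refl
unit-productC 𝟙 𝕚 = refl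
unit-productC 𝟙 𝕛 = refl
unit-productC 𝟙 𝕜 = refl
unit-productC 𝕚 𝟙 = refl
unit-productC 𝕚 𝕚 = refl
unit-productC 𝕚 𝕛 = refl
unit-productC 𝕚 𝕜 = refl
unit-productC 𝕛 𝟙 = refl
unit-productC 𝕛 𝕚 = refl
unit-productC 𝕛 𝕛 = refl
unit-productC 𝕛 𝕜 = refl
unit-productC 𝕜 𝟙 = refl
unit-productC 𝕜 𝕚 = refl
unit-productC 𝕜 𝕛 = refl
unit-productC 𝕜 𝕜 = refl

conj-sign : Unit4 → Sgn
conj-sign 𝟙 = plus
conj-sign _ = minus

unit-conjC : ∀ ε → conjC (unitC ε) ≡ sgnC (conj-sign ε) (unitC ε)
unit-conjC 𝟙 = refl
unit-conjC 𝕚 = refl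
unit-conjC 𝕛 = refl
unit-conjC 𝕜 = refl

unit-normC : ∀ ε → unitC ε *C conjC (unitC ε) ≡ (1G , 0G)
unit-normC 𝟙 = refl
unit-normC 𝕚 = refl
unit-normC 𝕛 = refl
unit-normC 𝕜 = refl

-- Signed units times monomials are closed under products and conjugation.

module Monomials {R : Ring 0ℓ 0ℓ} {_⋆ : Ring.Carrier R → Ring.Carrier R} (S : IsStarRing R _⋆)
  {E : Set} (unit : Unit4 → Ring.Carrier R) (monom : E → Ring.Carrier R) (_⊹_ : E → E → E) (conjE : E → E) where
  open Ring R renaming (trans to ≈-trans)
  open IsStarRing S
  open Signs S
  open import Relation.Binary.Reasoning.Setoid setoid

  -- The unit is kept on the left. A product regains this form by moving a monomial to the right
  -- past a unit, which exchanges the exponents of x and x* if the unit is j or k.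
  IsMonomial : Carrier → Set
  IsMonomial x = ∃[ s ] ∃[ ε ] ∃[ e ] (x ≈ signed s (unit ε * monom e))

  module Closure
    (unit-* : ∀ ε ε′ → (unit ε * unit ε′) ≈ signed (proj₁ (unit-product ε ε′)) (unit (proj₂ (unit-product ε ε′))))
    (unit-⋆ : ∀ ε → (unit ε ⋆) ≈ signed (conj-sign ε) (unit ε))
    (monom-* : ∀ e f → (monom e * monom f) ≈ monom (e ⊹ f))
    (monom-⋆ : ∀ e → (monom e ⋆) ≈ monom (conjE e))
    (monom-unit : ∀ e ε → ∃[ f ] ((monom e * unit ε) ≈ (unit ε * monom f))) where

    isMonomial-* : ∀ {x y} → IsMonomial x → IsMonomial y → IsMonomial (x * y)
    isMonomial-* {x} {y} (s , ε , e , p) (s′ , ε′ , f , q) =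
      let (e′ , r) = monom-unit e ε′
          (t , ε″) = unit-product ε ε′
      in (s · s′) · t , ε″ , e′ ⊹ f , (begin
      x * y
        ≈⟨ *-cong p q ⟩
      signed s (unit ε * monom e) * signed s′ (unit ε′ * monom f)
        ≈⟨ ≈-trans (signed-*ˡ s _ _) (≈-trans (signed-cong s (signed-*ʳ s′ _ _)) (signed-signed s s′ _)) ⟩
      signed (s · s′) ((unit ε * monom e) * (unit ε′ * monom f))
        ≈⟨ signed-cong (s · s′) (begin
          (unit ε * monom e) * (unit ε′ * monom f)     ≈⟨ *-assoc _ _ _ ⟩
          unit ε * (monom e * (unit ε′ * monom f))     ≈⟨ *-congˡ (*-assoc _ _ _) ⟨
          unit ε * ((monom e * unit ε′) * monom f)     ≈⟨ *-congˡ (*-congʳ r) ⟩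
          unit ε * ((unit ε′ * monom e′) * monom f)    ≈⟨ *-congˡ (*-assoc _ _ _) ⟩
          unit ε * (unit ε′ * (monom e′ * monom f))    ≈⟨ *-assoc _ _ _ ⟨
          (unit ε * unit ε′) * (monom e′ * monom f)    ≈⟨ *-cong (unit-* ε ε′) (monom-* e′ f) ⟩
          signed t (unit ε″) * monom (e′ ⊹ f)          ≈⟨ signed-*ˡ t _ _ ⟩
          signed t (unit ε″ * monom (e′ ⊹ f)) ∎) ⟩
      signed (s · s′) (signed t (unit ε″ * monom (e′ ⊹ f)))
        ≈⟨ signed-signed (s · s′) t _ ⟩
      signed ((s · s′) · t) (unit ε″ * monom (e′ ⊹ f)) ∎)

    isMonomial-⋆ : ∀ {x} → IsMonomial x → IsMonomial (x ⋆)
    isMonomial-⋆ {x} (s , ε , e , p) =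
      let (f , r) = monom-unit (conjE e) ε
      in s · conj-sign ε , ε , f , (begin
      x ⋆
        ≈⟨ ⋆-cong p ⟩
      signed s (unit ε * monom e) ⋆
        ≈⟨ signed-⋆ s _ ⟩
      signed s ((unit ε * monom e) ⋆)
        ≈⟨ signed-cong s (≈-trans (⋆-* _ _) (*-cong (monom-⋆ e) (unit-⋆ ε))) ⟩
      signed s (monom (conjE e) * signed (conj-sign ε) (unit ε))
        ≈⟨ signed-cong s (signed-*ʳ (conj-sign ε) _ _) ⟩
      signed s (signed (conj-sign ε) (monom (conjE e) * unit ε))
        ≈⟨ signed-signed s (conj-sign ε) _ ⟩
      signed (s · conj-sign ε) (monom (conjE e) * unit ε)
        ≈⟨ signed-cong (s · conj-sign ε) r ⟩
      signed (s · conj-sign ε) (unit ε * monom f) ∎)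

module Centre {R : Ring 0ℓ 0ℓ} {_⋆ : Ring.Carrier R → Ring.Carrier R} (S : IsStarRing R _⋆) where
  open Ring R renaming (sym to ≈-sym; trans to ≈-trans)
  open IsStarRing S
  open StarRing S
  open StarMatrices S

  central-0 : Central 0#
  central-0 x = ≈-trans (zeroˡ x) (≈-sym (zeroʳ x))

  central-+ : ∀ {a b} → Central a → Central b → Central (a + b)
  central-+ p q x = ≈-trans (distribʳ x _ _) (≈-trans (+-cong (p x) (q x)) (≈-sym (distribˡ x _ _)))

  central-* : ∀ {a b} → Central a → Central b → Central (a * b)
  central-* p q x = ≈-trans (*-assoc _ _ x) (≈-trans (*-congˡ (q x))
    (≈-trans (≈-sym (*-assoc _ x _)) (≈-trans (*-congʳ (p x)) (*-assoc x _ _))))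

  adjoint-* : ∀ {a b} → Central a → SelfAdjoint a → SelfAdjoint b → SelfAdjoint (a * b)
  adjoint-* c p q = ≈-trans (⋆-* _ _) (≈-trans (*-cong q p) (≈-sym (c _)))

  central-sum : ∀ {n} (f : Fin n → Carrier) → (∀ i → Central (f i)) → Central (sum f)
  central-sum {zero}  f c = central-0
  central-sum {suc n} f c = central-+ (c Fin.zero) (central-sum (f ∘ Fin.suc) (c ∘ Fin.suc))

  adjoint-sum : ∀ {n} (f : Fin n → Carrier) → (∀ i → SelfAdjoint (f i)) → SelfAdjoint (sum f)
  adjoint-sum f a = ≈-trans (⋆-sum f) (sum-cong a)

module _ {u : ℕ} where
  open Signs (isStarRing-Q u) using (signed)

  signed≡sgnQ : ∀ s (x : QP u) → signed s x ≡ sgnQ s x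
  signed≡sgnQ plus  x = refl
  signed≡sgnQ minus x = refl

  monoQ : Exp u → QP u
  monoQ e = (mono e , 0P)

  ΣQ≡sum : ∀ {n} (f : Fin n → QP u) → ΣQ f ≡ Q.sum f
  ΣQ≡sum {zero}  f = refl
  ΣQ≡sum {suc n} f = cong (f Fin.zero +Q_) (ΣQ≡sum (f ∘ Fin.suc))

  private
    drop-zero : ∀ (p q : Poly u) → (p +P (-P (q *P conjP 0P))) ≈P p
    drop-zero p q = P.trans (P.+-congˡ {u} {p} (P.trans (P.-‿cong (P.zeroʳ q)) neg-zero)) (P.+-identityʳ p)
      where
      neg-zero : (-P 0P) ≈P 0P {u}
      neg-zero e = refl

  complex-* : ∀ (p r : Poly u) → ((p , 0P) *Q (r , 0P)) ≈Q (p *P r , 0P)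
  complex-* p r = drop-zero (p *P r) 0P
                , P.trans (P.+-cong (P.zeroʳ p) (P.zeroˡ (conjP r))) (P.+-identityˡ 0P)

  complex-*-j : ∀ (p s : Poly u) → ((p , 0P) *Q (0P , s)) ≈Q (0P , p *P s)
  complex-*-j p s = P.trans (P.+-cong (P.zeroʳ p) (P.trans (P.-‿cong (P.zeroˡ (conjP s))) (λ e → refl))) (P.+-identityˡ 0P)
                  , P.trans (P.+-congˡ {u} {p *P s} (P.zeroˡ (conjP 0P))) (P.+-identityʳ (p *P s))

  j-*-complex : ∀ (q r : Poly u) → ((0P , q) *Q (r , 0P)) ≈Q (0P , q *P conjP r)
  j-*-complex q r = P.trans (drop-zero (0P *P r) q) (P.zeroˡ r)
                  , P.trans (P.+-congʳ {u} {q *P conjP r} (P.zeroˡ 0P)) (P.+-identityˡ (q *P conjP r))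

  open Q {u} using (Central; SelfAdjoint)

  -- Complex polynomials commute with each other, while passing j conjugates p; invariance under
  -- conjugation closes the gap. The numbers n and the |x_ℓ|² are of this kind, hence so is σ.
  real-central : ∀ {p : Poly u} → conjP p ≈P p → Central (p , 0P)
  real-central {p} real (r , t) =
      P.trans (P.+-cong (P.*-comm p r) (P.-‿cong (P.trans (P.zeroˡ (conjP t)) (P.sym (P.zeroʳ t))))) P.refl
    , P.trans (P.+-cong (P.*-comm p t) (P.zeroˡ (conjP r)))
        (P.trans (P.+-comm (t *P p) 0P)
          (P.+-cong (P.sym (P.zeroʳ r)) (P.*-congˡ {u} {t} (P.sym real))))

  real-adjoint : ∀ {p : Poly u} → conjP p ≈P p → SelfAdjoint (p , 0P)
  real-adjoint real = real , (λ e → refl)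

  natQ-real : ∀ n → conjP (constP {u} (ℤ.+ n , ℤ.+ 0)) ≈P constP (ℤ.+ n , ℤ.+ 0)
  natQ-real n = conjP-const (ℤ.+ n , ℤ.+ 0)

  square-real : ∀ ℓ → conjP (mono {u} (unitE ℓ (1 , 1))) ≈P mono (unitE ℓ (1 , 1))
  square-real ℓ e = trans (conjP-mono (unitE ℓ (1 , 1)) e) (cong (λ f → mono f e) (swap-unitE ℓ 1 1))

  module _ (s : Fin u → ℕ) where
    open Centre (isStarRing-Q u)

    σ-term : Fin u → QP u
    σ-term ℓ = natQ (s ℓ) *Q monoQ (unitE ℓ (1 , 1))

    σ-central : Central (σ s)
    σ-central = subst Central (sym (ΣQ≡sum σ-term)) (central-sum σ-term (λ ℓ →
      central-* {natQ (s ℓ)} {monoQ (unitE ℓ (1 , 1))}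
        (real-central {constP (ℤ.+ s ℓ , ℤ.+ 0)} (natQ-real (s ℓ)))
        (real-central {mono (unitE ℓ (1 , 1))} (square-real ℓ))))

    σ-adjoint : SelfAdjoint (σ s)
    σ-adjoint = subst SelfAdjoint (sym (ΣQ≡sum σ-term)) (adjoint-sum σ-term (λ ℓ →
      adjoint-* {natQ (s ℓ)} {monoQ (unitE ℓ (1 , 1))} (real-central {constP (ℤ.+ s ℓ , ℤ.+ 0)} (natQ-real (s ℓ)))
        (real-adjoint {constP (ℤ.+ s ℓ , ℤ.+ 0)} (natQ-real (s ℓ)))
        (real-adjoint {mono (unitE ℓ (1 , 1))} (square-real ℓ))))

  natQ-central : ∀ n → Central (natQ n)
  natQ-central n = real-central {constP (ℤ.+ n , ℤ.+ 0)} (natQ-real n)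

  natQ-adjoint : ∀ n → SelfAdjoint (natQ n)
  natQ-adjoint n = real-adjoint {constP (ℤ.+ n , ℤ.+ 0)} (natQ-real n)

  sgnC-signed : ∀ s x → qcQ {u} (sgnC s x) ≈Q signed s (qcQ x)
  sgnC-signed s x = subst (qcQ (sgnC s x) ≈Q_) (sym (signed≡sgnQ s (qcQ x))) (qcQ-sgn s x)

  open Signs (isStarRing-Q u) using (signed-cong)

  unitQ-* : ∀ ε ε′ → (unitQ {u} ε *Q unitQ ε′) ≈Q signed (proj₁ (unit-product ε ε′)) (unitQ (proj₂ (unit-product ε ε′)))
  unitQ-* ε ε′ = begin
    unitQ ε *Q unitQ ε′
      ≈⟨ Q.*-cong {u} {unitQ ε} {qcQ (unitC ε)} {unitQ ε′} {qcQ (unitC ε′)} (unitQ≈qcQ ε) (unitQ≈qcQ ε′) ⟩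
    qcQ (unitC ε) *Q qcQ (unitC ε′)
      ≈⟨ qcQ-* (unitC ε) (unitC ε′) ⟨
    qcQ (unitC ε *C unitC ε′)
      ≡⟨ cong qcQ (unit-productC ε ε′) ⟩
    qcQ (sgnC t (unitC ε″))
      ≈⟨ sgnC-signed t (unitC ε″) ⟩
    signed t (qcQ (unitC ε″))
      ≈⟨ signed-cong t {unitQ ε″} {qcQ (unitC ε″)} (unitQ≈qcQ ε″) ⟨
    signed t (unitQ ε″) ∎
    where
    open import Relation.Binary.Reasoning.Setoid (Q.setoid {u})
    t : Sgn
    t = proj₁ (unit-product ε ε′)
    ε″ : Unit4
    ε″ = proj₂ (unit-product ε ε′)

  unitQ-conj : ∀ ε → conjQ (unitQ {u} ε) ≈Q signed (conj-sign ε) (unitQ ε)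
  unitQ-conj ε = begin
    conjQ (unitQ ε)                        ≈⟨ Q.⋆-cong {u} {unitQ ε} {qcQ (unitC ε)} (unitQ≈qcQ ε) ⟩
    conjQ (qcQ (unitC ε))                  ≈⟨ qcQ-conj (unitC ε) ⟨
    qcQ (conjC (unitC ε))                  ≡⟨ cong qcQ (unit-conjC ε) ⟩
    qcQ (sgnC (conj-sign ε) (unitC ε))     ≈⟨ sgnC-signed (conj-sign ε) (unitC ε) ⟩
    signed (conj-sign ε) (qcQ (unitC ε))   ≈⟨ signed-cong (conj-sign ε) {unitQ ε} {qcQ (unitC ε)} (unitQ≈qcQ ε) ⟨
    signed (conj-sign ε) (unitQ ε) ∎
    where open import Relation.Binary.Reasoning.Setoid (Q.setoid {u})

  unitQ-norm : ∀ ε → (unitQ {u} ε *Q conjQ (unitQ ε)) ≈Q Q.1#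
  unitQ-norm ε = begin
    unitQ ε *Q conjQ (unitQ ε)
      ≈⟨ Q.*-cong {u} {unitQ ε} {qcQ (unitC ε)} {conjQ (unitQ ε)} {conjQ (qcQ (unitC ε))}
           (unitQ≈qcQ ε) (Q.⋆-cong {u} {unitQ ε} {qcQ (unitC ε)} (unitQ≈qcQ ε)) ⟩
    qcQ (unitC ε) *Q conjQ (qcQ (unitC ε))
      ≈⟨ Q.*-congˡ {u} {qcQ (unitC ε)} {qcQ (conjC (unitC ε))} {conjQ (qcQ (unitC ε))} (qcQ-conj (unitC ε)) ⟨
    qcQ (unitC ε) *Q qcQ (conjC (unitC ε))
      ≈⟨ qcQ-* (unitC ε) (conjC (unitC ε)) ⟨
    qcQ (unitC ε *C conjC (unitC ε))
      ≡⟨ cong qcQ (unit-normC ε) ⟩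
    qcQ (1G , 0G)
      ≈⟨ natQ≈qcQ 1 ⟨
    Q.1# ∎
    where open import Relation.Binary.Reasoning.Setoid (Q.setoid {u})

  monoQ-* : ∀ e f → (monoQ e *Q monoQ f) ≈Q monoQ (addE e f)
  monoQ-* e f = P.trans (proj₁ (complex-* (mono e) (mono f))) (cmono-* e f 1G 1G) , proj₂ (complex-* (mono e) (mono f))

  monoQ-conj : ∀ e → conjQ (monoQ e) ≈Q monoQ (Vec.map swap e)
  monoQ-conj e = conjP-mono e , (λ f → refl)

  monoQ-complex : ∀ e g → (monoQ e *Q (constP g , 0P)) ≈Q ((constP g , 0P) *Q monoQ e)
  monoQ-complex e g = begin
    monoQ e *Q (constP g , 0P)      ≈⟨ complex-* (mono e) (constP g) ⟩
    (mono e *P constP g , 0P)       ≈⟨ P.*-comm (mono e) (constP g) , P.refl ⟩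
    (constP g *P mono e , 0P)       ≈⟨ complex-* (constP g) (mono e) ⟨
    (constP g , 0P) *Q monoQ e ∎
    where open import Relation.Binary.Reasoning.Setoid (Q.setoid {u})

  monoQ-j : ∀ e g → (monoQ e *Q (0P , constP g)) ≈Q ((0P , constP g) *Q monoQ (Vec.map swap e))
  monoQ-j e g = begin
    monoQ e *Q (0P , constP g)                       ≈⟨ complex-*-j (mono e) (constP g) ⟩
    (0P , mono e *P constP g)                        ≈⟨ P.refl , P.*-comm (mono e) (constP g) ⟩
    (0P , constP g *P mono e)                        ≈⟨ P.refl , P.*-congˡ {u} {constP g} conj-swap ⟨
    (0P , constP g *P conjP (mono (Vec.map swap e))) ≈⟨ j-*-complex (constP g) (mono (Vec.map swap e)) ⟨
    (0P , constP g) *Q monoQ (Vec.map swap e) ∎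
    where
    open import Relation.Binary.Reasoning.Setoid (Q.setoid {u})
    conj-swap : conjP (mono (Vec.map swap e)) ≈P mono e
    conj-swap f = trans (conjP-mono (Vec.map swap e) f) (cong (λ z → mono z f) (map-swap² e))

  monoQ-unit : ∀ e ε → ∃[ f ] ((monoQ e *Q unitQ ε) ≈Q (unitQ ε *Q monoQ f))
  monoQ-unit e 𝟙 = e , monoQ-complex e 1G
  monoQ-unit e 𝕚 = e , monoQ-complex e iG
  monoQ-unit e 𝕛 = Vec.map swap e , monoQ-j e 1G
  monoQ-unit e 𝕜 = Vec.map swap e , monoQ-j e iG

module QMonomials (u : ℕ) where
  open Monomials (isStarRing-Q u) unitQ (monoQ {u}) addE (Vec.map swap) public
  open Closure unitQ-* unitQ-conj monoQ-* monoQ-conj monoQ-unit public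

-- Norms of entries, and the shape of entries in the two splits.

module UnitProducts {R : Ring 0ℓ 0ℓ} {_⋆ : Ring.Carrier R → Ring.Carrier R} (S : IsStarRing R _⋆) where
  open Ring R renaming (refl to ≈-refl; sym to ≈-sym; trans to ≈-trans)
  open IsStarRing S
  open StarMatrices S using (Central)
  open Signs S
  open import Relation.Binary.Reasoning.Setoid setoid

  -- (UV)(UV)⋆ = U μ U⋆ = μ UU⋆ = μ. The detour through `normal` brings the sign to where
  -- `signed-⋆*` squares it away.
  norm-unit : ∀ s {U V μ} → (U * (U ⋆)) ≈ 1# → (V * (V ⋆)) ≈ μ → Central μ →
              (signed s (U * V) * (signed s (U * V) ⋆)) ≈ μ
  norm-unit s {U} {V} {μ} u v central = begin
    signed s (U * V) * (signed s (U * V) ⋆)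
      ≈⟨ normal (signed s (U * V)) ⟨
    (signed s (U * V) ⋆) * signed s (U * V)
      ≈⟨ signed-⋆* s s (U * V) (U * V) ⟩
    signed (s · s) (((U * V) ⋆) * (U * V))
      ≡⟨ cong (λ t → signed t (((U * V) ⋆) * (U * V))) (square s) ⟩
    ((U * V) ⋆) * (U * V)
      ≈⟨ normal (U * V) ⟩
    (U * V) * ((U * V) ⋆)
      ≈⟨ *-congˡ (⋆-* U V) ⟩
    (U * V) * ((V ⋆) * (U ⋆))
      ≈⟨ ≈-trans (*-assoc _ _ _) (*-congˡ (≈-sym (*-assoc _ _ _))) ⟩
    U * ((V * (V ⋆)) * (U ⋆))
      ≈⟨ *-congˡ (≈-trans (*-congʳ v) (central (U ⋆))) ⟩
    U * ((U ⋆) * μ)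
      ≈⟨ *-assoc _ _ _ ⟨
    (U * (U ⋆)) * μ
      ≈⟨ ≈-trans (*-congʳ u) (*-identityˡ μ) ⟩
    μ ∎
    where
    square : ∀ s → s · s ≡ plus
    square plus  = refl
    square minus = refl

  -- `UnstableEntry` wants the constant between the unit and the monomial.
  central-inside : ∀ {k k′} U V → Central k → k ≈ k′ → (k * (U * V)) ≈ ((U * k′) * V)
  central-inside U V central e =
    ≈-trans (≈-sym (*-assoc _ U V)) (*-congʳ (≈-trans (central U) (*-congˡ e)))

  -- `StableEntry` wants σ on the right and a constant next to the unit; there o is α = 1.
  central-outside : ∀ {k o} U → Central k → 1# ≈ o → (k * U) ≈ ((U * o) * k)
  central-outside U central e =
    ≈-trans (central U) (*-congʳ (≈-trans (≈-sym (*-identityʳ U)) (*-congˡ e)))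

  rescale : ∀ s t {x k y z} → x ≈ signed s (k * y) → y ≈ signed t z → x ≈ signed (s · t) (k * z)
  rescale s t e f = ≈-trans e (≈-trans (signed-cong s (≈-trans (*-congˡ f) (signed-*ʳ t _ _))) (signed-signed s t _))

  quotient : ∀ s s′ c d {U U′ U″} → (U ⋆) ≈ signed c U → (U * U′) ≈ signed d U″ →
             ((signed s U ⋆) * signed s′ U′) ≈ signed (((s · s′) · c) · d) U″
  quotient s s′ c d {U} {U′} {U″} conj prod = begin
    (signed s U ⋆) * signed s′ U′                ≈⟨ signed-⋆* s s′ U U′ ⟩
    signed (s · s′) ((U ⋆) * U′)                 ≈⟨ signed-cong (s · s′) (≈-trans (*-congʳ conj) (signed-*ˡ c U U′)) ⟩
    signed (s · s′) (signed c (U * U′))          ≈⟨ signed-signed (s · s′) c (U * U′) ⟩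
    signed ((s · s′) · c) (U * U′)               ≈⟨ signed-cong ((s · s′) · c) prod ⟩
    signed ((s · s′) · c) (signed d U″)          ≈⟨ signed-signed ((s · s′) · c) d U″ ⟩
    signed (((s · s′) · c) · d) U″ ∎

  signed-inside : ∀ s x y → signed s (x * y) ≈ (x * signed s y)
  signed-inside s x y = ≈-sym (signed-*ʳ s x y)

  unstable-form : ∀ s t x k k′ y U V → Central k → k ≈ k′ → x ≈ signed s (k * y) → y ≈ signed t (U * V) →
                  x ≈ signed (s · t) ((U * k′) * V)
  unstable-form s t x k k′ y U V central e p q =
    ≈-trans (rescale s t p q) (signed-cong (s · t) (central-inside U V central e))

  stable-form : ∀ s t x k o y U → Central k → 1# ≈ o → x ≈ signed s (k * y) → y ≈ signed t U →
                x ≈ signed (s · t) ((U * o) * k)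
  stable-form s t x k o y U central e p q =
    ≈-trans (rescale s t p q) (signed-cong (s · t) (central-outside U central e))

  signed-form : ∀ t s x y z → x ≈ signed t y → y ≈ signed s z → x ≈ signed (t · s) z
  signed-form t s x y z p q = ≈-trans p (≈-trans (signed-cong t q) (signed-signed t s z))

  flip-block : ∀ x y → (((x ⋆) * y) ⋆) ≈ ((y ⋆) * x)
  flip-block x y = ≈-trans (⋆-* (x ⋆) y) (*-congˡ (⋆-⋆ x))

  flip-signed-block : ∀ s x y → (signed s ((x ⋆) * y) ⋆) ≈ ((y ⋆) * signed s x)
  flip-signed-block s x y = ≈-trans (signed-⋆ s _)
    (≈-trans (signed-cong s (flip-block x y)) (≈-sym (signed-*ʳ s (y ⋆) x)))

  open StarMatrices S using (sum; sum-cong)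

  signed-gram : ∀ {k n} (t t′ : Sgn) (f g : Fin k → Fin n → Carrier) →
    sum (λ i → sum (λ a → (signed t (f i a) ⋆) * signed t′ (g i a)))
      ≈ signed (t · t′) (sum (λ i → sum (λ a → (f i a ⋆) * g i a)))
  signed-gram t t′ f g = ≈-trans
    (sum-cong (λ i → ≈-trans (sum-cong (λ a → signed-⋆* t t′ (f i a) (g i a)))
                             (signed-sum (t · t′) (λ a → (f i a ⋆) * g i a))))
    (signed-sum (t · t′) (λ i → sum (λ a → (f i a ⋆) * g i a)))

  -- Reads a column Gram sum as the row Gram sum of the conjugated entries, the form that
  -- `block-gram` evaluates.
  double-⋆ : ∀ {k n} (f g : Fin k → Fin n → Carrier) →
    sum (λ i → sum (λ a → f i a * (g i a ⋆))) ≈ sum (λ i → sum (λ a → ((f i a ⋆) ⋆) * (g i a ⋆)))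
  double-⋆ f g = sum-cong (λ i → sum-cong (λ a → *-congʳ (≈-sym (⋆-⋆ (f i a)))))

  signed-gram-⋆ : ∀ {k n} (t t′ : Sgn) (f g : Fin k → Fin n → Carrier) →
    sum (λ i → sum (λ a → signed t (f i a) * (signed t′ (g i a) ⋆)))
      ≈ signed (t · t′) (sum (λ i → sum (λ a → ((f i a ⋆) ⋆) * (g i a ⋆))))
  signed-gram-⋆ t t′ f g = ≈-trans
    (sum-cong (λ i → sum-cong (λ a → *-cong (≈-trans (signed-cong t (≈-sym (⋆-⋆ (f i a)))) (≈-sym (signed-⋆ t (f i a ⋆))))
                                            (signed-⋆ t′ (g i a)))))
    (signed-gram t t′ (λ i a → f i a ⋆) (λ i a → g i a ⋆))

  sum-↑ : ∀ a {b} (f : Fin (a ℕ.+ b) → Carrier) → sum f ≈ sum (λ i → f (i Fin.↑ˡ b)) + sum (λ j → f (a Fin.↑ʳ j))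
  sum-↑ zero    f = ≈-sym (+-identityˡ _)
  sum-↑ (suc a) f = ≈-trans (+-congˡ (sum-↑ a (f ∘ Fin.suc))) (≈-sym (+-assoc _ _ _))

  sum-remQuot : ∀ k n (f : Fin k × Fin n → Carrier) →
                sum (λ r → f (Fin.remQuot {k} n r)) ≈ sum (λ i → sum (λ a → f (i , a)))
  sum-remQuot zero    n f = ≈-refl
  sum-remQuot (suc k) n f = ≈-trans (sum-↑ n (λ r → f (Fin.remQuot {suc k} n r)))
    (+-cong (sum-cong first) (≈-trans (sum-cong rest) (sum-remQuot k n (λ (i , a) → f (Fin.suc i , a)))))
    where
    first : ∀ a → f (Fin.remQuot {suc k} n (a Fin.↑ˡ (k ℕ.* n))) ≈ f (Fin.zero , a)
    first a rewrite Finₚ.splitAt-↑ˡ n a (k ℕ.* n) = ≈-refl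
    rest : ∀ r → f (Fin.remQuot {suc k} n (n Fin.↑ʳ r)) ≈
                 f (Fin.suc (proj₁ (Fin.remQuot {k} n r)) , proj₂ (Fin.remQuot {k} n r))
    rest r rewrite Finₚ.splitAt-↑ʳ n (k ℕ.* n) r = ≈-refl

-- The Hadamard condition in any number of indeterminates.

valC : HEntry → QC
valC (s , ε) = sgnC s (unitC ε)

module _ {u : ℕ} where
  valC-H : ∀ h → ⟦ h ⟧H ≈Q qcQ {u} (valC h)
  valC-H (s , ε) = Q.trans {u} {sgnQ s (unitQ ε)} {sgnQ s (qcQ (unitC ε))} {qcQ (sgnC s (unitC ε))}
    (sgnQ-cong s {unitQ ε} {qcQ (unitC ε)} (unitQ≈qcQ ε)) (Q.sym {u} {qcQ (sgnC s (unitC ε))} {sgnQ s (qcQ (unitC ε))} (qcQ-sgn s (unitC ε)))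

  qcQ-sum : ∀ {n} (f : Fin n → QC) → qcQ {u} (sumFin _+C_ 0C f) ≈Q Q.sum (λ i → qcQ (f i))
  qcQ-sum {zero}  f = constP-0 , constP-0
  qcQ-sum {suc n} f = Q.trans {u} {qcQ (f Fin.zero +C rest)} {qcQ (f Fin.zero) +Q qcQ rest} {qcQ (f Fin.zero) +Q Q.sum (λ i → qcQ (f (Fin.suc i)))}
    (qcQ-+ (f Fin.zero) rest) (Q.+-congˡ {u} {qcQ (f Fin.zero)} (qcQ-sum (f ∘ Fin.suc)))
    where
    rest : QC
    rest = sumFin _+C_ 0C (f ∘ Fin.suc)

  inner-productC : ∀ {n} (H : Fin n → Fin n → HEntry) → Fin n → Fin n → QC
  inner-productC H a b = sumFin _+C_ 0C (λ c → valC (H a c) *C conjC (valC (H b c)))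

  inner-product : ∀ {n} (H : Fin n → Fin n → HEntry) a b →
    Q.sum (λ c → ⟦ H a c ⟧H *Q conjQ ⟦ H b c ⟧H) ≈Q qcQ {u} (inner-productC H a b)
  inner-product H a b = begin
    Q.sum (λ c → ⟦ H a c ⟧H *Q conjQ ⟦ H b c ⟧H)
      ≈⟨ Q.sum-cong {u} {f = λ c → ⟦ H a c ⟧H *Q conjQ ⟦ H b c ⟧H} {λ c → qcQ (valC (H a c) *C conjC (valC (H b c)))} summand ⟩
    Q.sum (λ c → qcQ (valC (H a c) *C conjC (valC (H b c))))
      ≈⟨ qcQ-sum (λ c → valC (H a c) *C conjC (valC (H b c))) ⟨
    qcQ (inner-productC H a b) ∎
    where
    open import Relation.Binary.Reasoning.Setoid (Q.setoid {u})
    summand : ∀ c → (⟦ H a c ⟧H *Q conjQ ⟦ H b c ⟧H) ≈Q qcQ {u} (valC (H a c) *C conjC (valC (H b c)))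
    summand c = begin
      ⟦ H a c ⟧H *Q conjQ ⟦ H b c ⟧H
        ≈⟨ Q.*-cong {u} {⟦ H a c ⟧H} {qcQ (valC (H a c))} {conjQ ⟦ H b c ⟧H} {conjQ (qcQ (valC (H b c)))}
             (valC-H (H a c)) (Q.⋆-cong {u} {⟦ H b c ⟧H} {qcQ (valC (H b c))} (valC-H (H b c))) ⟩
      qcQ (valC (H a c)) *Q conjQ (qcQ (valC (H b c)))
        ≈⟨ Q.*-congˡ {u} {qcQ (valC (H a c))} {qcQ (conjC (valC (H b c)))} {conjQ (qcQ (valC (H b c)))} (qcQ-conj (valC (H b c))) ⟨
      qcQ (valC (H a c)) *Q qcQ (conjC (valC (H b c)))
        ≈⟨ qcQ-* (valC (H a c)) (conjC (valC (H b c))) ⟨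
      qcQ (valC (H a c) *C conjC (valC (H b c))) ∎

  natδ : ∀ n (b : Bool) → qcQ {u} (if b then intQC (ℤ.+ n) else 0C) ≈Q (if b then natQ n else 0Q)
  natδ n true  = P.refl , constP-0
  natδ n false = constP-0 , constP-0

qcQ-injective₀ : ∀ {x y} → qcQ {0} x ≈Q qcQ y → x ≡ y
qcQ-injective₀ (e , f) = cong₂ _,_ (e []) (f [])

-- For every u the inner products of rows of H are images of the same quaternion constants. Without
-- indeterminates a polynomial is a single coefficient, so the hypothesis identifies these
-- constants, and `qcQ` carries the equality to any u.
hadamard-rows : ∀ {u n} (H : Fin n → Fin n → HEntry) → IsQHadamard n H →
                Q.RowOrthogonal {u} (natQ n) (λ a b → ⟦ H a b ⟧H)
hadamard-rows {u} {n} H hadamard a b = begin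
  Q.sum (λ c → ⟦ H a c ⟧H *Q conjQ ⟦ H b c ⟧H)           ≈⟨ inner-product H a b ⟩
  qcQ (inner-productC {u} H a b)                         ≡⟨ cong qcQ (qcQ-injective₀ constants) ⟩
  qcQ (if a ==F b then intQC (ℤ.+ n) else 0C)            ≈⟨ natδ n (a ==F b) ⟩
  (if a ==F b then natQ n else 0Q) ∎
  where
  open import Relation.Binary.Reasoning.Setoid (Q.setoid {u})
  constants : qcQ {0} (inner-productC {u} H a b) ≈Q qcQ (if a ==F b then intQC (ℤ.+ n) else 0C)
  constants = Q.trans {0} {qcQ (inner-productC {u} H a b)} {Q.sum f} {qcQ (if a ==F b then intQC (ℤ.+ n) else 0C)}
    (Q.sym {0} {Q.sum f} {qcQ (inner-productC {u} H a b)} (inner-product H a b))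
    (Q.trans {0} {Q.sum f} {if a ==F b then natQ n else 0Q} {qcQ (if a ==F b then intQC (ℤ.+ n) else 0C)}
      (subst (_≈Q (if a ==F b then natQ n else 0Q)) (ΣQ≡sum f) (hadamard a b))
      (Q.sym {0} {qcQ (if a ==F b then intQC (ℤ.+ n) else 0C)} {if a ==F b then natQ n else 0Q} (natδ n (a ==F b))))
    where
    f : Fin n → QP 0
    f c = ⟦ H a c ⟧H *Q conjQ ⟦ H b c ⟧H

-- A full design has no zero entry.

sumFin-cong : ∀ {n} {A : Set} (_⊕_ : A → A → A) z {f g : Fin n → A} → (∀ i → f i ≡ g i) → sumFin _⊕_ z f ≡ sumFin _⊕_ z g
sumFin-cong {zero}  _⊕_ z e = refl
sumFin-cong {suc n} _⊕_ z e = cong₂ _⊕_ (e Fin.zero) (sumFin-cong _⊕_ z (e ∘ Fin.suc))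

add-unitE : ∀ {u} (ℓ : Fin u) a b c d → addE (unitE ℓ (a , b)) (unitE ℓ (c , d)) ≡ unitE ℓ (a ℕ.+ c , b ℕ.+ d)
add-unitE Fin.zero    a b c d = cong (_ ∷_) (add-zeroE zeroE)
add-unitE (Fin.suc ℓ) a b c d = cong (_ ∷_) (add-unitE ℓ a b c d)

-- The number of nonzero entries of a row is read off from the coefficients of the |x_ℓ|².
module _ {u : ℕ} where
  weight : QP u → ℤ
  weight x = sumFin ℤ._+_ (ℤ.+ 0) (λ ℓ → proj₁ (proj₁ x (unitE ℓ (1 , 1))))

  weight-cong : ∀ {x y} → x ≈Q y → weight x ≡ weight y
  weight-cong (e , _) = sumFin-cong ℤ._+_ (ℤ.+ 0) (λ ℓ → cong proj₁ (e (unitE ℓ (1 , 1))))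

sumFin-0 : ∀ n → sumFin {n} ℤ._+_ (ℤ.+ 0) (λ _ → ℤ.+ 0) ≡ ℤ.+ 0
sumFin-0 zero    = refl
sumFin-0 (suc n) = trans (ℤₚ.+-identityˡ _) (sumFin-0 n)

sumFin-+ : ∀ n (f g : Fin n → ℤ) → sumFin ℤ._+_ (ℤ.+ 0) (λ i → f i ℤ.+ g i) ≡ sumFin ℤ._+_ (ℤ.+ 0) f ℤ.+ sumFin ℤ._+_ (ℤ.+ 0) g
sumFin-+ zero    f g = refl
sumFin-+ (suc n) f g = trans (cong (λ x → (f Fin.zero ℤ.+ g Fin.zero) ℤ.+ x) (sumFin-+ n (f ∘ Fin.suc) (g ∘ Fin.suc)))
  (interchange (f Fin.zero) (g Fin.zero) _ _)
  where open import Algebra.Properties.CommutativeSemigroup ℤₚ.+-commutativeSemigroup using (interchange)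

module _ {u : ℕ} where
  weight-ΣQ : ∀ {n} (f : Fin n → QP u) → weight (ΣQ f) ≡ sumFin ℤ._+_ (ℤ.+ 0) (λ i → weight (f i))
  weight-ΣQ {zero}  f = sumFin-0 u
  weight-ΣQ {suc n} f = trans
    (sumFin-+ u (λ ℓ → proj₁ (proj₁ (f Fin.zero) (unitE ℓ (1 , 1)))) (λ ℓ → proj₁ (proj₁ (ΣQ (f ∘ Fin.suc)) (unitE ℓ (1 , 1)))))
    (cong (λ x → weight (f Fin.zero) ℤ.+ x) (weight-ΣQ (f ∘ Fin.suc)))

weight-square : ∀ {u} (ℓ : Fin u) g → sumFin ℤ._+_ (ℤ.+ 0) (λ ℓ′ → proj₁ (cmono (unitE ℓ (1 , 1)) g (unitE ℓ′ (1 , 1)))) ≡ proj₁ g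
weight-square {suc u} Fin.zero g = trans
  (cong₂ ℤ._+_ (cong (λ b → proj₁ (if b then g else 0G)) (==E-refl (zeroE {u}))) (sumFin-0 u)) (ℤₚ.+-identityʳ _)
weight-square {suc u} (Fin.suc ℓ) g = trans (ℤₚ.+-identityˡ _) (weight-square ℓ g)

sumFin-pos : ∀ {n} (w : Fin n → ℕ) → sumFin ℤ._+_ (ℤ.+ 0) (λ i → ℤ.+ w i) ≡ ℤ.+ ΣN w
sumFin-pos {zero}  w = refl
sumFin-pos {suc n} w = trans (cong (λ x → ℤ.+ w Fin.zero ℤ.+ x) (sumFin-pos (w ∘ Fin.suc))) (sym (ℤₚ.pos-+ (w Fin.zero) _))

module _ {u : ℕ} (s : Fin u → ℕ) where
  weight-σ : weight (σ s) ≡ ℤ.+ ΣN s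
  weight-σ = trans (weight-ΣQ (σ-term s)) (trans (sumFin-cong ℤ._+_ (ℤ.+ 0) term) (sumFin-pos s))
    where
    term : ∀ ℓ → weight (σ-term s ℓ) ≡ ℤ.+ s ℓ
    term ℓ = trans (weight-cong {x = σ-term s ℓ} {y = cmono (unitE ℓ (1 , 1)) ((ℤ.+ s ℓ , ℤ.+ 0) *G 1G) , 0P}
        (P.trans (proj₁ (complex-* (constP (ℤ.+ s ℓ , ℤ.+ 0)) (mono (unitE ℓ (1 , 1))))) (const-*-cmono (ℤ.+ s ℓ , ℤ.+ 0) (unitE ℓ (1 , 1)) 1G)
        , proj₂ (complex-* (constP (ℤ.+ s ℓ , ℤ.+ 0)) (mono (unitE ℓ (1 , 1))))))
      (trans (weight-square ℓ ((ℤ.+ s ℓ , ℤ.+ 0) *G 1G)) (cong proj₁ (G.*-identityʳ (ℤ.+ s ℓ , ℤ.+ 0))))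

support : ∀ {u} → QEntry u → ℕ
support zer           = 0
support (ent _ _ _ _) = 1

-- Sign, unit and conjugation drop out of the norm, so each nonzero entry contributes exactly one
-- |x_ℓ|² to its row.
entry-norm : ∀ {u} s ε (ℓ : Fin u) b →
  (⟦ ent s ε ℓ b ⟧E *Q conjQ ⟦ ent s ε ℓ b ⟧E) ≈Q monoQ (unitE ℓ (1 , 1))
entry-norm {u} s ε ℓ b = subst (λ x → (x *Q conjQ x) ≈Q μ) (signed≡sgnQ s (unitQ ε *Q varQ ℓ b))
  (norm-unit s {unitQ ε} {varQ ℓ b} {μ} (unitQ-norm {u} ε) (var-norm b) (real-central {p = mono (unitE ℓ (1 , 1))} (square-real ℓ)))
  where
  open UnitProducts (isStarRing-Q u) using (norm-unit)
  μ : QP u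
  μ = monoQ (unitE ℓ (1 , 1))
  product-norm : ∀ x y → (monoQ (unitE ℓ (x , y)) *Q conjQ (monoQ (unitE ℓ (x , y)))) ≈Q monoQ (unitE ℓ (x ℕ.+ y , y ℕ.+ x))
  product-norm x y = begin
    monoQ e *Q conjQ (monoQ e)       ≈⟨ Q.*-congˡ {u} {monoQ e} {conjQ (monoQ e)} {monoQ (Vec.map swap e)} (monoQ-conj e) ⟩
    monoQ e *Q monoQ (Vec.map swap e) ≈⟨ monoQ-* e (Vec.map swap e) ⟩
    monoQ (addE e (Vec.map swap e))  ≡⟨ cong monoQ (trans (cong (addE e) (swap-unitE ℓ x y)) (add-unitE ℓ x y y x)) ⟩
    monoQ (unitE ℓ (x ℕ.+ y , y ℕ.+ x)) ∎
    where
    open import Relation.Binary.Reasoning.Setoid (Q.setoid {u})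
    e : Exp u
    e = unitE ℓ (x , y)
  var-norm : ∀ b → (varQ ℓ b *Q conjQ (varQ ℓ b)) ≈Q μ
  var-norm false = product-norm 1 0
  var-norm true  = product-norm 0 1

weight-entry : ∀ {u} (x : QEntry u) → weight (⟦ x ⟧E *Q conjQ ⟦ x ⟧E) ≡ ℤ.+ support x
weight-entry {u} zer = trans (weight-cong {x = 0Q *Q conjQ 0Q} {y = 0Q} (Q.zeroˡ {u} (conjQ 0Q))) (sumFin-0 u)
weight-entry (ent s ε ℓ b) = trans
  (weight-cong {x = ⟦ ent s ε ℓ b ⟧E *Q conjQ ⟦ ent s ε ℓ b ⟧E} {y = monoQ (unitE ℓ (1 , 1))} (entry-norm s ε ℓ b))
  (weight-square ℓ 1G)

support≤1 : ∀ {u} (x : QEntry u) → support x ≤ 1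
support≤1 zer           = z≤n
support≤1 (ent _ _ _ _) = s≤s z≤n

all-ones : ∀ {n} (w : Fin n → ℕ) → (∀ i → w i ≤ 1) → ΣN w ≡ n → ∀ i → w i ≡ 1
all-ones {suc n} w w≤1 e = λ { Fin.zero → first ; (Fin.suc i) → all-ones (w ∘ Fin.suc) (w≤1 ∘ Fin.suc) rest i }
  where
  total≤ : ∀ {n} (w : Fin n → ℕ) → (∀ i → w i ≤ 1) → ΣN w ≤ n
  total≤ {zero}  w w≤1 = z≤n
  total≤ {suc n} w w≤1 = ℕₚ.+-mono-≤ (w≤1 Fin.zero) (total≤ (w ∘ Fin.suc) (w≤1 ∘ Fin.suc))
  first : w Fin.zero ≡ 1
  first = ℕₚ.≤-antisym (w≤1 Fin.zero) (ℕₚ.+-cancelʳ-≤ n 1 (w Fin.zero)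
    (subst (_≤ w Fin.zero ℕ.+ n) e (ℕₚ.+-monoʳ-≤ (w Fin.zero) (total≤ (w ∘ Fin.suc) (w≤1 ∘ Fin.suc)))))
  rest : ΣN (w ∘ Fin.suc) ≡ n
  rest = ℕₚ.suc-injective (trans (cong (ℕ._+ ΣN (w ∘ Fin.suc)) (sym first)) e)

-- The diagonal entry of XX* has as weight the number of nonzero entries in the row, while σ has
-- weight Σ s_ℓ = n; a row of n entries reaches n only if all are nonzero. This makes every entry of
-- X a signed unit times a monomial.
full-support : ∀ {u n} {s : Fin u → ℕ} {X : Fin n → Fin n → QEntry u} → IsFullQOD n s X → ∀ a c → support (X a c) ≡ 1
full-support {n = n} {s} {X} (qod , full) a = all-ones (λ c → support (X a c)) (λ c → support≤1 (X a c))
  (trans (ℤₚ.+-injective (begin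
    ℤ.+ ΣN (λ c → support (X a c))                                     ≡⟨ sumFin-pos (λ c → support (X a c)) ⟨
    sumFin ℤ._+_ (ℤ.+ 0) (λ c → ℤ.+ support (X a c))                   ≡⟨ sumFin-cong ℤ._+_ (ℤ.+ 0) (λ c → weight-entry (X a c)) ⟨
    sumFin ℤ._+_ (ℤ.+ 0) (λ c → weight (norm c))                       ≡⟨ weight-ΣQ norm ⟨
    weight (ΣQ norm)                                                   ≡⟨ weight-cong (qod a a) ⟩
    weight (if a ==F a then σ s else 0Q)                               ≡⟨ cong (λ b → weight (if b then σ s else 0Q)) (==F-refl a) ⟩
    weight (σ s)                                                       ≡⟨ weight-σ s ⟩
    ℤ.+ ΣN s ∎)) full)
  where
  open ≡.≡-Reasoning
  norm : Fin n → QP _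
  norm c = ⟦ X a c ⟧E *Q conjQ ⟦ X a c ⟧E

-- The two splits of X_(4n²).

module _ {u m : ℕ} (X : Fin (suc m) → Fin (suc m) → QEntry u) (H : Fin (suc m) → Fin (suc m) → HEntry) where
  open Construction X H using (kron)
  open import Data.Nat.DivMod using (_mod_)

  kron-sgnQ : ∀ Y p q → kron Y p q ≡
    sgnQ (if p ℕ.<ᵇ suc m then plus else (if q ℕ.<ᵇ suc m then plus else minus)) (Y (p mod suc m) (q mod suc m))
  kron-sgnQ Y p q with p ℕ.<ᵇ suc m | q ℕ.<ᵇ suc m
  ... | true  | true  = refl
  ... | true  | false = refl
  ... | false | true  = refl
  ... | false | false = refl

module Main {u m : ℕ} (s : Fin u → ℕ) (X : Fin (suc m) → Fin (suc m) → QEntry u) (H : Fin (suc m) → Fin (suc m) → HEntry)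
            (full : IsFullQOD (suc m) s X) (hadamard : IsQHadamard (suc m) H) where
  open Construction X H
  open Q {u} using (sum; RowOrthogonal; ColumnOrthogonal; δ-≢; columns-orthogonal)
  open Signs (isStarRing-Q u)
  open UnitProducts (isStarRing-Q u)
  open QMonomials u
  module BG = BlockGram (isStarRing-Q u) m
  module Cy = Cyclic m
  open import Relation.Binary.Reasoning.Setoid (Q.setoid {u})

  X-rows : RowOrthogonal (σ s) Xq
  X-rows a b = subst (_≈Q (if a ==F b then σ s else 0Q)) (ΣQ≡sum (λ c → Xq a c *Q conjQ (Xq b c))) (proj₁ full a b)

  H-rows : RowOrthogonal (natQ N) Hq
  H-rows = hadamard-rows H hadamard

  orthogonal : ∀ (Y : Fin N → Fin N → QP u) k → ColumnOrthogonal k Y →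
               ∀ {a b : Fin N} → a ≢ b → sum {N} (λ c → conjQ (Y c a) *Q Y c b) ≈Q 0Q
  orthogonal Y k cols {a} {b} a≢b =
    Q.trans {u} {sum {N} (λ c → conjQ (Y c a) *Q Y c b)} {Q.δ a b k} {0Q} (cols a b) (δ-≢ k a≢b)

  -- `Blocks` receives the matrix that supplies the factors y: X for [E A B], and H for the block
  -- column, because conjugation turns h_t* r_t into r_t* h_t. Reading down a column also transposes
  -- the positions.
  module Rows = BG.Blocks Xq
    (orthogonal Xq (σ s) (columns-orthogonal Xq (σ-central s) (σ-adjoint s) X-rows)) BG.rows-circulant
  module Cols = BG.Blocks Hq
    (orthogonal Hq (natQ N) (columns-orthogonal Hq (natQ-central N) (natQ-adjoint N) H-rows)) BG.columns-circulant

  kron-signed : ∀ Y p q → kron Y p q ≡ signed (BG.corner p q) (Y (fN p) (fN q))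
  kron-signed Y p q = trans (kron-sgnQ X H Y p q) (sym (signed≡sgnQ (BG.corner p q) (Y (fN p) (fN q))))

  reflected-block : ∀ (f : Fin N → QP u) t r (b : Bool) → (if b then f (fN r) else sgnQ t (f (fN (D ∸ r)))) ≡
                    signed (if b then plus else t) (f (fN (if b then r else D ∸ r)))
  reflected-block f t r true  = refl
  reflected-block f t r false = sym (signed≡sgnQ t (f (fN (D ∸ r))))

  circBlock-signed : ∀ t r a c → circBlock t r a c ≡ signed (BG.half t r) (C (Cy.fold r) a c)
  circBlock-signed t r a c = reflected-block (λ k → C k a c) t r (r ℕ.<ᵇ N)

  circBlock-row : ∀ t r a c → circBlock t r a c ≈Q (conjQ (Hq (Cy.fold r) a) *Q signed (BG.half t r) (Xq (Cy.fold r) c))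
  circBlock-row t r a c = subst (_≈Q (conjQ (Hq (Cy.fold r) a) *Q signed (BG.half t r) (Xq (Cy.fold r) c)))
    (sym (circBlock-signed t r a c))
    (signed-inside (BG.half t r) (conjQ (Hq (Cy.fold r) a)) (Xq (Cy.fold r) c))

  circBlock-col : ∀ t r a c → conjQ (circBlock t r a c) ≈Q (conjQ (Xq (Cy.fold r) c) *Q signed (BG.half t r) (Hq (Cy.fold r) a))
  circBlock-col t r a c = subst (λ z → conjQ z ≈Q (conjQ (Xq (Cy.fold r) c) *Q signed (BG.half t r) (Hq (Cy.fold r) a)))
    (sym (circBlock-signed t r a c))
    (flip-signed-block (BG.half t r) (Hq (Cy.fold r) a) (Xq (Cy.fold r) c))

  row-block : ∀ i a p → X4 (mid i a) p ≈Q (conjQ (Hq (Rows.block i p) a) *Q Rows.entry i p)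
  row-block i a (top q)   = Q.reflexive {u} (cong (conjQ (Hq Fin.zero a) *Q_) (kron-signed Xq (suc (toℕ i)) (toℕ q)))
  row-block i a (mid j c) = circBlock-row plus (shift i j) a c
  row-block i a (bot j c) = circBlock-row minus (shift i j) a c

  col-block : ∀ j c p → conjQ (X4 p (mid j c)) ≈Q (conjQ (Xq (Cols.block j p) c) *Q Cols.entry j p)
  col-block j c (top p)   = subst (λ z → conjQ (conjQ (Hh (suc (toℕ j)) (toℕ p)) *Q Xq Fin.zero c) ≈Q (conjQ (Xq Fin.zero c) *Q z))
    (kron-signed Hq (suc (toℕ j)) (toℕ p)) (flip-block (Hh (suc (toℕ j)) (toℕ p)) (Xq Fin.zero c))
  col-block j c (mid i a) = circBlock-col plus (shift i j) a c
  col-block j c (bot i a) = circBlock-col minus (shift i j) a c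

  ΣDN≡sum : ∀ f → ΣDN f ≡ sum (λ i → sum (λ a → f i a))
  ΣDN≡sum f = trans (ΣQ≡sum (λ i → ΣQ (f i))) (sum≡ (λ i → ΣQ≡sum (f i)))
    where
    sum≡ : ∀ {n} {f g : Fin n → QP u} → (∀ i → f i ≡ g i) → sum f ≡ sum g
    sum≡ {zero}  e = refl
    sum≡ {suc n} e = cong₂ _+Q_ (e Fin.zero) (sum≡ (e ∘ Fin.suc))

  -- [-E B A] arises from [E A B] by exchanging the last two block columns and negating the first,
  -- and the two block columns are related in the same way. The third block row and column thus
  -- inherit their splits from the second, up to signs.
  reflect : Idx m → Idx m
  reflect (top p)   = top p
  reflect (mid i a) = bot i a
  reflect (bot i a) = mid i a

  reflect-injective : ∀ {p q} → reflect p ≡ reflect q → p ≡ q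
  reflect-injective {p} {q} e = trans (sym (involutive p)) (trans (cong reflect e) (involutive q))
    where
    involutive : ∀ p → reflect (reflect p) ≡ p
    involutive (top p)   = refl
    involutive (mid i a) = refl
    involutive (bot i a) = refl

  parity-sign : Idx m → Sgn
  parity-sign (top _)   = minus
  parity-sign (mid _ _) = plus
  parity-sign (bot _ _) = plus

  bot-row : ∀ i a p → X4 (bot i a) p ≡ signed (parity-sign p) (X4 (mid i a) (reflect p))
  bot-row i a (top p)   = refl
  bot-row i a (mid j c) = refl
  bot-row i a (bot j c) = refl

  bot-col : ∀ j c p → X4 p (bot j c) ≡ signed (parity-sign p) (X4 (reflect p) (mid j c))
  bot-col j c (top p)   = refl
  bot-col j c (mid i a) = refl
  bot-col j c (bot i a) = refl

  rowSummand colSummand : Idx m → Idx m → Fin D → Fin N → QP u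
  rowSummand p q i a = conjQ (X4 (mid i a) p) *Q X4 (mid i a) q
  colSummand p q j c = conjQ (conjQ (X4 p (mid j c))) *Q conjQ (X4 q (mid j c))

  gramColsMid≈ : ∀ p q → gramColsMid p q ≈Q sum (λ j → sum (colSummand p q j))
  gramColsMid≈ p q = subst (_≈Q sum (λ j → sum (colSummand p q j)))
    (sym (ΣDN≡sum (λ j c → X4 p (mid j c) *Q conjQ (X4 q (mid j c)))))
    (double-⋆ (λ j c → X4 p (mid j c)) (λ j c → X4 q (mid j c)))

  α₁ β₁ α₂ β₂ : QC
  α₁ = intQC (ℤ.+ N)
  β₁ = intQC (ℤ.- (ℤ.+ N))
  α₂ = intQC (ℤ.+ 1)
  β₂ = intQC (ℤ.- (ℤ.+ 1))

  Unstable Stable : QP u → Set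
  Unstable = UnstableEntry α₁ β₁
  Stable = StableEntry s α₂ β₂

  unstable-signed : ∀ t x y → x ≈Q signed t y → Unstable y → Unstable x
  unstable-signed t x y e (s′ , ε , c , ex , f) = t · s′ , ε , c , ex ,
    subst (x ≈Q_) (signed≡sgnQ (t · s′) z) (signed-form t s′ x y z e (subst (y ≈Q_) (sym (signed≡sgnQ s′ z)) f))
    where
    z : QP u
    z = (unitQ ε *Q pick α₁ β₁ c) *Q (mono ex , 0P)

  stable-signed : ∀ t x y → x ≈Q signed t y → Stable y → Stable x
  stable-signed t x y e (s′ , ε , c , f) = t · s′ , ε , c ,
    subst (x ≈Q_) (signed≡sgnQ (t · s′) z) (signed-form t s′ x y z e (subst (y ≈Q_) (sym (signed≡sgnQ s′ z)) f))
    where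
    z : QP u
    z = (unitQ ε *Q pick α₂ β₂ c) *Q σ s

  entry-monomial : ∀ (x : QEntry u) → support x ≡ 1 → IsMonomial ⟦ x ⟧E
  entry-monomial (ent t ε ℓ false) _ = t , ε , unitE ℓ (1 , 0) , Q.reflexive {u} (sym (signed≡sgnQ t (unitQ ε *Q varQ ℓ false)))
  entry-monomial (ent t ε ℓ true)  _ = t , ε , unitE ℓ (0 , 1) , Q.reflexive {u} (sym (signed≡sgnQ t (unitQ ε *Q varQ ℓ true)))

  X-monomial : ∀ a c → IsMonomial (Xq a c)
  X-monomial a c = entry-monomial (X a c) (full-support {u} {N} {s} {X} full a c)

  X-quotient : ∀ a c a′ c′ → IsMonomial (conjQ (Xq a c) *Q Xq a′ c′)
  X-quotient a c a′ c′ = isMonomial-* {conjQ (Xq a c)} {Xq a′ c′} (isMonomial-⋆ {Xq a c} (X-monomial a c)) (X-monomial a′ c′)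

  H-quotient : ∀ h h′ → ∃[ t ] ∃[ ε ] ((conjQ ⟦ h ⟧H *Q ⟦ h′ ⟧H) ≈Q signed t (unitQ ε))
  H-quotient (t , ε) (t′ , ε′) = ((t · t′) · conj-sign ε) · proj₁ (unit-product ε ε′) , proj₂ (unit-product ε ε′) ,
    subst (_≈Q signed (((t · t′) · conj-sign ε) · proj₁ (unit-product ε ε′)) (unitQ (proj₂ (unit-product ε ε′))))
      (cong₂ (λ x y → conjQ x *Q y) (signed≡sgnQ t (unitQ ε)) (signed≡sgnQ t′ (unitQ ε′)))
      (quotient t t′ (conj-sign ε) (proj₁ (unit-product ε ε′)) {unitQ ε} {unitQ ε′} {unitQ (proj₂ (unit-product ε ε′))}
        (unitQ-conj ε) (unitQ-* ε ε′))

  rows-sum-unstable : ∀ p q → p ≢ q → Unstable (sum (λ i → sum (rowSummand p q i)))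
  rows-sum-unstable p q p≢q =
    let (t , a , c , a′ , c′ , e) = Rows.block-gram {natQ N} Hq (natQ-central N) H-rows (λ i a p → X4 (mid i a) p) row-block p q p≢q
        (t′ , ε , ex , f) = X-quotient a c a′ c′
        x = sum (λ i → sum (rowSummand p q i))
    -- The sign of the Gram product and that of the monomial are collected in the leading factor,
    -- next to the constant α = n that comes from HH* = nI.
    in t · t′ , ε , pα , ex , subst (x ≈Q_) (signed≡sgnQ (t · t′) ((unitQ ε *Q qcQ α₁) *Q monoQ ex))
         (unstable-form t t′ x (natQ N) (qcQ α₁) (conjQ (Xq a c) *Q Xq a′ c′) (unitQ ε) (monoQ ex) (natQ-central N) (natQ≈qcQ N) e f)

  columns-sum-stable : ∀ p q → p ≢ q → Stable (sum (λ j → sum (colSummand p q j)))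
  columns-sum-stable p q p≢q =
    let (t , a , c , a′ , c′ , e) = Cols.block-gram {σ s} Xq (σ-central s) X-rows (λ j c p → conjQ (X4 p (mid j c))) col-block p q p≢q
        (t′ , ε , f) = H-quotient (H a c) (H a′ c′)
        x = sum (λ j → sum (colSummand p q j))
    in t · t′ , ε , pα , subst (x ≈Q_) (signed≡sgnQ (t · t′) ((unitQ ε *Q qcQ α₂) *Q σ s))
         (stable-form t t′ x (σ s) (qcQ α₂) (conjQ (Hq a c) *Q Hq a′ c′) (unitQ ε) (σ-central s) (natQ≈qcQ 1) e f)

  rows-mid-unstable : ∀ p q → p ≢ q → Unstable (gramRowsMid p q)
  rows-mid-unstable p q p≢q = subst Unstable (sym (ΣDN≡sum (rowSummand p q))) (rows-sum-unstable p q p≢q)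

  columns-mid-stable : ∀ p q → p ≢ q → Stable (gramColsMid p q)
  columns-mid-stable p q p≢q = stable-signed plus (gramColsMid p q) (sum (λ j → sum (colSummand p q j)))
    (gramColsMid≈ p q) (columns-sum-stable p q p≢q)

  ΣDN-cong : ∀ {f g : Fin D → Fin N → QP u} → (∀ i a → f i a ≡ g i a) → ΣDN f ≡ ΣDN g
  ΣDN-cong e = sumFin-cong _+Q_ 0Q (λ i → sumFin-cong _+Q_ 0Q (e i))

  gramRowsBot≈ : ∀ p q → gramRowsBot p q ≈Q
    signed (parity-sign p · parity-sign q) (sum (λ i → sum (rowSummand (reflect p) (reflect q) i)))
  gramRowsBot≈ p q = subst (_≈Q signed (parity-sign p · parity-sign q) (sum (λ i → sum (rowSummand (reflect p) (reflect q) i))))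
    (sym (trans (ΣDN-cong (λ i a → cong₂ (λ x y → conjQ x *Q y) (bot-row i a p) (bot-row i a q)))
      (ΣDN≡sum (λ i a → conjQ (signed (parity-sign p) (X4 (mid i a) (reflect p))) *Q signed (parity-sign q) (X4 (mid i a) (reflect q))))))
    (signed-gram (parity-sign p) (parity-sign q) (λ i a → X4 (mid i a) (reflect p)) (λ i a → X4 (mid i a) (reflect q)))

  gramColsBot≈ : ∀ p q → gramColsBot p q ≈Q
    signed (parity-sign p · parity-sign q) (sum (λ j → sum (colSummand (reflect p) (reflect q) j)))
  gramColsBot≈ p q = subst (_≈Q signed (parity-sign p · parity-sign q) (sum (λ j → sum (colSummand (reflect p) (reflect q) j))))
    (sym (trans (ΣDN-cong (λ j c → cong₂ (λ x y → x *Q conjQ y) (bot-col j c p) (bot-col j c q)))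
      (ΣDN≡sum (λ j c → signed (parity-sign p) (X4 (reflect p) (mid j c)) *Q conjQ (signed (parity-sign q) (X4 (reflect q) (mid j c)))))))
    (signed-gram-⋆ (parity-sign p) (parity-sign q) (λ j c → X4 (reflect p) (mid j c)) (λ j c → X4 (reflect q) (mid j c)))

  rows-bot-unstable : ∀ p q → p ≢ q → Unstable (gramRowsBot p q)
  rows-bot-unstable p q p≢q = unstable-signed (parity-sign p · parity-sign q) (gramRowsBot p q)
    (sum (λ i → sum (rowSummand (reflect p) (reflect q) i))) (gramRowsBot≈ p q)
    (rows-sum-unstable (reflect p) (reflect q) (p≢q ∘ reflect-injective))

  columns-bot-stable : ∀ p q → p ≢ q → Stable (gramColsBot p q)
  columns-bot-stable p q p≢q = stable-signed (parity-sign p · parity-sign q) (gramColsBot p q)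
    (sum (λ j → sum (colSummand (reflect p) (reflect q) j))) (gramColsBot≈ p q)
    (columns-sum-stable (reflect p) (reflect q) (p≢q ∘ reflect-injective))

  -- The witness for splittability is the block row [E A B]: its (2n - 1)n rows, enumerated by a
  -- single index through quotient and remainder.
  mid-rows : Fin (D ℕ.* N) → Idx m
  mid-rows r = mid (proj₁ (Fin.remQuot {D} N r)) (proj₂ (Fin.remQuot {D} N r))

  mid-rows-injective : Injective mid-rows
  mid-rows-injective a b e = trans (sym (Finₚ.combine-remQuot {D} N a))
    (trans (cong (λ (i , c) → Fin.combine i c) (unmid e)) (Finₚ.combine-remQuot {D} N b))
    where
    unmid : ∀ {i i′ c c′} → mid {m} i c ≡ mid i′ c′ → (i , c) ≡ (i′ , c′)
    unmid refl = refl

  rowGram≈ : ∀ p q → rowGram X4 mid-rows p q ≈Q sum (λ i → sum (rowSummand p q i))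
  rowGram≈ p q = subst (_≈Q sum (λ i → sum (rowSummand p q i)))
    (sym (ΣQ≡sum (λ r → conjQ (X4 (mid-rows r) p) *Q X4 (mid-rows r) q)))
    (sum-remQuot D N (λ (i , a) → rowSummand p q i a))

  balancedly-splittable : BalancedlySplittable s X4
  balancedly-splittable = D ℕ.* N , mid-rows , α₁ , β₁ , mid-rows-injective , inj₁ (inj₁ (λ p q p≢q →
    unstable-signed plus (rowGram X4 mid-rows p q) (sum (λ i → sum (rowSummand p q i)))
      (rowGram≈ p q) (rows-sum-unstable p q p≢q)))

open import Data.Integer using (+_; -_)

mainTheorem6 : ∀ {u} (m : ℕ) (s : Fin u → ℕ)
    (X : Fin (suc m) → Fin (suc m) → QEntry u)
    (H : Fin (suc m) → Fin (suc m) → HEntry) →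
    IsFullQOD (suc m) s X → IsQHadamard (suc m) H →
    let open Construction X H in
    BalancedlySplittable s X4
    × (OffDiag (λ p q → UnstableEntry (intQC (+ suc m)) (intQC (- (+ suc m))) (gramRowsMid p q))
       × OffDiag (λ p q → UnstableEntry (intQC (+ suc m)) (intQC (- (+ suc m))) (gramRowsBot p q)))
    × (OffDiag (λ p q → StableEntry s (intQC (+ 1)) (intQC (- (+ 1))) (gramColsMid p q))
       × OffDiag (λ p q → StableEntry s (intQC (+ 1)) (intQC (- (+ 1))) (gramColsBot p q)))
mainTheorem6 m s X H full hadamard =
    balancedly-splittable
  , (rows-mid-unstable , rows-bot-unstable)
  , (columns-mid-stable , columns-bot-stable)
  where open Main s X H full hadamard
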